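{- Let $(W,\mathcal{S})$ be a finite Coxeter system, $c$ a Coxeter element, $m\ge0$, and $w,u\in\mathrm{Sort}^{(m)}(W,c)$. Then (1) $w\le u$ in right weak order if and only if $\mathrm{inv}(w)\subseteq\mathrm{inv}(u)$; and (2) $\mathrm{inv}(w\wedge u)=\mathrm{inv}(w)\cap\mathrm{inv}(u)$.
   Context: $B^+$ is the positive Artin monoid of $(W,\mathcal{S})$ (generated by $\mathcal{S}$ with the braid relations), with right weak order $u\le w$ iff $uv=w$ for some $v\in B^+$, a lattice with meet $\wedge$; $w_\circ$ is the longest element of $W$ and $W^{(m)}=\{w\in B^+:w\le w_\circ^m\}$. $\Phi^+$ is the set of positive roots of a root system for $W$ with simple roots $\alpha_s$. Colored positive roots are $\beta^{(k)}$, $\beta\in\Phi^+$, $k\ge0$; $s\in\mathcal{S}$ acts by $s(\beta^{(k)})=[s(\beta)]^{(k)}$ if $\beta\ne\alpha_s$, $s(\alpha_s^{(k)})=\alpha_s^{(k+1)}$. The colored inversion sequence of a word $s_1\cdots s_p$ has $i$-th entry $s_1(\cdots s_{i-1}(\alpha_{s_i}^{(0)}))$, and $\mathrm{inv}(w)$ for $w\in B^+$ is the set of entries of the colored inversion sequence of a word for $w$. A Coxeter element $c$ is a product of all simple reflections in some order; fix a reduced word $s_1\cdots s_n$. The $c$-sorting word of $w$ is the lexicographically first subword of $(s_1\cdots s_n)^\infty$ which is a reduced word for $w$; $w$ is $c$-sortable if the sets of positions used in successive copies of $s_1\cdots s_n$ form a weakly decreasing sequence. $\mathrm{Sort}^{(m)}(W,c)$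 is the set of $c$-sortable elements of $W^{(m)}$. -}

module Defs where

open import Data.Nat using (ℕ; zero; suc; _+_; _*_; _≤_; _<_)
open import Data.Fin using (Fin; toℕ)
open import Data.List using (List; []; _∷_; _++_; length; concat; replicate; map)
open import Data.List.Membership.Propositional using (_∈_)
open import Data.Product using (Σ; ∃; _×_; _,_)
open import Data.Sum using (_⊎_)
open import Relation.Nullary using (¬_)
open import Relation.Binary.PropositionalEquality using (_≡_; _≢_)
open import Relation.Binary.Construct.Closure.Equivalence using (EqClosure)

record CoxeterMatrix (n : ℕ) : Set where
  field
    m     : Fin n → Fin n → ℕ
    diag  : ∀ i → m i i ≡ 1
    symm  : ∀ i j → m i j ≡ m j i
    off   : ∀ i j → i ≢ j → 2 ≤ m i j

Word : ℕ → Set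
Word n = List (Fin n)

alt : ∀ {n} → Fin n → Fin n → ℕ → Word n
alt s t zero    = []
alt s t (suc k) = s ∷ alt t s k

module Coxeter {n : ℕ} (M : CoxeterMatrix n) where
  open CoxeterMatrix M

  data BraidStep : Word n → Word n → Set where
    braid : ∀ x y s t → BraidStep (x ++ alt s t (m s t) ++ y) (x ++ alt t s (m s t) ++ y)

  data CoxStep : Word n → Word n → Set where
    braid : ∀ x y s t → CoxStep (x ++ alt s t (m s t) ++ y) (x ++ alt t s (m s t) ++ y)
    quad  : ∀ x y s   → CoxStep (x ++ s ∷ s ∷ y) (x ++ y)

  -- equality in the positive Artin monoid B⁺ (words modulo braid relations)
  _≈B_ : Word n → Word n → Set
  _≈B_ = EqClosure BraidStep

  _≈W_ : Word n → Word n → Set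
  _≈W_ = EqClosure CoxStep

  _≤R_ : Word n → Word n → Set
  u ≤R w = ∃ λ v → (u ++ v) ≈B w

  IsMeet : Word n → Word n → Word n → Set
  IsMeet z w u = z ≤R w × z ≤R u × (∀ y → y ≤R w → y ≤R u → y ≤R z)

  Reduced : Word n → Set
  Reduced x = ∀ y → y ≈W x → length x ≤ length y

  IsLongest : Word n → Set
  IsLongest w0 = Reduced w0 × (∀ x → Reduced x → length x ≤ length w0)

  InWm : Word n → ℕ → Word n → Set
  InWm w0 k w = w ≤R concat (replicate k w0)

  -- Colored positive roots.  A positive root β is represented by the
  -- reflection t_β ∈ W (as a word), with α_s ↦ s and s(β) ↦ s t_β s.
  ColRoot : Set
  ColRoot = Word n × ℕ

  _≈C_ : ColRoot → ColRoot → Set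
  (t , k) ≈C (t' , k') = t ≈W t' × k ≡ k'

  ActC : Fin n → ColRoot → ColRoot → Set
  ActC s (t , k) r' =
      (t ≈W (s ∷ []) × r' ≈C (t , suc k))
    ⊎ ((¬ t ≈W (s ∷ [])) × r' ≈C ((s ∷ t ++ s ∷ []) , k))

  ApplyW : Word n → ColRoot → ColRoot → Set
  ApplyW []      r r'' = r ≈C r''
  ApplyW (s ∷ x) r r'' = ∃ λ r' → ApplyW x r r' × ActC s r' r''

  InInv : Word n → ColRoot → Set
  InInv w r = ∃ λ x → ∃ λ s → ∃ λ y →
      (w ≡ x ++ s ∷ y) × ApplyW x ((s ∷ []) , 0) r

  -- c-sorting.  The Coxeter element is given by a word c 0, c 1, …, c (n-1)
  -- (c injective, hence a permutation of S).  A position in c^∞ is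
  -- (k , i) = i-th letter of the k-th copy.
  Pos : Set
  Pos = ℕ × Fin n

  code : Pos → ℕ
  code (k , i) = k * n + toℕ i

  spell : (Fin n → Fin n) → List Pos → Word n
  spell c ps = map (λ { (k , i) → c i }) ps

  data Increasing : List Pos → Set where
    []  : Increasing []
    [_] : ∀ p → Increasing (p ∷ [])
    _∷_ : ∀ {p q ps} → code p < code q → Increasing (q ∷ ps) → Increasing (p ∷ q ∷ ps)

  data _≤Lex_ : List ℕ → List ℕ → Set where
    nil   : ∀ {ys} → [] ≤Lex ys
    here  : ∀ {x y xs ys} → x < y → (x ∷ xs) ≤Lex (y ∷ ys)
    there : ∀ {x xs ys} → xs ≤Lex ys → (x ∷ xs) ≤Lex (x ∷ ys)

  IsSortingWord : (Fin n → Fin n) → Word n → List Pos → Set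
  IsSortingWord c w ps =
    Increasing ps × spell c ps ≈B w ×
    (∀ qs → Increasing qs → spell c qs ≈B w → map code ps ≤Lex map code qs)

  Sortable : (Fin n → Fin n) → Word n → Set
  Sortable c w = ∃ λ ps → IsSortingWord c w ps ×
    (∀ k i → (suc k , i) ∈ ps → (k , i) ∈ ps)

  InSortm : (Fin n → Fin n) → Word n → ℕ → Word n → Set
  InSortm c w0 k w = Sortable c w × InWm w0 k w

{-# OPTIONS --safe #-}
module Submission where

-- A colored reflection β⁽ᵏ⁾ lies in inv(w) exactly when the reflection of β
-- occurs more than k times in the reflection sequence of w, so inv is a
-- multiset of reflections, and it is determined by the element of B⁺.
--
-- Sorted words obey the Cambrian recurrence: if r is the first letter of c,
-- a sorted word either starts with r, and its tail is sorted for the rotated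
-- c, or it avoids r.  The only hard case of the resulting induction compares
-- a word avoiding r with a word u starting with r.  It is settled by
-- restricting u to the parabolic subgroup W_J without r: the letters of u
-- whose reflection lies in W_J spell a word that is again sorted, has exactly
-- the reflections of u in W_J, and is a prefix of u in B⁺.
--
-- That the restriction is sorted follows from the invariance of the Euler
-- form of c under rotation.  That it is a prefix is clear for reduced words
-- (Matsumoto); in general one moves a letter of J to the front one simple
-- reflection at a time, the invariant being that W-equalities between reduced
-- sorted words lift to B⁺.
--
-- Root systems are built without real numbers: 2 cos (π / m) is replaced by
-- the adjacency operator of a path with m − 1 nodes, and nonnegativity by the
-- preservation of nonnegative functions.

-- The induction asks for less than a meet: a common prefix z of w and u, up to braid relations, in
-- which each reflection occurs at least as often as the smaller of its multiplicities in w and u.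
-- If inv(w) is contained in inv(u), such a z has all the reflections of w, and a prefix with no
-- fewer reflections is the whole element. Every meet lies above z, which gives the nontrivial
-- inclusion in (2).
--
-- The obstacle is that a sorted word need not be reduced in W. While u is read, a word b collects
-- the letters whose reflection lies outside W_J. A next letter s with b s = i b in W, i in J, has
-- to satisfy the same equality in B⁺, although b may be too long for Matsumoto's theorem.
--
-- The Euler form helps because it is triangular in the order of c. Against a multiple of the first
-- or last simple root it reads off a single coordinate, so facts about the order of letters become
-- vanishing coordinates of roots, where positivity applies.

open import Defs
open import Level using (0ℓ)
open import Algebra.Bundles using (AbelianGroup; CommutativeRing; RawRing)
import Algebra.Solver.Ring as RingSolver
import Algebra.Solver.Ring.AlmostCommutativeRing as ACR
open import Data.Empty using (⊥; ⊥-elim)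
open import Data.Fin using (Fin; zero; suc; toℕ)
import Data.Fin.Properties as Finₚ
open import Data.Fin.Properties using (_≟_)
import Data.Integer as ℤ
import Data.Integer.Properties as ℤₚ
open import Data.List using (List; []; _∷_; _++_; length; reverse; [_]; _∷ʳ_; allFin; filter; initLast; map; tabulate; _∷ʳ′_)
import Data.List.Properties as Lₚ
open import Data.List.Membership.Propositional using (_∈_; _∉_)
open import Data.List.Membership.Propositional.Properties using (∈-allFin; ∈-++⁺ˡ; ∈-++⁺ʳ; ∈-++⁻; ∈-∃++; ∈-filter⁺; ∈-filter⁻; ∈-tabulate⁺; ∈-tabulate⁻)
open import Data.List.Relation.Unary.All as All using (All; []; _∷_)
import Data.List.Relation.Unary.All.Properties as Allₚ
open import Data.List.Relation.Unary.AllPairs as AllPairs using (AllPairs; []; _∷_)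
import Data.List.Relation.Unary.AllPairs.Properties as AllPairsₚ
open import Data.List.Relation.Unary.Any using (here; there)
import Data.List.Relation.Unary.Any.Properties as Anyₚ
open import Data.List.Relation.Unary.Unique.Propositional using (Unique)
import Data.List.Relation.Unary.Unique.Propositional.Properties as Uniqueₚ
open import Data.List.Reverse using (Reverse; reverseView; _∶_∶ʳ_; [])
open import Data.Maybe using (Maybe; just; nothing)
open import Data.Nat as ℕ using (ℕ; zero; suc; _≤_; _<_; _⊓_; z≤n; s≤s)
import Data.Nat.Properties as ℕₚ
open import Data.Product using (_×_; _,_; proj₁; proj₂; ∃)
open import Data.Product.Properties using (≡-dec)
open import Data.Sum using (_⊎_; inj₁; inj₂)
open import Function using (_∘_)
open import Function.Definitions using (Injective)
open import Relation.Binary.PropositionalEquality as ≡ using (_≡_; _≢_)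
open import Relation.Binary.Structures using (IsEquivalence)
import Relation.Binary.Construct.Closure.Equivalence as Eq
import Relation.Binary.Reasoning.Setoid as SetoidReasoning
open import Relation.Nullary using (¬_; Dec; yes; no)
open import Relation.Unary using (Decidable)

-- A ring solver with integer coefficients.

-- The coefficient (a , b) stands for the integer a − b.
module IntegerCoefficientSolver (R : CommutativeRing 0ℓ 0ℓ) where
  open CommutativeRing R
  open import Algebra.Properties.Ring ring using (-‿distribˡ-*; -‿distribʳ-*; -‿+-comm)
  open import Algebra.Properties.Group +-group using (⁻¹-involutive; ε⁻¹≈ε)
  open import Algebra.Properties.CommutativeSemigroup +-commutativeSemigroup using (interchange)
  open import Algebra.Properties.Semiring.Mult semiring renaming (_×_ to _·_) using (×-homo-+; ×1-homo-*; ×-congˡ)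
  open import Relation.Binary.Reasoning.Setoid setoid

  private
    ι : ℕ → Carrier
    ι k = k · 1#

    reduce : ℕ × ℕ → ℕ × ℕ
    reduce (a , b) = (a ℕ.∸ b , b ℕ.∸ a)

    _+ᵈ_ _*ᵈ_ : ℕ × ℕ → ℕ × ℕ → ℕ × ℕ
    (a , b) +ᵈ (c , d) = (a ℕ.+ c , b ℕ.+ d)
    (a , b) *ᵈ (c , d) = (a ℕ.* c ℕ.+ b ℕ.* d , a ℕ.* d ℕ.+ b ℕ.* c)

    -ᵈ_ : ℕ × ℕ → ℕ × ℕ
    -ᵈ (a , b) = (b , a)

    -- Cancelling after each sum and product keeps one pair per integer; in particular zero is
    -- always (0 , 0), on which `value` computes.
    Difference : RawRing 0ℓ 0ℓ
    Difference = record
      { Carrier = ℕ × ℕ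
      ; _≈_ = _≡_
      ; _+_ = λ p q → reduce (p +ᵈ q)
      ; _*_ = λ p q → reduce (p *ᵈ q)
      ; -_ = -ᵈ_
      ; 0# = (0 , 0)
      ; 1# = (1 , 0)
      }

    diff : ℕ × ℕ → Carrier
    diff (a , b) = ι a - ι b

    -- Agrees with diff, but computes to 0# and 1# on the constants 0 and 1.
    value : ℕ × ℕ → Carrier
    value (0 , 0) = 0#
    value (1 , 0) = 1#
    value p = diff p

    value≈diff : ∀ p → value p ≈ diff p
    value≈diff (0 , 0) = sym (-‿inverseʳ 0#)
    value≈diff (1 , 0) = sym (trans (+-congˡ ε⁻¹≈ε) (trans (+-identityʳ _) (+-identityʳ 1#)))
    value≈diff (suc (suc a) , 0) = refl
    value≈diff (0 , suc b) = refl
    value≈diff (1 , suc b) = refl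
    value≈diff (suc (suc a) , suc b) = refl

    diff-+ : ∀ p q → diff (p +ᵈ q) ≈ diff p + diff q
    diff-+ (a , b) (c , d) = begin
      ι (a ℕ.+ c) - ι (b ℕ.+ d)          ≈⟨ +-cong (×-homo-+ 1# a c) (-‿cong (×-homo-+ 1# b d)) ⟩
      (ι a + ι c) - (ι b + ι d)          ≈⟨ +-congˡ (-‿+-comm (ι b) (ι d)) ⟨
      (ι a + ι c) + (- ι b + - ι d)      ≈⟨ interchange (ι a) (ι c) (- ι b) (- ι d) ⟩
      (ι a - ι b) + (ι c - ι d)          ∎

    diff-neg : ∀ p → diff (-ᵈ p) ≈ - diff p
    diff-neg (a , b) = begin
      ι b - ι a            ≈⟨ +-congʳ (⁻¹-involutive (ι b)) ⟨
      - - ι b + - ι a      ≈⟨ +-comm _ _ ⟩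
      - ι a + - - ι b      ≈⟨ -‿+-comm (ι a) (- ι b) ⟩
      - (ι a - ι b)        ∎

    difference-* : ∀ a b c d → (a * c + b * d) - (a * d + b * c) ≈ (a - b) * (c - d)
    difference-* a b c d = begin
      (a * c + b * d) - (a * d + b * c)
        ≈⟨ +-congˡ (-‿+-comm (a * d) (b * c)) ⟨
      (a * c + b * d) + (- (a * d) + - (b * c))
        ≈⟨ +-cong (+-congˡ (trans (sym (⁻¹-involutive _)) (-‿cong (-‿distribˡ-* b d)))) (+-cong (-‿distribʳ-* a d) (-‿distribˡ-* b c)) ⟩
      (a * c + - (- b * d)) + (a * - d + - b * c)
        ≈⟨ +-cong (+-congˡ (-‿distribʳ-* (- b) d)) (+-comm _ _) ⟩
      (a * c + - b * - d) + (- b * c + a * - d)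
        ≈⟨ interchange (a * c) (- b * - d) (- b * c) (a * - d) ⟩
      (a * c + - b * c) + (- b * - d + a * - d)
        ≈⟨ +-cong (distribʳ c a (- b)) (trans (distribʳ (- d) a (- b)) (+-comm _ _)) ⟨
      (a - b) * c + (a - b) * - d
        ≈⟨ distribˡ (a - b) c (- d) ⟨
      (a - b) * (c - d) ∎

    diff-* : ∀ p q → diff (p *ᵈ q) ≈ diff p * diff q
    diff-* (a , b) (c , d) = begin
      ι (a ℕ.* c ℕ.+ b ℕ.* d) - ι (a ℕ.* d ℕ.+ b ℕ.* c)
        ≈⟨ +-cong (expand a c b d) (-‿cong (expand a d b c)) ⟩
      (ι a * ι c + ι b * ι d) - (ι a * ι d + ι b * ι c)
        ≈⟨ difference-* (ι a) (ι b) (ι c) (ι d) ⟩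
      diff (a , b) * diff (c , d) ∎
      where
      expand : ∀ a c b d → ι (a ℕ.* c ℕ.+ b ℕ.* d) ≈ ι a * ι c + ι b * ι d
      expand a c b d = trans (×-homo-+ 1# (a ℕ.* c) (b ℕ.* d)) (+-cong (×1-homo-* a c) (×1-homo-* b d))

    diff-≡ : ∀ a b c d → a ℕ.+ d ≡ c ℕ.+ b → diff (a , b) ≈ diff (c , d)
    diff-≡ a b c d e = begin
      ι a - ι b                          ≈⟨ +-congʳ (+-identityʳ (ι a)) ⟨
      (ι a + 0#) - ι b                   ≈⟨ +-congʳ (+-congˡ (-‿inverseʳ (ι d))) ⟨
      (ι a + (ι d - ι d)) - ι b          ≈⟨ +-congʳ (+-assoc _ _ _) ⟨
      ((ι a + ι d) - ι d) - ι b          ≈⟨ +-congʳ (+-congʳ (trans (sym (×-homo-+ 1# a d)) (trans (×-congˡ e) (×-homo-+ 1# c b)))) ⟩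
      ((ι c + ι b) - ι d) - ι b          ≈⟨ +-assoc _ _ _ ⟩
      (ι c + ι b) + (- ι d + - ι b)      ≈⟨ interchange (ι c) (ι b) (- ι d) (- ι b) ⟩
      (ι c - ι d) + (ι b - ι b)          ≈⟨ +-congˡ (-‿inverseʳ (ι b)) ⟩
      (ι c - ι d) + 0#                   ≈⟨ +-identityʳ _ ⟩
      ι c - ι d                          ∎

    value-≡ : ∀ p q → Maybe (value p ≈ value q)
    value-≡ (a , b) (c , d) with a ℕ.+ d ℕ.≟ c ℕ.+ b
    ... | no _ = nothing
    ... | yes e = just (trans (value≈diff (a , b)) (trans (diff-≡ a b c d e) (sym (value≈diff (c , d)))))

    monus-+ : ∀ a b → a ℕ.∸ b ℕ.+ b ≡ a ℕ.+ (b ℕ.∸ a)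
    monus-+ zero b = ≡.cong (ℕ._+ b) (ℕₚ.0∸n≡0 b)
    monus-+ (suc a) zero = ≡.refl
    monus-+ (suc a) (suc b) = ≡.trans (ℕₚ.+-suc (a ℕ.∸ b) b) (≡.cong suc (monus-+ a b))

    value-reduce : ∀ p → value (reduce p) ≈ diff p
    value-reduce (a , b) = trans (value≈diff (reduce (a , b))) (diff-≡ (a ℕ.∸ b) (b ℕ.∸ a) a b (monus-+ a b))

    almost = ACR.fromCommutativeRing R

    morphism : Difference ACR.-Raw-AlmostCommutative⟶ almost
    morphism = record
      { ⟦_⟧ = value
      ; +-homo = λ p q → trans (value-reduce (p +ᵈ q)) (trans (diff-+ p q) (sym (+-cong (value≈diff p) (value≈diff q))))
      ; *-homo = λ p q → trans (value-reduce (p *ᵈ q)) (trans (diff-* p q) (sym (*-cong (value≈diff p) (value≈diff q))))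
      ; -‿homo = λ p → trans (value≈diff (-ᵈ p)) (trans (diff-neg p) (sym (-‿cong (value≈diff p))))
      ; 0-homo = refl
      ; 1-homo = refl
      }

  open RingSolver Difference almost morphism value-≡ public
    using (solve; _:=_; _:+_; _:*_; _:-_; :-_; con; Polynomial)

  :0 :1 : ∀ {k} → Polynomial k
  :0 = con (0 , 0)
  :1 = con (1 , 0)

-- Partially ordered rings of commuting operators.

-- Only a pointed cone is asked for, neither a total order nor a field. Hence the sign of a root has
-- to come from `descent`, and a coefficient is cancelled by exhibiting an inverse, as in
-- `Exchange`.
record ConeRing : Set₁ where
  field
    commutativeRing : CommutativeRing 0ℓ 0ℓ
  open CommutativeRing commutativeRing public
  field
    Nonneg        : Carrier → Set
    nonneg-resp   : ∀ {a b} → a ≈ b → Nonneg a → Nonneg b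
    nonneg-0      : Nonneg 0#
    nonneg-1      : Nonneg 1#
    nonneg-+      : ∀ {a b} → Nonneg a → Nonneg b → Nonneg (a + b)
    nonneg-*      : ∀ {a b} → Nonneg a → Nonneg b → Nonneg (a * b)
    nonneg-antisym : ∀ {a} → Nonneg a → Nonneg (- a) → a ≈ 0#
    1≉0           : ¬ 1# ≈ 0#

  -- In terms of θ with x = 2 cos θ, this is sin (k θ) / sin θ.
  chebyshev : Carrier → ℕ → Carrier
  chebyshev x 0 = 0#
  chebyshev x 1 = 1#
  chebyshev x (suc (suc k)) = x * chebyshev x (suc k) - chebyshev x k

chebyshevOperator : (A : AbelianGroup 0ℓ 0ℓ) → let open AbelianGroup A in (Carrier → Carrier) → ℕ → Carrier → Carrier
chebyshevOperator A f 0 v = AbelianGroup.ε A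
chebyshevOperator A f 1 v = v
chebyshevOperator A f (suc (suc k)) v = f (chebyshevOperator A f (suc k) v) ∙ chebyshevOperator A f k v ⁻¹
  where open AbelianGroup A

-- The operator `κ m` plays the part of 2 cos (π / m) for 2 ≤ m ≤ K: sin (m θ) / sin θ vanishes at θ
-- = π / m, and sin (k θ) / sin θ is nonnegative there for k ≤ m. By `generated` an operator is
-- determined by its values on the cone, which makes the cone of operators pointed.
record OperatorModule (K : ℕ) : Set₁ where
  field
    abelianGroup : AbelianGroup 0ℓ 0ℓ
  open AbelianGroup abelianGroup public
    renaming (_∙_ to _+_; ε to 0#; _⁻¹ to -_; ∙-cong to +-cong; ∙-congˡ to +-congˡ; ∙-congʳ to +-congʳ; ⁻¹-cong to -‿cong; assoc to +-assoc; comm to +-comm; identityˡ to +-identityˡ; identityʳ to +-identityʳ; inverseˡ to -‿inverseˡ; inverseʳ to -‿inverseʳ; commutativeSemigroup to +-commutativeSemigroup)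
    using (Carrier; _≈_; refl; sym; trans; setoid; group)
  field
    Nonneg    : Carrier → Set
    nonneg-resp : ∀ {v w} → v ≈ w → Nonneg v → Nonneg w
    nonneg-0  : Nonneg 0#
    nonneg-+  : ∀ {v w} → Nonneg v → Nonneg w → Nonneg (v + w)
    nonneg-antisym : ∀ {v} → Nonneg v → Nonneg (- v) → v ≈ 0#
    generated : ∀ v → ∃ λ p → ∃ λ q → Nonneg p × Nonneg q × v ≈ p + - q
    nontrivial : ∃ λ v → ¬ v ≈ 0#
    κ      : ℕ → Carrier → Carrier
    κ-cong : ∀ m {v w} → v ≈ w → κ m v ≈ κ m w
    κ-+    : ∀ m v w → κ m (v + w) ≈ κ m v + κ m w
    κ-comm : ∀ m m′ v → κ m (κ m′ v) ≈ κ m′ (κ m v)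

  U : ℕ → ℕ → Carrier → Carrier
  U m = chebyshevOperator abelianGroup (κ m)

  field
    U-vanish : ∀ m → 2 ≤ m → m ≤ K → ∀ v → U m m v ≈ 0#
    U-nonneg : ∀ m → 2 ≤ m → m ≤ K → ∀ k → k ≤ m → ∀ {v} → Nonneg v → Nonneg (U m k v)

module OperatorModuleProperties {K} (N : OperatorModule K) where
  open OperatorModule N
  open import Algebra.Properties.Group group using (identityʳ-unique; inverseʳ-unique)
  open import Algebra.Properties.AbelianGroup abelianGroup using (⁻¹-∙-comm)
  open import Algebra.Properties.CommutativeSemigroup +-commutativeSemigroup using (interchange)
  open import Relation.Binary.Reasoning.Setoid setoid

  record Additive (f : Carrier → Carrier) : Set where
    field
      cong : ∀ {v w} → v ≈ w → f v ≈ f w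
      +-homo : ∀ v w → f (v + w) ≈ f v + f w

    0-homo : f 0# ≈ 0#
    0-homo = identityʳ-unique (f 0#) (f 0#) (trans (sym (+-homo 0# 0#)) (cong (+-identityˡ 0#)))

    neg-homo : ∀ v → f (- v) ≈ - f v
    neg-homo v = inverseʳ-unique (f v) (f (- v)) (trans (sym (+-homo v (- v))) (trans (cong (-‿inverseʳ v)) 0-homo))

  κ-additive : ∀ m → Additive (κ m)
  κ-additive m = record { cong = κ-cong m ; +-homo = κ-+ m }

  -- Syntax is used because additivity and mutual commutation, which fail for arbitrary maps, then
  -- follow by induction. Equality in the ring is equality of the denoted operators.
  data Expr : Set where
    zero′ one′ : Expr
    κ′ : ℕ → Expr
    _+′_ _*′_ : Expr → Expr → Expr
    -′_ : Expr → Expr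

  ⟦_⟧ : Expr → Carrier → Carrier
  ⟦ zero′ ⟧ v = 0#
  ⟦ one′ ⟧ v = v
  ⟦ κ′ m ⟧ v = κ m v
  ⟦ a +′ b ⟧ v = ⟦ a ⟧ v + ⟦ b ⟧ v
  ⟦ a *′ b ⟧ v = ⟦ a ⟧ (⟦ b ⟧ v)
  ⟦ -′ a ⟧ v = - ⟦ a ⟧ v

  additive : ∀ a → Additive ⟦ a ⟧
  additive zero′ = record { cong = λ _ → refl ; +-homo = λ _ _ → sym (+-identityˡ 0#) }
  additive one′ = record { cong = λ e → e ; +-homo = λ _ _ → refl }
  additive (κ′ m) = κ-additive m
  additive (a +′ b) = record
    { cong = λ e → +-cong (Additive.cong (additive a) e) (Additive.cong (additive b) e)
    ; +-homo = λ v w → trans (+-cong (Additive.+-homo (additive a) v w) (Additive.+-homo (additive b) v w)) (interchange _ _ _ _) }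
  additive (a *′ b) = record
    { cong = λ e → Additive.cong (additive a) (Additive.cong (additive b) e)
    ; +-homo = λ v w → trans (Additive.cong (additive a) (Additive.+-homo (additive b) v w)) (Additive.+-homo (additive a) _ _) }
  additive (-′ a) = record
    { cong = λ e → -‿cong (Additive.cong (additive a) e)
    ; +-homo = λ v w → trans (-‿cong (Additive.+-homo (additive a) v w)) (sym (⁻¹-∙-comm _ _)) }

  commute-with : ∀ {f} → Additive f → (∀ m v → f (κ m v) ≈ κ m (f v)) → ∀ a v → f (⟦ a ⟧ v) ≈ ⟦ a ⟧ (f v)
  commute-with F h zero′ v = Additive.0-homo F
  commute-with F h one′ v = refl
  commute-with F h (κ′ m) v = h m v
  commute-with F h (a +′ b) v = trans (Additive.+-homo F _ _) (+-cong (commute-with F h a v) (commute-with F h b v))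
  commute-with F h (a *′ b) v = trans (commute-with F h a _) (Additive.cong (additive a) (commute-with F h b v))
  commute-with F h (-′ a) v = trans (Additive.neg-homo F _) (-‿cong (commute-with F h a v))

  commute : ∀ a b v → ⟦ a ⟧ (⟦ b ⟧ v) ≈ ⟦ b ⟧ (⟦ a ⟧ v)
  commute a = commute-with (additive a) λ m v → sym (commute-with (κ-additive m) (κ-comm m) a v)

  coneRing : ConeRing
  coneRing = record
    { commutativeRing = record
      { Carrier = Expr
      ; _≈_ = λ a b → ∀ v → ⟦ a ⟧ v ≈ ⟦ b ⟧ v
      ; _+_ = _+′_
      ; _*_ = _*′_
      ; -_ = -′_
      ; 0# = zero′
      ; 1# = one′
      ; isCommutativeRing = record
        { isRing = record
          { +-isAbelianGroup = record
            { isGroup = record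
              { isMonoid = record
                { isSemigroup = record
                  { isMagma = record
                    { isEquivalence = record
                      { refl = λ v → refl ; sym = λ e v → sym (e v) ; trans = λ e f v → trans (e v) (f v) }
                    ; ∙-cong = λ e f v → +-cong (e v) (f v) }
                  ; assoc = λ a b c v → +-assoc _ _ _ }
                ; identity = (λ a v → +-identityˡ _) , (λ a v → +-identityʳ _) }
              ; inverse = (λ a v → -‿inverseˡ _) , (λ a v → -‿inverseʳ _)
              ; ⁻¹-cong = λ e v → -‿cong (e v) }
            ; comm = λ a b v → +-comm _ _ }
          ; *-cong = λ {a} {b} {c} {d} e f v → trans (Additive.cong (additive a) (f v)) (e (⟦ d ⟧ v))
          ; *-assoc = λ a b c v → refl
          ; *-identity = (λ a v → refl) , (λ a v → refl)
          ; distrib = (λ a b c v → Additive.+-homo (additive a) _ _) , (λ a b c v → refl) }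
        ; *-comm = commute } }
    ; Nonneg = λ a → ∀ v → Nonneg v → Nonneg (⟦ a ⟧ v)
    ; nonneg-resp = λ e p v q → nonneg-resp (e v) (p v q)
    ; nonneg-0 = λ v q → nonneg-0
    ; nonneg-1 = λ v q → q
    ; nonneg-+ = λ p p′ v q → nonneg-+ (p v q) (p′ v q)
    ; nonneg-* = λ {a} {b} p p′ v q → p (⟦ b ⟧ v) (p′ v q)
    ; nonneg-antisym = λ {a} → antisym {a}
    ; 1≉0 = λ e → proj₂ nontrivial (e (proj₁ nontrivial))
    }
    where
    antisym : ∀ {a} → (∀ v → Nonneg v → Nonneg (⟦ a ⟧ v)) → (∀ v → Nonneg v → Nonneg (- ⟦ a ⟧ v)) → ∀ v → ⟦ a ⟧ v ≈ 0#
    antisym {a} p q v with generated v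
    ... | x , y , x≥0 , y≥0 , e = begin
      ⟦ a ⟧ v                   ≈⟨ Additive.cong (additive a) e ⟩
      ⟦ a ⟧ (x + - y)           ≈⟨ Additive.+-homo (additive a) x (- y) ⟩
      ⟦ a ⟧ x + ⟦ a ⟧ (- y)     ≈⟨ +-cong (nonneg-antisym (p x x≥0) (q x x≥0)) (trans (Additive.neg-homo (additive a) y) (-‿cong (nonneg-antisym (p y y≥0) (q y y≥0)))) ⟩
      0# + - 0#                 ≈⟨ -‿inverseʳ 0# ⟩
      0#                        ∎

  chebyshev-U : ∀ m k v → ⟦ ConeRing.chebyshev coneRing (κ′ m) k ⟧ v ≡ U m k v
  chebyshev-U m 0 v = ≡.refl
  chebyshev-U m 1 v = ≡.refl
  chebyshev-U m (suc (suc k)) v = ≡.cong₂ (λ x y → κ m x + - y) (chebyshev-U m (suc k) v) (chebyshev-U m k v)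

-- The adjacency operator of a path as a substitute for 2 cos (π / m).

-- Functions on the nodes 1, …, K of a path, with node suc i stored at the
-- argument i < K; the new operator is the adjacency operator of the path.
module PathExtension {K} (1≤K : 1 ≤ K) (N : OperatorModule K) where
  open OperatorModule N
  open OperatorModuleProperties N using (κ-additive; module Additive)
  open import Algebra.Properties.Group group using (⁻¹-involutive; ε⁻¹≈ε)
  open import Algebra.Properties.AbelianGroup abelianGroup using (⁻¹-∙-comm)
  open import Algebra.Properties.CommutativeSemigroup +-commutativeSemigroup using (interchange)
  open import Relation.Binary.Reasoning.Setoid setoid

  F : Set
  F = ℕ → Carrier

  functions : AbelianGroup 0ℓ 0ℓ
  functions = record
    { Carrier = F
    ; _≈_ = λ f g → ∀ i → i < K → f i ≈ g i
    ; _∙_ = λ f g i → f i + g i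
    ; ε = λ i → 0#
    ; _⁻¹ = λ f i → - f i
    ; isAbelianGroup = record
      { isGroup = record
        { isMonoid = record
          { isSemigroup = record
            { isMagma = record
              { isEquivalence = record
                { refl = λ i _ → refl ; sym = λ e i l → sym (e i l) ; trans = λ e e′ i l → trans (e i l) (e′ i l) }
              ; ∙-cong = λ e e′ i l → +-cong (e i l) (e′ i l) }
            ; assoc = λ f g h i _ → +-assoc _ _ _ }
          ; identity = (λ f i _ → +-identityˡ _) , (λ f i _ → +-identityʳ _) }
        ; inverse = (λ f i _ → -‿inverseˡ _) , (λ f i _ → -‿inverseʳ _)
        ; ⁻¹-cong = λ e i l → -‿cong (e i l) }
      ; comm = λ f g i _ → +-comm _ _ } }

  module A = AbelianGroup functions

  -- Reads a function by node number, with boundary value zero at node 0 and at all nodes beyond K,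
  -- so that `path` needs no case distinction at the two ends.
  at : F → ℕ → Carrier
  at f 0 = 0#
  at f (suc i) with i ℕₚ.<? K
  ... | yes _ = f i
  ... | no _ = 0#

  at-inside : ∀ f {i} → i < K → at f (suc i) ≡ f i
  at-inside f {i} l with i ℕₚ.<? K
  ... | yes _ = ≡.refl
  ... | no ¬l = ⊥-elim (¬l l)

  at-top : ∀ f → at f (suc K) ≡ 0#
  at-top f with K ℕₚ.<? K
  ... | yes l = ⊥-elim (ℕₚ.<-irrefl ≡.refl l)
  ... | no _ = ≡.refl

  at-cong : ∀ {f g} → f A.≈ g → ∀ a → at f a ≈ at g a
  at-cong e 0 = refl
  at-cong e (suc i) with i ℕₚ.<? K
  ... | yes l = e i l
  ... | no _ = refl

  at-+ : ∀ f g a → at (f A.∙ g) a ≈ at f a + at g a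
  at-+ f g 0 = sym (+-identityˡ 0#)
  at-+ f g (suc i) with i ℕₚ.<? K
  ... | yes l = refl
  ... | no _ = sym (+-identityˡ 0#)

  at-0 : ∀ a → at A.ε a ≈ 0#
  at-0 0 = refl
  at-0 (suc i) with i ℕₚ.<? K
  ... | yes l = refl
  ... | no _ = refl

  path : F → F
  path f i = at f i + at f (suc (suc i))

  path-cong : ∀ {f g} → f A.≈ g → path f A.≈ path g
  path-cong e i l = +-cong (at-cong e i) (at-cong e (suc (suc i)))

  path-+ : ∀ f g → path (f A.∙ g) A.≈ path f A.∙ path g
  path-+ f g i l = trans (+-cong (at-+ f g i) (at-+ f g (suc (suc i)))) (interchange _ _ _ _)

  path-neg : ∀ f → path (f A.⁻¹) A.≈ path f A.⁻¹
  path-neg f i l = trans (+-cong (neg i) (neg (suc (suc i)))) (⁻¹-∙-comm _ _)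
    where
    neg : ∀ a → at (f A.⁻¹) a ≈ - at f a
    neg 0 = sym ε⁻¹≈ε
    neg (suc i) with i ℕₚ.<? K
    ... | yes l = refl
    ... | no _ = sym ε⁻¹≈ε

  T : ℕ → F → F
  T = chebyshevOperator functions path

  T-step : ∀ f k {i} → i < K → at (T (2 ℕ.+ k) f) (suc i) ≈ (at (T (suc k) f) i + at (T (suc k) f) (2 ℕ.+ i)) + - at (T k f) (suc i)
  T-step f k {i} l = begin
    at (T (2 ℕ.+ k) f) (suc i)  ≡⟨ at-inside (T (2 ℕ.+ k) f) l ⟩
    path (T (suc k) f) i + - T k f i ≡⟨ ≡.cong (λ x → path (T (suc k) f) i + - x) (at-inside (T k f) l) ⟨
    path (T (suc k) f) i + - at (T k f) (suc i) ∎

  T-path : ∀ k f → T k (path f) A.≈ path (T k f)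
  T-path 0 f i l = sym (trans (+-cong (at-0 i) (at-0 (suc (suc i)))) (+-identityˡ 0#))
  T-path 1 f = A.refl
  T-path (suc (suc k)) f = A.trans (A.∙-cong (path-cong (T-path (suc k) f)) (A.⁻¹-cong (T-path k f)))
    (A.sym (A.trans (path-+ (path (T (suc k) f)) (T k f A.⁻¹)) (A.∙-congˡ (path-neg (T k f)))))

  swap-cancel : ∀ x y z → (x + (y + z)) + - y ≈ x + z
  swap-cancel x y z = begin
    (x + (y + z)) + - y      ≈⟨ +-assoc _ _ _ ⟩
    x + ((y + z) + - y)      ≈⟨ +-congˡ (+-congʳ (+-comm y z)) ⟩
    x + ((z + y) + - y)      ≈⟨ +-congˡ (+-assoc z y _) ⟩
    x + (z + (y + - y))      ≈⟨ +-congˡ (trans (+-congˡ (-‿inverseʳ y)) (+-identityʳ z)) ⟩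
    x + z ∎

  -- The discrete wave equation T (k+2) + T k = path (T (k+1)) propagates along diagonals.
  diagonal : ∀ f k a → suc a ℕ.+ suc k ≤ suc K → at (T (suc k) f) (suc a) ≈ at (T k f) a + at f (suc (a ℕ.+ k))
  diagonal f 0 a l = begin
    at f (suc a)               ≡⟨ ≡.cong (λ j → at f (suc j)) (ℕₚ.+-identityʳ a) ⟨
    at f (suc (a ℕ.+ 0))       ≈⟨ +-identityˡ _ ⟨
    0# + at f (suc (a ℕ.+ 0))  ≈⟨ +-congʳ (at-0 a) ⟨
    at (T 0 f) a + at f (suc (a ℕ.+ 0)) ∎
  diagonal f (suc k) a l = begin
    at (T (2 ℕ.+ k) f) (suc a)
      ≈⟨ T-step f k a<K ⟩
    (at (T (suc k) f) a + at (T (suc k) f) (2 ℕ.+ a)) + - at (T k f) (suc a)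
      ≈⟨ +-congʳ (+-congˡ (diagonal f k (suc a) (≡.subst (_≤ suc K) (ℕₚ.+-suc (suc a) (suc k)) l))) ⟩
    (at (T (suc k) f) a + (at (T k f) (suc a) + at f (suc (suc a ℕ.+ k)))) + - at (T k f) (suc a)
      ≈⟨ swap-cancel _ _ _ ⟩
    at (T (suc k) f) a + at f (suc (suc a ℕ.+ k))
      ≡⟨ ≡.cong (λ j → at (T (suc k) f) a + at f (suc j)) (ℕₚ.+-suc a k) ⟨
    at (T (suc k) f) a + at f (suc (a ℕ.+ suc k)) ∎
    where
    a<K : a < K
    a<K = ℕₚ.≤-trans (ℕₚ.m≤m+n (suc a) (suc k)) (ℕ.s≤s⁻¹ (≡.subst (_≤ suc K) (ℕₚ.+-suc (suc a) (suc k)) l))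

  -- This is `diagonal` for a = 0, where the boundary value vanishes. In matrix terms, the first row
  -- of the k-th Chebyshev polynomial of the path is the k-th unit row.
  at-node-1 : ∀ f k → k ≤ K → at (T k f) 1 ≈ at f k
  at-node-1 f 0 l = at-0 1
  at-node-1 f (suc k) l = trans (diagonal f k 0 (s≤s l)) (+-identityˡ _)

  -- An operator commuting with path is determined by its values at the nodes 0 and 1.
  T-column : ∀ f k a → suc a ≤ K → at (T k f) (2 ℕ.+ a) ≈ at (T k (path f)) (suc a) + - at (T k f) a
  T-column f k a l = sym (begin
    at (T k (path f)) (suc a) + - at (T k f) a
      ≈⟨ +-congʳ (at-cong (T-path k f) (suc a)) ⟩
    at (path (T k f)) (suc a) + - at (T k f) a
      ≡⟨ ≡.cong (_+ - at (T k f) a) (at-inside (path (T k f)) l) ⟩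
    (at (T k f) a + at (T k f) (2 ℕ.+ a)) + - at (T k f) a
      ≈⟨ trans (+-congʳ (sym (+-identityˡ _))) (swap-cancel 0# (at (T k f) a) _) ⟩
    0# + at (T k f) (2 ℕ.+ a)
      ≈⟨ +-identityˡ _ ⟩
    at (T k f) (2 ℕ.+ a) ∎)

  -- The K-th polynomial acts as the flip of the path: both commute with `path` and agree at the
  -- nodes 0 and 1, and `T-column` carries the equality along the path.
  T-K : ∀ f a a′ → a ℕ.+ a′ ≡ suc K → at (T K f) a ≈ at f a′
  T-K f 0 _ ≡.refl = sym (reflexive (at-top f))
    where open AbelianGroup abelianGroup using (reflexive)
  T-K f 1 _ ≡.refl = at-node-1 f K ℕₚ.≤-refl
  T-K f (suc (suc a)) a′ e = begin
    at (T K f) (2 ℕ.+ a)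
      ≈⟨ T-column f K a a<K ⟩
    at (T K (path f)) (suc a) + - at (T K f) a
      ≈⟨ +-cong (T-K (path f) (suc a) (suc a′) (≡.trans (≡.cong suc (ℕₚ.+-suc a a′)) e)) (-‿cong (T-K f a (2 ℕ.+ a′) (≡.trans (ℕₚ.+-suc a (suc a′)) (≡.trans (≡.cong suc (ℕₚ.+-suc a a′)) e)))) ⟩
    at (path f) (suc a′) + - at f (2 ℕ.+ a′)
      ≡⟨ ≡.cong (_+ - at f (2 ℕ.+ a′)) (at-inside (path f) a′<K) ⟩
    (at f a′ + at f (2 ℕ.+ a′)) + - at f (2 ℕ.+ a′)
      ≈⟨ trans (+-assoc _ _ _) (trans (+-congˡ (-‿inverseʳ _)) (+-identityʳ _)) ⟩
    at f a′ ∎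
    where
    e′ : suc (a ℕ.+ a′) ≡ K
    e′ = ℕₚ.suc-injective e
    a<K : a < K
    a<K = ≡.subst (a <_) e′ (s≤s (ℕₚ.m≤m+n a a′))
    a′<K : a′ < K
    a′<K = ≡.subst (a′ <_) e′ (s≤s (ℕₚ.m≤n+m a′ a))

  T-vanish-1 : ∀ f k → K ≡ suc k → at (T (suc K) f) 1 ≈ 0#
  T-vanish-1 f k eq = begin
    at (T (suc K) f) 1
      ≡⟨ ≡.cong (λ j → at (T (suc j) f) 1) eq ⟩
    at (T (2 ℕ.+ k) f) 1
      ≈⟨ T-step f k 1≤K ⟩
    (0# + at (T (suc k) f) 2) + - at (T k f) 1
      ≈⟨ +-cong (trans (+-identityˡ _) (≡.subst (λ j → at (T j f) 2 ≈ at f k) eq (T-K f 2 k (≡.cong suc (≡.sym eq))))) (-‿cong (at-node-1 f k (≡.subst (k ≤_) (≡.sym eq) (ℕₚ.n≤1+n k)))) ⟩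
    at f k + - at f k
      ≈⟨ -‿inverseʳ _ ⟩
    0# ∎

  -- Cayley-Hamilton for the path, whose characteristic polynomial this is. The operator commutes
  -- with `path`, so its vanishing at the nodes 0 and 1 spreads to all others.
  T-vanish : ∀ f a → a ≤ suc K → at (T (suc K) f) a ≈ 0#
  T-vanish f 0 l = refl
  T-vanish f 1 l = T-vanish-1 f (ℕ.pred K) (≡.sym (ℕₚ.suc-pred K ⦃ ℕ.>-nonZero 1≤K ⦄))
  T-vanish f (suc (suc a)) l = begin
    at (T (suc K) f) (2 ℕ.+ a)
      ≈⟨ T-column f (suc K) a (ℕ.s≤s⁻¹ l) ⟩
    at (T (suc K) (path f)) (suc a) + - at (T (suc K) f) a
      ≈⟨ +-cong (T-vanish (path f) (suc a) (ℕₚ.≤-trans (ℕₚ.n≤1+n _) l)) (-‿cong (T-vanish f a (ℕₚ.≤-trans (ℕₚ.n≤1+n _) (ℕₚ.≤-trans (ℕₚ.n≤1+n _) l)))) ⟩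
    0# + - 0#
      ≈⟨ -‿inverseʳ 0# ⟩
    0# ∎

  -- The polynomials k and K + 1 - k differ by the flip of the path, as sin ((K + 1 - k) θ) = ± sin
  -- (k θ) at the eigenvalues 2 cos θ. Both sides obey the same recursion, started by `T-vanish` and
  -- `T-K`.
  T-symmetry : ∀ f k k′ → k ℕ.+ k′ ≡ suc K → ∀ a a′ → a ℕ.+ a′ ≡ suc K → at (T k f) a ≈ at (T k′ f) a′
  T-symmetry f 0 _ ≡.refl a a′ e = trans (at-0 a) (sym (T-vanish f a′ (≡.subst (a′ ≤_) e (ℕₚ.m≤n+m a′ a))))
  T-symmetry f 1 _ ≡.refl a a′ e = sym (T-K f a′ a (≡.trans (ℕₚ.+-comm a′ a) e))
  T-symmetry f (suc (suc k)) k′ ek 0 _ ≡.refl = sym (AbelianGroup.reflexive abelianGroup (at-top (T k′ f)))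
  T-symmetry f (suc (suc k)) k′ ek (suc a) 0 e with ≡.trans (≡.sym (ℕₚ.+-identityʳ a)) (ℕₚ.suc-injective e)
  ... | ≡.refl = AbelianGroup.reflexive abelianGroup (at-top (T (2 ℕ.+ k) f))
  T-symmetry f (suc (suc k)) k′ ek (suc a) (suc a′) e = begin
    at (T (2 ℕ.+ k) f) (suc a)
      ≈⟨ T-step f k a<K ⟩
    (at (T (suc k) f) a + at (T (suc k) f) (2 ℕ.+ a)) + - at (T k f) (suc a)
      ≈⟨ +-cong (+-cong (T-symmetry f (suc k) (suc k′) ek₁ a (2 ℕ.+ a′) (≡.trans (ℕₚ.+-suc a (suc a′)) e)) (T-symmetry f (suc k) (suc k′) ek₁ (2 ℕ.+ a) a′ (≡.trans (≡.cong suc (≡.sym (ℕₚ.+-suc a a′))) e))) (-‿cong (T-symmetry f k (2 ℕ.+ k′) ek₂ (suc a) (suc a′) e)) ⟩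
    (at (T (suc k′) f) (2 ℕ.+ a′) + at (T (suc k′) f) a′) + - at (T (2 ℕ.+ k′) f) (suc a′)
      ≈⟨ +-cong (+-comm _ _) (-‿cong (T-step f k′ a′<K)) ⟩
    (at (T (suc k′) f) a′ + at (T (suc k′) f) (2 ℕ.+ a′)) + - ((at (T (suc k′) f) a′ + at (T (suc k′) f) (2 ℕ.+ a′)) + - at (T k′ f) (suc a′))
      ≈⟨ +-congˡ (trans (sym (⁻¹-∙-comm _ _)) (+-congˡ (⁻¹-involutive _))) ⟩
    (at (T (suc k′) f) a′ + at (T (suc k′) f) (2 ℕ.+ a′)) + (- (at (T (suc k′) f) a′ + at (T (suc k′) f) (2 ℕ.+ a′)) + at (T k′ f) (suc a′))
      ≈⟨ trans (sym (+-assoc _ _ _)) (trans (+-congʳ (-‿inverseʳ _)) (+-identityˡ _)) ⟩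
    at (T k′ f) (suc a′) ∎
    where
    e′ : a ℕ.+ suc a′ ≡ K
    e′ = ℕₚ.suc-injective e
    a<K : a < K
    a<K = ≡.subst (a <_) (≡.trans (≡.sym (ℕₚ.+-suc a a′)) e′) (s≤s (ℕₚ.m≤m+n a a′))
    a′<K : a′ < K
    a′<K = ≡.subst (a′ <_) e′ (ℕₚ.m≤n+m (suc a′) a)
    ek₁ : suc k ℕ.+ suc k′ ≡ suc K
    ek₁ = ≡.trans (≡.cong suc (ℕₚ.+-suc k k′)) ek
    ek₂ : k ℕ.+ (2 ℕ.+ k′) ≡ suc K
    ek₂ = ≡.trans (ℕₚ.+-suc k (suc k′)) ek₁

  NonnegF : F → Set
  NonnegF f = ∀ i → i < K → Nonneg (f i)

  at-nonneg : ∀ {f} → NonnegF f → ∀ a → Nonneg (at f a)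
  at-nonneg p 0 = nonneg-0
  at-nonneg p (suc i) with i ℕₚ.<? K
  ... | yes l = p i l
  ... | no _ = nonneg-0

  T-nonneg-below : ∀ {f} → NonnegF f → ∀ k a → a ℕ.+ k ≤ suc K → Nonneg (at (T k f) a)
  T-nonneg-below p 0 a l = nonneg-resp (sym (at-0 a)) nonneg-0
  T-nonneg-below p (suc k) 0 l = nonneg-0
  T-nonneg-below {f} p (suc k) (suc a) l = nonneg-resp (sym (diagonal f k a l))
    (nonneg-+ (T-nonneg-below p k a (ℕₚ.≤-trans (ℕₚ.+-monoʳ-≤ a (ℕₚ.n≤1+n k)) (ℕₚ.≤-trans (ℕₚ.n≤1+n _) l))) (at-nonneg p (suc (a ℕ.+ k))))

  -- In the triangle a + k ≤ K + 1, `diagonal` writes the value as a sum of values of f; the flip of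
  -- `T-symmetry` maps the other triangle into this one.
  T-nonneg : ∀ {f} → NonnegF f → ∀ k → k ≤ suc K → NonnegF (T k f)
  T-nonneg {f} p k l i i<K = ≡.subst Nonneg (at-inside (T k f) i<K) goal
    where
    goal : Nonneg (at (T k f) (suc i))
    goal with suc i ℕ.+ k ℕₚ.≤? suc K
    ... | yes le = T-nonneg-below p k (suc i) le
    ... | no ¬le = nonneg-resp (sym (T-symmetry f k k′ ek (suc i) a′ ea)) (T-nonneg-below p k′ a′ small)
      where
      k′ = suc K ℕ.∸ k
      a′ = K ℕ.∸ i
      ek : k ℕ.+ k′ ≡ suc K
      ek = ℕₚ.m+[n∸m]≡n l
      ea : suc i ℕ.+ a′ ≡ suc K
      ea = ≡.cong suc (ℕₚ.m+[n∸m]≡n (ℕₚ.<⇒≤ i<K))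
      small : a′ ℕ.+ k′ ≤ suc K
      small = ℕₚ.+-cancelˡ-≤ (suc K) _ _ (ℕₚ.≤-trans (ℕₚ.+-monoˡ-≤ (a′ ℕ.+ k′) (ℕₚ.<⇒≤ (ℕₚ.≰⇒> ¬le))) (ℕₚ.≤-reflexive (≡.trans total (≡.cong₂ ℕ._+_ ea ek))))
        where
        total : (suc i ℕ.+ k) ℕ.+ (a′ ℕ.+ k′) ≡ (suc i ℕ.+ a′) ℕ.+ (k ℕ.+ k′)
        total = ℕ-interchange (suc i) k a′ k′
          where open import Algebra.Properties.CommutativeSemigroup ℕₚ.+-commutativeSemigroup using () renaming (interchange to ℕ-interchange)

  -- The path with K nodes has largest eigenvalue 2 cos (π / (K + 1)), whence the index `suc K`; the
  -- old operators act pointwise and so commute with `path`. The decision is an argument to let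
  -- later lemmas match on it.
  operator : ∀ m → Dec (m ≡ suc K) → F → F
  operator m (yes _) f = path f
  operator m (no _) f i = κ m (f i)

  at-κ : ∀ m f a → at (λ i → κ m (f i)) a ≈ κ m (at f a)
  at-κ m f 0 = sym (Additive.0-homo (κ-additive m))
  at-κ m f (suc i) with i ℕₚ.<? K
  ... | yes l = refl
  ... | no _ = sym (Additive.0-homo (κ-additive m))

  path-κ : ∀ m f → path (λ i → κ m (f i)) A.≈ (λ i → κ m (path f i))
  path-κ m f i l = trans (+-cong (at-κ m f i) (at-κ m f (suc (suc i)))) (sym (κ-+ m _ _))

  κF-cong : ∀ m d {f g} → f A.≈ g → operator m d f A.≈ operator m d g
  κF-cong m (yes _) e = path-cong e
  κF-cong m (no _) e i l = κ-cong m (e i l)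

  κF-+ : ∀ m d f g → operator m d (f A.∙ g) A.≈ operator m d f A.∙ operator m d g
  κF-+ m (yes _) f g = path-+ f g
  κF-+ m (no _) f g i l = κ-+ m (f i) (g i)

  κF-comm : ∀ m d m′ d′ f → operator m d (operator m′ d′ f) A.≈ operator m′ d′ (operator m d f)
  κF-comm m (yes _) m′ (yes _) f = A.refl
  κF-comm m (yes _) m′ (no _) f = path-κ m′ f
  κF-comm m (no _) m′ (yes _) f = A.sym (path-κ m f)
  κF-comm m (no _) m′ (no _) f i l = κ-comm m m′ (f i)

  pointwise-U : ∀ m (¬e : m ≢ suc K) k f i → chebyshevOperator functions (operator m (no ¬e)) k f i ≡ U m k (f i)
  pointwise-U m ¬e 0 f i = ≡.refl
  pointwise-U m ¬e 1 f i = ≡.refl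
  pointwise-U m ¬e (suc (suc k)) f i = ≡.cong₂ (λ x y → κ m x + - y) (pointwise-U m ¬e (suc k) f i) (pointwise-U m ¬e k f i)

  T≡ : ∀ {m} (e : m ≡ suc K) k f → chebyshevOperator functions (operator m (yes e)) k f ≡ T k f
  T≡ e 0 f = ≡.refl
  T≡ e 1 f = ≡.refl
  T≡ e (suc (suc k)) f = ≡.cong₂ (λ x y → path x A.∙ y A.⁻¹) (T≡ e (suc k) f) (T≡ e k f)

  vanish : ∀ m d → 2 ≤ m → m ≤ suc K → ∀ f → chebyshevOperator functions (operator m d) m f A.≈ A.ε
  vanish .(suc K) (yes ≡.refl) l l′ f i i<K rewrite T≡ ≡.refl (suc K) f =
    trans (sym (AbelianGroup.reflexive abelianGroup (at-inside (T (suc K) f) i<K))) (T-vanish f (suc i) (ℕₚ.≤-trans i<K (ℕₚ.n≤1+n K)))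
  vanish m (no ¬e) l l′ f i i<K rewrite pointwise-U m ¬e m f i =
    U-vanish m l (ℕ.s≤s⁻¹ (ℕₚ.≤∧≢⇒< l′ ¬e)) (f i)

  nonneg : ∀ m d → 2 ≤ m → m ≤ suc K → ∀ k → k ≤ m → ∀ {f} → NonnegF f → NonnegF (chebyshevOperator functions (operator m d) k f)
  nonneg .(suc K) (yes ≡.refl) l l′ k k≤ {f} p rewrite T≡ ≡.refl k f = T-nonneg p k k≤
  nonneg m (no ¬e) l l′ k k≤ {f} p i i<K rewrite pointwise-U m ¬e k f i =
    U-nonneg m l (ℕ.s≤s⁻¹ (ℕₚ.≤∧≢⇒< l′ ¬e)) k k≤ (p i i<K)

  extension : OperatorModule (suc K)
  extension = record
    { abelianGroup = functions
    ; Nonneg = NonnegF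
    ; nonneg-resp = λ e p i l → nonneg-resp (e i l) (p i l)
    ; nonneg-0 = λ i l → nonneg-0
    ; nonneg-+ = λ p q i l → nonneg-+ (p i l) (q i l)
    ; nonneg-antisym = λ p q i l → nonneg-antisym (p i l) (q i l)
    ; generated = λ f → (λ i → proj₁ (generated (f i))) , (λ i → proj₁ (proj₂ (generated (f i))))
        , (λ i _ → proj₁ (proj₂ (proj₂ (generated (f i))))) , (λ i _ → proj₁ (proj₂ (proj₂ (proj₂ (generated (f i))))))
        , (λ i _ → proj₂ (proj₂ (proj₂ (proj₂ (generated (f i))))))
    ; nontrivial = (λ _ → proj₁ nontrivial) , (λ e → proj₂ nontrivial (e 0 1≤K))
    ; κ = λ m → operator m (m ℕₚ.≟ suc K)
    ; κ-cong = λ m → κF-cong m (m ℕₚ.≟ suc K)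
    ; κ-+ = λ m → κF-+ m (m ℕₚ.≟ suc K)
    ; κ-comm = λ m m′ → κF-comm m (m ℕₚ.≟ suc K) m′ (m′ ℕₚ.≟ suc K)
    ; U-vanish = λ m → vanish m (m ℕₚ.≟ suc K)
    ; U-nonneg = λ m → nonneg m (m ℕₚ.≟ suc K)
    }

-- No m satisfies 2 ≤ m ≤ 1, so the zero operator can stand in for every `κ m` until a path
-- extension supplies the right one.
integerModule : OperatorModule 1
integerModule = record
  { abelianGroup = ℤₚ.+-0-abelianGroup
  ; Nonneg = λ i → ℤ.0ℤ ℤ.≤ i
  ; nonneg-resp = λ { ≡.refl p → p }
  ; nonneg-0 = ℤₚ.≤-refl
  ; nonneg-+ = λ p q → ℤₚ.+-mono-≤ p q
  ; nonneg-antisym = λ {v} p q → ℤₚ.≤-antisym (≡.subst (ℤ._≤ ℤ.0ℤ) (ℤₚ.neg-involutive v) (ℤₚ.neg-mono-≤ q)) p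
  ; generated = λ { (ℤ.+ k) → ℤ.+ k , ℤ.0ℤ , ℤ.+≤+ z≤n , ℤₚ.≤-refl , ≡.sym (ℤₚ.+-identityʳ _)
                  ; (ℤ.-[1+_] k) → ℤ.0ℤ , ℤ.+ suc k , ℤₚ.≤-refl , ℤ.+≤+ z≤n , ≡.refl }
  ; nontrivial = ℤ.1ℤ , λ ()
  ; κ = λ _ _ → ℤ.0ℤ
  ; κ-cong = λ _ _ → ≡.refl
  ; κ-+ = λ _ _ _ → ≡.refl
  ; κ-comm = λ _ _ _ → ≡.refl
  ; U-vanish = λ m l l′ → ⊥-elim (ℕₚ.1+n≰n (ℕₚ.≤-trans l l′))
  ; U-nonneg = λ m l l′ → ⊥-elim (ℕₚ.1+n≰n (ℕₚ.≤-trans l l′))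
  }

operatorModule : ∀ k → OperatorModule (suc k)
operatorModule 0 = integerModule
operatorModule (suc k) = PathExtension.extension (s≤s z≤n) (operatorModule k)

-- Chebyshev weights for a Coxeter matrix.

-- Here `κ s t` stands for 2 cos (π / m s t). Of its properties, `κ-vanish` yields the braid
-- relations and `κ-nonneg` the positivity of the roots of rank two subgroups.
record Weights {n} (M : CoxeterMatrix n) : Set₁ where
  open CoxeterMatrix M
  field
    coneRing : ConeRing
  open ConeRing coneRing public
  field
    κ : Fin n → Fin n → Carrier
    κ-sym : ∀ s t → κ s t ≈ κ t s
    κ-vanish : ∀ {s t} → s ≢ t → chebyshev (κ s t) (m s t) ≈ 0#
    κ-nonneg : ∀ {s t} → s ≢ t → ∀ k → k ≤ m s t → Nonneg (chebyshev (κ s t) k)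

bounded : ∀ {n} (f : Fin n → ℕ) → ∃ λ K → ∀ i → f i ≤ K
bounded {zero} f = 0 , λ ()
bounded {suc n} f with bounded (f ∘ suc)
... | K , f≤K = f zero ℕ.⊔ K , λ { zero → ℕₚ.m≤m⊔n (f zero) K ; (suc i) → ℕₚ.≤-trans (f≤K i) (ℕₚ.m≤n⊔m (f zero) K) }

coxeterWeights : ∀ {n} (M : CoxeterMatrix n) → Weights M
coxeterWeights M = record
  { coneRing = coneRing
  ; κ = λ s t → κ′ (m s t)
  ; κ-sym = λ s t v → AbelianGroup.reflexive (OperatorModule.abelianGroup N) (≡.cong (λ k → ⟦ κ′ k ⟧ v) (symm s t))
  ; κ-vanish = λ {s} {t} s≢t v → ≡.subst (λ x → OperatorModule._≈_ N x _) (≡.sym (chebyshev-U (m s t) (m s t) v)) (OperatorModule.U-vanish N (m s t) (off s t s≢t) (m≤ s t) v)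
  ; κ-nonneg = λ {s} {t} s≢t k k≤ v p → ≡.subst (OperatorModule.Nonneg N) (≡.sym (chebyshev-U (m s t) k v)) (OperatorModule.U-nonneg N (m s t) (off s t s≢t) (m≤ s t) k k≤ p)
  }
  where
  open CoxeterMatrix M
  K : ℕ
  K = proj₁ (bounded λ s → proj₁ (bounded (m s)))
  m≤ : ∀ s t → m s t ≤ suc K
  m≤ s t = ℕₚ.m≤n⇒m≤1+n (ℕₚ.≤-trans (proj₂ (bounded (m s)) t) (proj₂ (bounded λ s → proj₁ (bounded (m s))) s))
  N : OperatorModule (suc K)
  N = operatorModule K
  open OperatorModuleProperties N

-- Words modulo braid and Coxeter relations, and some facts on lists.

module Words {n} (M : CoxeterMatrix n) where
  open CoxeterMatrix M
  open Coxeter M hiding ([_])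

  module B = IsEquivalence (Eq.isEquivalence BraidStep)
  module W = IsEquivalence (Eq.isEquivalence CoxStep)
  module ≈B-Reasoning = SetoidReasoning (Eq.setoid BraidStep)
  module ≈W-Reasoning = SetoidReasoning (Eq.setoid CoxStep)

  private
    reassocʳ : ∀ b (x z y : Word n) → x ++ z ++ y ++ b ≡ (x ++ z ++ y) ++ b
    reassocʳ b x z y = ≡.sym (≡.trans (Lₚ.++-assoc x (z ++ y) b) (≡.cong (x ++_) (Lₚ.++-assoc z y b)))

  ++-congˡB : ∀ a {x y} → x ≈B y → (a ++ x) ≈B (a ++ y)
  ++-congˡB a = Eq.gmap (a ++_) λ { (braid x y s t) → ≡.subst₂ BraidStep (Lₚ.++-assoc a x _) (Lₚ.++-assoc a x _) (braid (a ++ x) y s t) }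

  ++-congʳB : ∀ b {x y} → x ≈B y → (x ++ b) ≈B (y ++ b)
  ++-congʳB b = Eq.gmap (_++ b) λ { (braid x y s t) → ≡.subst₂ BraidStep (reassocʳ b x _ y) (reassocʳ b x _ y) (braid x (y ++ b) s t) }

  ++-congˡW : ∀ a {x y} → x ≈W y → (a ++ x) ≈W (a ++ y)
  ++-congˡW a = Eq.gmap (a ++_) λ
    { (braid x y s t) → ≡.subst₂ CoxStep (Lₚ.++-assoc a x _) (Lₚ.++-assoc a x _) (braid (a ++ x) y s t)
    ; (quad x y s) → ≡.subst₂ CoxStep (Lₚ.++-assoc a x _) (Lₚ.++-assoc a x y) (quad (a ++ x) y s) }

  ++-congʳW : ∀ b {x y} → x ≈W y → (x ++ b) ≈W (y ++ b)
  ++-congʳW b = Eq.gmap (_++ b) λ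
    { (braid x y s t) → ≡.subst₂ CoxStep (reassocʳ b x _ y) (reassocʳ b x _ y) (braid x (y ++ b) s t)
    ; (quad x y s) → ≡.subst₂ CoxStep (reassocʳ b x (s ∷ s ∷ []) y) (≡.sym (Lₚ.++-assoc x y b)) (quad x (y ++ b) s) }

  ++-congW : ∀ {x x′ y y′} → x ≈W x′ → y ≈W y′ → (x ++ y) ≈W (x′ ++ y′)
  ++-congW {x′ = x′} {y = y} e f = W.trans (++-congʳW y e) (++-congˡW x′ f)

  B⇒W : ∀ {x y} → x ≈B y → x ≈W y
  B⇒W = Eq.map λ { (braid x y s t) → braid x y s t }

  alt-B : ∀ s t → alt s t (m s t) ≈B alt t s (m s t)
  alt-B s t = ≡.subst₂ _≈B_ (Lₚ.++-identityʳ _) (Lₚ.++-identityʳ _) (Eq.return (braid [] [] s t))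

  swap-B : ∀ {s t} → m s t ≡ 2 → ∀ y → (s ∷ t ∷ y) ≈B (t ∷ s ∷ y)
  swap-B {s} {t} e y = ≡.subst (λ k → (alt s t k ++ y) ≈B (alt t s k ++ y)) e (++-congʳB y (alt-B s t))

  alt-length : ∀ (s t : Fin n) k → length (alt s t k) ≡ k
  alt-length s t zero = ≡.refl
  alt-length s t (suc k) = ≡.cong suc (alt-length t s k)

  length-B : ∀ {x y} → x ≈B y → length x ≡ length y
  length-B = Eq.gfold ≡.isEquivalence length λ { (braid x y s t) → ≡.trans (Lₚ.length-++ x) (≡.trans (≡.cong (length x ℕ.+_) (≡.trans (Lₚ.length-++ (alt s t (m s t))) (≡.trans (≡.cong (ℕ._+ length y) (≡.trans (alt-length s t (m s t)) (≡.sym (alt-length t s (m s t))))) (≡.sym (Lₚ.length-++ (alt t s (m s t))))))) (≡.sym (Lₚ.length-++ x))) }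

  involution : ∀ s → (s ∷ s ∷ []) ≈W []
  involution s = Eq.return (quad [] [] s)

  reverse-inverseʳ : ∀ x → (x ++ reverse x) ≈W []
  reverse-inverseʳ [] = W.refl
  reverse-inverseʳ (s ∷ x) = begin
    s ∷ x ++ reverse (s ∷ x)      ≡⟨ ≡.cong (λ y → s ∷ x ++ y) (Lₚ.unfold-reverse s x) ⟩
    s ∷ x ++ reverse x ++ [ s ]   ≡⟨ ≡.cong (s ∷_) (Lₚ.++-assoc x (reverse x) [ s ]) ⟨
    [ s ] ++ (x ++ reverse x) ++ [ s ] ≈⟨ ++-congˡW [ s ] (++-congʳW [ s ] (reverse-inverseʳ x)) ⟩
    s ∷ s ∷ []                    ≈⟨ involution s ⟩
    []                            ∎
    where open ≈W-Reasoning

  reverse-inverseˡ : ∀ x → (reverse x ++ x) ≈W []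
  reverse-inverseˡ x = ≡.subst (λ y → (reverse x ++ y) ≈W []) (Lₚ.reverse-involutive x) (reverse-inverseʳ (reverse x))

  cancelˡ-W : ∀ a {x y} → (a ++ x) ≈W (a ++ y) → x ≈W y
  cancelˡ-W a {x} {y} e = begin
    x                       ≈⟨ ++-congʳW x (reverse-inverseˡ a) ⟨
    (reverse a ++ a) ++ x   ≡⟨ Lₚ.++-assoc (reverse a) a x ⟩
    reverse a ++ a ++ x     ≈⟨ ++-congˡW (reverse a) e ⟩
    reverse a ++ a ++ y     ≡⟨ Lₚ.++-assoc (reverse a) a y ⟨
    (reverse a ++ a) ++ y   ≈⟨ ++-congʳW y (reverse-inverseˡ a) ⟩
    y                       ∎
    where open ≈W-Reasoning

  cancelʳ-W : ∀ b {x y} → (x ++ b) ≈W (y ++ b) → x ≈W y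
  cancelʳ-W b {x} {y} e = begin
    x                       ≡⟨ Lₚ.++-identityʳ x ⟨
    x ++ []                 ≈⟨ ++-congˡW x (reverse-inverseʳ b) ⟨
    x ++ b ++ reverse b     ≡⟨ Lₚ.++-assoc x b (reverse b) ⟨
    (x ++ b) ++ reverse b   ≈⟨ ++-congʳW (reverse b) e ⟩
    (y ++ b) ++ reverse b   ≡⟨ Lₚ.++-assoc y b (reverse b) ⟩
    y ++ b ++ reverse b     ≈⟨ ++-congˡW y (reverse-inverseʳ b) ⟩
    y ++ []                 ≡⟨ Lₚ.++-identityʳ y ⟩
    y                       ∎
    where open ≈W-Reasoning

unique-middle : ∀ {A : Set} (a : List A) {t b} → Unique (a ++ t ∷ b) → Unique (a ++ b) × t ∉ a ++ b
unique-middle [] (t∉ ∷ u) = u , λ t∈ → All.lookup t∉ t∈ ≡.refl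
unique-middle (x ∷ a) (x∉ ∷ u) with unique-middle a u
... | u′ , t∉ = Allₚ.++⁺ (Allₚ.++⁻ˡ a x∉) (All.tail (Allₚ.++⁻ʳ a x∉)) ∷ u′
  , λ { (here ≡.refl) → All.lookup x∉ (∈-++⁺ʳ a (here ≡.refl)) ≡.refl ; (there t∈) → t∉ t∈ }

∈-middle : ∀ {A : Set} (a : List A) {t x b} → x ∈ a ++ t ∷ b → x ≡ t ⊎ x ∈ a ++ b
∈-middle [] (here e) = inj₁ e
∈-middle [] (there p) = inj₂ p
∈-middle (y ∷ a) (here e) = inj₂ (here e)
∈-middle (y ∷ a) (there p) with ∈-middle a p
... | inj₁ e = inj₁ e
... | inj₂ q = inj₂ (there q)

∈-middle⁺ : ∀ {A : Set} (a : List A) {t x b} → x ∈ a ++ b → x ∈ a ++ t ∷ b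
∈-middle⁺ [] p = there p
∈-middle⁺ (y ∷ a) (here e) = here e
∈-middle⁺ (y ∷ a) (there p) = there (∈-middle⁺ a p)

split-∷ʳ : ∀ {A : Set} (x : List A) {s} y {t z} → x ∷ʳ s ≡ y ++ t ∷ z → (z ≡ [] × x ≡ y × s ≡ t) ⊎ (∃ λ z′ → x ≡ y ++ t ∷ z′)
split-∷ʳ [] [] ≡.refl = inj₁ (≡.refl , ≡.refl , ≡.refl)
split-∷ʳ [] (_ ∷ []) ()
split-∷ʳ [] (_ ∷ _ ∷ _) ()
split-∷ʳ (a ∷ x) [] ≡.refl = inj₂ (x , ≡.refl)
split-∷ʳ (a ∷ x) (b ∷ y) e with Lₚ.∷-injective e
... | ≡.refl , e′ with split-∷ʳ x y e′
... | inj₁ (z≡ , x≡ , s≡) = inj₁ (z≡ , ≡.cong (a ∷_) x≡ , s≡)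
... | inj₂ (z′ , x≡) = inj₂ (z′ , ≡.cong (a ∷_) x≡)

-- The geometric representation.

module Geometry {n} {M : CoxeterMatrix n} (weights : Weights M) where
  open CoxeterMatrix M
  open Coxeter M hiding ([_])
  open Words M
  open Weights weights
  open IntegerCoefficientSolver commutativeRing
  open import Data.List.Membership.DecPropositional (_≟_ {n}) using (_∈?_)
  open import Relation.Binary.Reasoning.Setoid setoid

  V : Set
  V = Fin n → Carrier

  infix 4 _≋_
  _≋_ : V → V → Set
  v ≋ w = ∀ t → v t ≈ w t

  infixl 6 _⊕_
  infixl 7 _⊙_
  _⊕_ : V → V → V
  (v ⊕ w) t = v t + w t

  _⊙_ : Carrier → V → V
  (a ⊙ v) t = a * v t

  ⊖_ : V → V
  (⊖ v) t = - v t

  α : Fin n → V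
  α s t with s ≟ t
  ... | yes _ = 1#
  ... | no _ = 0#

  α-same : ∀ s → α s s ≡ 1#
  α-same s with s ≟ s
  ... | yes _ = ≡.refl
  ... | no ¬e = ⊥-elim (¬e ≡.refl)

  α-other : ∀ {s t} → s ≢ t → α s t ≡ 0#
  α-other {s} {t} ne with s ≟ t
  ... | yes e = ⊥-elim (ne e)
  ... | no _ = ≡.refl

  -- The negative of the generalised Cartan matrix.
  C : Fin n → Fin n → Carrier
  C s t with s ≟ t
  ... | yes _ = - (1# + 1#)
  ... | no _ = κ s t

  C-same : ∀ s → C s s ≡ - (1# + 1#)
  C-same s with s ≟ s
  ... | yes _ = ≡.refl
  ... | no ¬e = ⊥-elim (¬e ≡.refl)

  C-other : ∀ {s t} → s ≢ t → C s t ≡ κ s t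
  C-other {s} {t} ne with s ≟ t
  ... | yes e = ⊥-elim (ne e)
  ... | no _ = ≡.refl

  C-sym : ∀ s t → C s t ≈ C t s
  C-sym s t with s ≟ t
  ... | yes ≡.refl = sym (reflexive (C-same s))
  ... | no ne = trans (κ-sym s t) (sym (reflexive (C-other (ne ∘ ≡.sym))))

  Σ[_] : List (Fin n) → (Fin n → Carrier) → Carrier
  Σ[ [] ] f = 0#
  Σ[ t ∷ l ] f = f t + Σ[ l ] f

  Σ-cong : ∀ l {f g} → (∀ {t} → t ∈ l → f t ≈ g t) → Σ[ l ] f ≈ Σ[ l ] g
  Σ-cong [] h = refl
  Σ-cong (t ∷ l) h = +-cong (h (here ≡.refl)) (Σ-cong l (h ∘ there))

  Σ-+ : ∀ l f g → Σ[ l ] (λ t → f t + g t) ≈ Σ[ l ] f + Σ[ l ] g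
  Σ-+ [] f g = sym (+-identityˡ 0#)
  Σ-+ (t ∷ l) f g = trans (+-congˡ (Σ-+ l f g))
    (solve 4 (λ a b c d → a :+ b :+ (c :+ d) := a :+ c :+ (b :+ d)) refl (f t) (g t) (Σ[ l ] f) (Σ[ l ] g))

  Σ-* : ∀ l a f → Σ[ l ] (λ t → a * f t) ≈ a * Σ[ l ] f
  Σ-* [] a f = sym (zeroʳ a)
  Σ-* (t ∷ l) a f = trans (+-congˡ (Σ-* l a f)) (sym (distribˡ a (f t) (Σ[ l ] f)))

  Σ-middle : ∀ a {t b} f → Σ[ a ++ t ∷ b ] f ≈ f t + Σ[ a ++ b ] f
  Σ-middle [] f = refl
  Σ-middle (x ∷ a) {t} {b} f = trans (+-congˡ (Σ-middle a f))
    (solve 3 (λ x t r → x :+ (t :+ r) := t :+ (x :+ r)) refl (f x) (f t) (Σ[ a ++ b ] f))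

  Σ-support : ∀ l c f → Unique l → Unique c → (∀ {t} → t ∈ c → t ∈ l) → (∀ {t} → t ∉ c → f t ≈ 0#) → Σ[ l ] f ≈ Σ[ c ] f
  Σ-support [] [] f ul uc c⊆l z = refl
  Σ-support [] (t ∷ c) f ul uc c⊆l z with c⊆l (here ≡.refl)
  ... | ()
  Σ-support (t ∷ l) c f (t∉l ∷ ul) uc c⊆l z with t ∈? c
  ... | no t∉c = trans (+-cong (z t∉c) (Σ-support l c f ul uc c⊆l′ z)) (+-identityˡ _)
    where
    c⊆l′ : ∀ {x} → x ∈ c → x ∈ l
    c⊆l′ p with c⊆l p
    ... | here ≡.refl = ⊥-elim (t∉c p)
    ... | there q = q
  ... | yes t∈c with ∈-∃++ t∈c
  ... | a , b , ≡.refl = begin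
      f t + Σ[ l ] f                            ≈⟨ +-congˡ (Σ-cong l λ x∈l → sym (off-t x∈l)) ⟩
      f t + Σ[ l ] g                            ≈⟨ +-congˡ (Σ-support l (a ++ b) g ul (proj₁ (unique-middle a uc)) ⊆l z′) ⟩
      f t + Σ[ a ++ b ] g                       ≈⟨ +-congˡ (Σ-cong (a ++ b) λ x∈ → off-t (⊆l x∈)) ⟩
      f t + Σ[ a ++ b ] f                       ≈⟨ Σ-middle a f ⟨
      Σ[ a ++ t ∷ b ] f ∎
    where
    -- Erasing the value at t makes the function vanish outside the support without t, as the
    -- induction hypothesis demands.
    g : Fin n → Carrier
    g x with t ≟ x
    ... | yes _ = 0#
    ... | no _ = f x
    off-t : ∀ {x} → x ∈ l → g x ≈ f x
    off-t {x} x∈l with t ≟ x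
    ... | yes ≡.refl = ⊥-elim (All.lookup t∉l x∈l ≡.refl)
    ... | no _ = refl
    ⊆l : ∀ {x} → x ∈ a ++ b → x ∈ l
    ⊆l p with c⊆l (∈-middle⁺ a p)
    ... | here ≡.refl = ⊥-elim (proj₂ (unique-middle a uc) p)
    ... | there q = q
    z′ : ∀ {x} → x ∉ a ++ b → g x ≈ 0#
    z′ {x} x∉ with t ≟ x
    ... | yes _ = refl
    ... | no ne = z λ x∈ → case (∈-middle a x∈)
      where
      case : x ≡ t ⊎ x ∈ a ++ b → ⊥
      case (inj₁ e) = ne (≡.sym e)
      case (inj₂ q) = x∉ q

  gens : List (Fin n)
  gens = allFin n

  -- Over `gens` this is minus the pairing of v with the coroot of s. Shorter lists occur in the
  -- Euler form, which sums only over the letters behind a given one.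
  pair : List (Fin n) → Fin n → V → Carrier
  pair l s v = Σ[ l ] (λ t → C s t * v t)

  pair-cong : ∀ l s {v w} → (∀ {t} → t ∈ l → v t ≈ w t) → pair l s v ≈ pair l s w
  pair-cong l s e = Σ-cong l (λ t∈ → *-congˡ (e t∈))

  pair-⊕ : ∀ l s v w → pair l s (v ⊕ w) ≈ pair l s v + pair l s w
  pair-⊕ l s v w = trans (Σ-cong l (λ {t} _ → distribˡ (C s t) (v t) (w t))) (Σ-+ l _ _)

  pair-⊙ : ∀ l s a v → pair l s (a ⊙ v) ≈ a * pair l s v
  pair-⊙ l s a v = trans (Σ-cong l (λ {t} _ → solve 3 (λ c a x → c :* (a :* x) := a :* (c :* x)) refl (C s t) a (v t))) (Σ-* l a _)

  pair-support : ∀ {c} s v → Unique c → (∀ {t} → t ∉ c → v t ≈ 0#) → pair gens s v ≈ pair c s v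
  pair-support {c} s v u z = Σ-support gens c _ (Uniqueₚ.allFin⁺ n) u (λ _ → ∈-allFin _) (λ t∉ → trans (*-congˡ (z t∉)) (zeroʳ _))

  pair-α : ∀ s t → pair gens s (α t) ≈ C s t
  pair-α s t = begin
    pair gens s (α t)         ≈⟨ pair-support {t ∷ []} s (α t) ([] ∷ []) (λ x∉ → reflexive (α-other (λ e → x∉ (here (≡.sym e))))) ⟩
    C s t * α t t + 0#        ≡⟨ ≡.cong (λ x → C s t * x + 0#) (α-same t) ⟩
    C s t * 1# + 0#           ≈⟨ trans (+-identityʳ _) (*-identityʳ _) ⟩
    C s t                     ∎

  infixr 8 _•_
  _•_ : Fin n → V → V
  s • v = v ⊕ pair gens s v ⊙ α s

  •-cong : ∀ s {v w} → v ≋ w → s • v ≋ s • w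
  •-cong s e t = +-cong (e t) (*-congʳ (pair-cong gens s (λ {t} _ → e t)))

  •-⊕ : ∀ s v w → s • (v ⊕ w) ≋ s • v ⊕ s • w
  •-⊕ s v w t = trans (+-congˡ (*-congʳ (pair-⊕ gens s v w)))
    (solve 5 (λ v w p q a → v :+ w :+ (p :+ q) :* a := v :+ p :* a :+ (w :+ q :* a)) refl (v t) (w t) (pair gens s v) (pair gens s w) (α s t))

  •-⊙ : ∀ s a v → s • (a ⊙ v) ≋ a ⊙ (s • v)
  •-⊙ s a v t = trans (+-congˡ (*-congʳ (pair-⊙ gens s a v)))
    (solve 4 (λ a v p e → a :* v :+ a :* p :* e := a :* (v :+ p :* e)) refl a (v t) (pair gens s v) (α s t))

  •-other : ∀ {s t} → s ≢ t → ∀ v → (s • v) t ≈ v t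
  •-other {s} {t} ne v = trans (+-congˡ (trans (*-congˡ (reflexive (α-other ne))) (zeroʳ _))) (+-identityʳ _)

  •-self : ∀ s v → (s • v) s ≈ v s + pair gens s v
  •-self s v = +-congˡ (trans (*-congˡ (reflexive (α-same s))) (*-identityʳ _))

  •-α : ∀ s t → s • α t ≋ α t ⊕ C s t ⊙ α s
  •-α s t x = +-congˡ (*-congʳ (pair-α s t))

  •-α-same : ∀ s → s • α s ≋ ⊖ α s
  •-α-same s x = trans (•-α s s x) (trans (+-congˡ (*-congʳ (reflexive (C-same s))))
    (solve 1 (λ a → a :+ :- (:1 :+ :1) :* a := :- a) refl (α s x)))

  •-involutive : ∀ s v → s • s • v ≋ v
  •-involutive s v x = begin
    (v x + p * α s x) + pair gens s (v ⊕ p ⊙ α s) * α s x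
      ≈⟨ +-congˡ (*-congʳ (trans (pair-⊕ gens s v (p ⊙ α s)) (+-congˡ (trans (pair-⊙ gens s p (α s)) (*-congˡ (trans (pair-α s s) (reflexive (C-same s)))))))) ⟩
    (v x + p * α s x) + (p + p * - (1# + 1#)) * α s x
      ≈⟨ solve 3 (λ v p a → v :+ p :* a :+ (p :+ p :* :- (:1 :+ :1)) :* a := v) refl (v x) p (α s x) ⟩
    v x ∎
    where p = pair gens s v

  act : Word n → V → V
  act [] v = v
  act (s ∷ x) v = s • act x v

  act-++ : ∀ x y v → act (x ++ y) v ≡ act x (act y v)
  act-++ [] y v = ≡.refl
  act-++ (s ∷ x) y v = ≡.cong (s •_) (act-++ x y v)

  ≋-refl : ∀ {v} → v ≋ v
  ≋-refl t = refl

  ≋-sym : ∀ {v w} → v ≋ w → w ≋ v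
  ≋-sym e t = sym (e t)

  ≋-trans : ∀ {u v w} → u ≋ v → v ≋ w → u ≋ w
  ≋-trans e f t = trans (e t) (f t)

  ≋-reflexive : ∀ {v w} → v ≡ w → v ≋ w
  ≋-reflexive ≡.refl t = refl

  act-cong : ∀ x {v w} → v ≋ w → act x v ≋ act x w
  act-cong [] e = e
  act-cong (s ∷ x) e = •-cong s (act-cong x e)

  act-⊕ : ∀ x v w → act x (v ⊕ w) ≋ act x v ⊕ act x w
  act-⊕ [] v w = ≋-refl
  act-⊕ (s ∷ x) v w = ≋-trans (•-cong s (act-⊕ x v w)) (•-⊕ s _ _)

  act-⊙ : ∀ x a v → act x (a ⊙ v) ≋ a ⊙ act x v
  act-⊙ [] a v = ≋-refl
  act-⊙ (s ∷ x) a v = ≋-trans (•-cong s (act-⊙ x a v)) (•-⊙ s a _)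

  ⊖≋⊙ : ∀ v → ⊖ v ≋ (- 1#) ⊙ v
  ⊖≋⊙ v t = solve 1 (λ x → :- x := :- :1 :* x) refl (v t)

  act-⊖ : ∀ x v → act x (⊖ v) ≋ ⊖ act x v
  act-⊖ x v = ≋-trans (act-cong x (⊖≋⊙ v)) (≋-trans (act-⊙ x _ v) (≋-sym (⊖≋⊙ _)))

  zero-V : V
  zero-V _ = 0#

  act-zero : ∀ x → act x zero-V ≋ zero-V
  act-zero x = ≋-trans (act-cong x (λ t → sym (zeroˡ 0#))) (≋-trans (act-⊙ x 0# zero-V) (λ t → zeroˡ _))

  -- The coefficients of α a and α b that alternating reflections in a, b add
  -- to a vector with pairings x and y.
  P : Carrier → ℕ → Carrier → Carrier → Carrier
  P k 0 x y = 0#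
  P k 1 x y = x
  P k (suc (suc p)) x y = x + k * P k (suc p) y x - P k p x y

  select : ℕ → Carrier → Carrier → Carrier
  select zero x y = x
  select (suc p) x y = select p y x

  -- Consecutive coefficients differ by a multiple of one Chebyshev value, hence coincide where that
  -- value vanishes. At `m s t` this makes the two sides of the braid relation agree.
  P-step : ∀ k p x y → P k (suc p) x y ≈ P k p x y + chebyshev k (suc p) * select p x y
  P-step k 0 x y = solve 1 (λ x → x := :0 :+ :1 :* x) refl x
  P-step k 1 x y = solve 3 (λ k x y → x :+ k :* y :- :0 := x :+ (k :* :1 :- :0) :* y) refl k x y
  P-step k (suc (suc p)) x y = begin
    x + k * P k (2 ℕ.+ p) y x - P k (suc p) x y
      ≈⟨ +-cong (+-congˡ (*-congˡ (P-step k (suc p) y x))) (-‿cong (P-step k p x y)) ⟩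
    x + k * (P k (suc p) y x + chebyshev k (2 ℕ.+ p) * select p x y) - (P k p x y + chebyshev k (suc p) * select p x y)
      ≈⟨ solve 7 (λ x k P₁ u₂ s P₀ u₁ → x :+ k :* (P₁ :+ u₂ :* s) :- (P₀ :+ u₁ :* s) := x :+ k :* P₁ :- P₀ :+ (k :* u₂ :- u₁) :* s) refl
          x k (P k (suc p) y x) (chebyshev k (2 ℕ.+ p)) (select p x y) (P k p x y) (chebyshev k (suc p)) ⟩
    x + k * P k (suc p) y x - P k p x y + chebyshev k (3 ℕ.+ p) * select p x y ∎

  P-sym : ∀ {s t} p x y → P (κ s t) p x y ≈ P (κ t s) p x y
  P-sym 0 x y = refl
  P-sym 1 x y = refl
  P-sym {s} {t} (suc (suc p)) x y = +-cong (+-congˡ (*-cong (κ-sym s t) (P-sym (suc p) y x))) (-‿cong (P-sym p x y))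

  act-alt : ∀ {a b} → a ≢ b → ∀ p v → act (alt a b (suc p)) v ≋ v ⊕ P (κ a b) (suc p) (pair gens a v) (pair gens b v) ⊙ α a ⊕ P (κ a b) p (pair gens b v) (pair gens a v) ⊙ α b
  act-alt {a} {b} ne zero v t = sym (trans (+-congˡ (zeroˡ _)) (+-identityʳ _))
  act-alt {a} {b} ne (suc p) v t = begin
    (a • act (alt b a (suc p)) v) t
      ≈⟨ •-cong a (act-alt (ne ∘ ≡.sym) p v) t ⟩
    (a • w) t
      ≈⟨ +-congˡ (*-congʳ pair-w) ⟩
    w t + (X + Q₁ * κ a b + Q₀ * - (1# + 1#)) * α a t
      ≈⟨ +-cong (+-cong (+-congˡ (*-congʳ (P-sym (suc p) Y X))) (*-congʳ (P-sym p X Y))) (*-congʳ (+-cong (+-congˡ (*-congʳ (P-sym (suc p) Y X))) (*-congʳ (P-sym p X Y)))) ⟩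
    v t + R₁ * α b t + R₀ * α a t + (X + R₁ * κ a b + R₀ * - (1# + 1#)) * α a t
      ≈⟨ solve 7 (λ v r₁ r₀ e f x k → v :+ r₁ :* f :+ r₀ :* e :+ (x :+ r₁ :* k :+ r₀ :* :- (:1 :+ :1)) :* e := v :+ (x :+ k :* r₁ :- r₀) :* e :+ r₁ :* f) refl
          (v t) R₁ R₀ (α a t) (α b t) X (κ a b) ⟩
    v t + (X + κ a b * R₁ - R₀) * α a t + R₁ * α b t ∎
    where
    X = pair gens a v
    Y = pair gens b v
    Q₁ = P (κ b a) (suc p) Y X
    Q₀ = P (κ b a) p X Y
    R₁ = P (κ a b) (suc p) Y X
    R₀ = P (κ a b) p X Y
    w : V
    w = v ⊕ Q₁ ⊙ α b ⊕ Q₀ ⊙ α a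
    pair-w : pair gens a w ≈ X + Q₁ * κ a b + Q₀ * - (1# + 1#)
    pair-w = trans (pair-⊕ gens a (v ⊕ Q₁ ⊙ α b) (Q₀ ⊙ α a))
      (+-cong (trans (pair-⊕ gens a v (Q₁ ⊙ α b)) (+-congˡ (trans (pair-⊙ gens a Q₁ (α b)) (*-congˡ (trans (pair-α a b) (reflexive (C-other ne)))))))
              (trans (pair-⊙ gens a Q₀ (α a)) (*-congˡ (trans (pair-α a a) (reflexive (C-same a))))))

  act-braid : ∀ s t v → act (alt s t (m s t)) v ≋ act (alt t s (m s t)) v
  act-braid s t v with s ≟ t
  ... | yes ≡.refl = ≋-refl
  ... | no ne = go (m s t) (off s t ne) (κ-vanish ne)
    where
    go : ∀ k → 2 ≤ k → chebyshev (κ s t) k ≈ 0# → act (alt s t k) v ≋ act (alt t s k) v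
    go 0 () e
    go (suc p) _ e x = begin
      act (alt s t (suc p)) v x
        ≈⟨ act-alt ne p v x ⟩
      v x + P (κ s t) (suc p) X Y * α s x + P (κ s t) p Y X * α t x
        ≈⟨ +-cong (+-congˡ (*-congʳ (same X Y))) (*-congʳ (sym (same Y X))) ⟩
      v x + P (κ s t) p X Y * α s x + P (κ s t) (suc p) Y X * α t x
        ≈⟨ solve 3 (λ a b c → a :+ b :+ c := a :+ c :+ b) refl (v x) (P (κ s t) p X Y * α s x) (P (κ s t) (suc p) Y X * α t x) ⟩
      v x + P (κ s t) (suc p) Y X * α t x + P (κ s t) p X Y * α s x
        ≈⟨ +-cong (+-congˡ (*-congʳ (P-sym (suc p) Y X))) (*-congʳ (P-sym p X Y)) ⟩
      v x + P (κ t s) (suc p) Y X * α t x + P (κ t s) p X Y * α s x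
        ≈⟨ act-alt (ne ∘ ≡.sym) p v x ⟨
      act (alt t s (suc p)) v x ∎
      where
      X = pair gens s v
      Y = pair gens t v
      same : ∀ x y → P (κ s t) (suc p) x y ≈ P (κ s t) p x y
      same x y = trans (P-step (κ s t) p x y) (trans (+-congˡ (trans (*-congʳ e) (zeroˡ _))) (+-identityʳ _))

  act-W : ∀ {x y} → x ≈W y → ∀ v → act x v ≋ act y v
  act-W = Eq.fold (record { refl = λ v → ≋-refl ; sym = λ e v → ≋-sym (e v) ; trans = λ e f v → ≋-trans (e v) (f v) }) step
    where
    in-context : ∀ x y {a b : Word n} → (∀ v → act a v ≋ act b v) → ∀ v → act (x ++ a ++ y) v ≋ act (x ++ b ++ y) v
    in-context x y {a} {b} e v
      rewrite act-++ x (a ++ y) v | act-++ x (b ++ y) v | act-++ a y v | act-++ b y v = act-cong x (e (act y v))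
    step : ∀ {x y} → CoxStep x y → ∀ v → act x v ≋ act y v
    step (braid x y s t) v = in-context x y (act-braid s t) v
    step (quad x y s) v = in-context x y {s ∷ s ∷ []} {[]} (•-involutive s) v

  act-B : ∀ {x y} → x ≈B y → ∀ v → act x v ≋ act y v
  act-B e = act-W (B⇒W e)

-- Signs of roots, the word problem and Matsumoto's theorem.

module Roots {n} {M : CoxeterMatrix n} (weights : Weights M) where
  open CoxeterMatrix M
  open Coxeter M hiding ([_])
  open Words M
  open Weights weights
  open Geometry weights
  open IntegerCoefficientSolver commutativeRing
  open import Relation.Binary.Reasoning.Setoid setoid
  open import Algebra.Properties.Group +-group using (⁻¹-involutive)
  open import Algebra.Properties.Ring ring using (-‿distribʳ-*)

  Positive Negative : V → Set
  Positive v = ∀ t → Nonneg (v t)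
  Negative v = ∀ t → Nonneg (- v t)

  Positive-resp : ∀ {v w} → v ≋ w → Positive v → Positive w
  Positive-resp e p t = nonneg-resp (e t) (p t)

  Negative-resp : ∀ {v w} → v ≋ w → Negative v → Negative w
  Negative-resp e p t = nonneg-resp (-‿cong (e t)) (p t)

  Negative-⊖ : ∀ {v} → Positive v → Negative (⊖ v)
  Negative-⊖ p t = nonneg-resp (sym (⁻¹-involutive _)) (p t)

  Positive-⊕ : ∀ {v w} → Positive v → Positive w → Positive (v ⊕ w)
  Positive-⊕ p q t = nonneg-+ (p t) (q t)

  Positive-⊙ : ∀ {a v} → Nonneg a → Positive v → Positive (a ⊙ v)
  Positive-⊙ p q t = nonneg-* p (q t)

  Negative-⊙ : ∀ {a v} → Nonneg a → Negative v → Negative (a ⊙ v)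
  Negative-⊙ p q t = nonneg-resp (sym (-‿distribʳ-* _ _)) (nonneg-* p (q t))

  α-Positive : ∀ s → Positive (α s)
  α-Positive s t with s ≟ t
  ... | yes _ = nonneg-1
  ... | no _ = nonneg-0

  act-inverse : ∀ x v → act (reverse x) (act x v) ≋ v
  act-inverse x v = ≋-trans (≋-reflexive (≡.sym (act-++ (reverse x) x v))) (act-W (reverse-inverseˡ x) v)

  act-inverse′ : ∀ x v → act x (act (reverse x) v) ≋ v
  act-inverse′ x v = ≋-trans (≋-reflexive (≡.sym (act-++ x (reverse x) v))) (act-W (reverse-inverseʳ x) v)

  root-nonzero : ∀ x s → ¬ act x (α s) ≋ zero-V
  root-nonzero x s e = 1≉0 (trans (sym (reflexive (α-same s))) (≋-trans (≋-sym (act-inverse x (α s))) (≋-trans (act-cong (reverse x) e) (act-zero (reverse x))) s))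

  ¬Positive∧Negative : ∀ x s → Positive (act x (α s)) → ¬ Negative (act x (α s))
  ¬Positive∧Negative x s p q = root-nonzero x s (λ t → nonneg-antisym (p t) (q t))

  act-∷ʳ : ∀ x s v → act (x ∷ʳ s) v ≋ act x (s • v)
  act-∷ʳ x s v = ≋-reflexive (act-++ x [ s ] v)

  act-∷ʳ-α : ∀ x s → act (x ∷ʳ s) (α s) ≋ ⊖ act x (α s)
  act-∷ʳ-α x s = ≋-trans (act-∷ʳ x s (α s)) (≋-trans (act-cong x (•-α-same s)) (act-⊖ x (α s)))

  -- Reducedness, expressed through the signs of the inversion sequence.
  Red : Word n → Set
  Red x = ∀ y s z → x ≡ y ++ s ∷ z → Positive (act y (α s))

  Red-[] : Red []
  Red-[] [] s z ()
  Red-[] (_ ∷ _) s z ()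

  Red-∷ʳ : ∀ {x s} → Red x → Positive (act x (α s)) → Red (x ∷ʳ s)
  Red-∷ʳ {x} r p y t z e with split-∷ʳ x y e
  ... | inj₁ (_ , ≡.refl , ≡.refl) = p
  ... | inj₂ (z′ , e′) = r y t z′ e′

  Red-prefix : ∀ x {y} → Red (x ++ y) → Red x
  Red-prefix x {y} r a s z ≡.refl = r a s (z ++ y) (Lₚ.++-assoc a (s ∷ z) y)

  Red-last : ∀ x {s} → Red (x ∷ʳ s) → Positive (act x (α s))
  Red-last x r = r x _ [] ≡.refl

  Red-last-Negative : ∀ x {s} → Red (x ∷ʳ s) → Negative (act (x ∷ʳ s) (α s))
  Red-last-Negative x {s} r = Negative-resp (≋-sym (act-∷ʳ-α x s)) (Negative-⊖ (Red-last x r))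

  next : Fin n → Fin n → ℕ → Fin n
  next a b zero = a
  next a b (suc p) = next b a p

  alt-∷ʳ : ∀ (a b : Fin n) p → alt a b (suc p) ≡ alt a b p ∷ʳ next a b p
  alt-∷ʳ a b zero = ≡.refl
  alt-∷ʳ a b (suc p) = ≡.cong (a ∷_) (alt-∷ʳ b a p)

  chebyshev-κ : ∀ a b p → chebyshev (κ a b) p ≈ chebyshev (κ b a) p
  chebyshev-κ a b 0 = refl
  chebyshev-κ a b 1 = refl
  chebyshev-κ a b (suc (suc p)) = +-cong (*-cong (κ-sym a b) (chebyshev-κ a b (suc p))) (-‿cong (chebyshev-κ a b p))

  -- With κ = 2 cos θ the coefficients are sin ((p + 1) θ) / sin θ and sin (p θ) / sin θ, the
  -- classical description of dihedral roots.
  alt-root : ∀ {a b} → a ≢ b → ∀ p → act (alt a b p) (α (next a b p)) ≋ chebyshev (κ a b) (suc p) ⊙ α a ⊕ chebyshev (κ a b) p ⊙ α b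
  alt-root {a} {b} ne zero t = solve 2 (λ x y → x := :1 :* x :+ :0 :* y) refl (α a t) (α b t)
  alt-root {a} {b} ne (suc p) t = begin
    (a • act (alt b a p) (α (next b a p))) t
      ≈⟨ •-cong a (alt-root (ne ∘ ≡.sym) p) t ⟩
    (a • (c₁ ⊙ α b ⊕ c₀ ⊙ α a)) t
      ≈⟨ •-⊕ a (c₁ ⊙ α b) (c₀ ⊙ α a) t ⟩
    (a • (c₁ ⊙ α b)) t + (a • (c₀ ⊙ α a)) t
      ≈⟨ +-cong (trans (•-⊙ a c₁ (α b) t) (*-congˡ (trans (•-α a b t) (+-congˡ (*-congʳ (reflexive (C-other ne))))))) (trans (•-⊙ a c₀ (α a) t) (*-congˡ (•-α-same a t))) ⟩
    c₁ * (α b t + κ a b * α a t) + c₀ * - α a t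
      ≈⟨ +-cong (*-congʳ (chebyshev-κ b a (suc p))) (*-congʳ (chebyshev-κ b a p)) ⟩
    d₁ * (α b t + κ a b * α a t) + d₀ * - α a t
      ≈⟨ solve 5 (λ c₁ c₀ k x y → c₁ :* (y :+ k :* x) :+ c₀ :* :- x := (k :* c₁ :- c₀) :* x :+ c₁ :* y) refl d₁ d₀ (κ a b) (α a t) (α b t) ⟩
    (κ a b * d₁ - d₀) * α a t + d₁ * α b t ∎
    where
    c₁ = chebyshev (κ b a) (suc p)
    c₀ = chebyshev (κ b a) p
    d₁ = chebyshev (κ a b) (suc p)
    d₀ = chebyshev (κ a b) p

  prefixed-alt-root : ∀ {a b} → a ≢ b → ∀ v p → act (v ++ alt a b p) (α (next a b p)) ≋ chebyshev (κ a b) (suc p) ⊙ act v (α a) ⊕ chebyshev (κ a b) p ⊙ act v (α b)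
  prefixed-alt-root {a} {b} ne v p = ≋-trans (≋-reflexive (act-++ v (alt a b p) _)) (≋-trans (act-cong v (alt-root ne p))
    (≋-trans (act-⊕ v _ _) (λ t → +-cong (act-⊙ v _ (α a) t) (act-⊙ v _ (α b) t))))

  prefixed-alt-root-Positive : ∀ {a b} → a ≢ b → ∀ v p → suc p ≤ m a b → Positive (act v (α a)) → Positive (act v (α b)) → Positive (act (v ++ alt a b p) (α (next a b p)))
  prefixed-alt-root-Positive ne v p l pa pb = Positive-resp (≋-sym (prefixed-alt-root ne v p))
    (Positive-⊕ (Positive-⊙ (κ-nonneg ne (suc p) l) pa) (Positive-⊙ (κ-nonneg ne p (ℕₚ.≤-trans (ℕₚ.n≤1+n p) l)) pb))

  Red-alt : ∀ {a b v} → a ≢ b → Red v → Positive (act v (α a)) → Positive (act v (α b)) → ∀ p → p ≤ m a b → Red (v ++ alt a b p)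
  Red-alt {v = v} ne r pa pb zero l = ≡.subst Red (≡.sym (Lₚ.++-identityʳ v)) r
  Red-alt {a} {b} {v} ne r pa pb (suc p) l =
    ≡.subst Red (≡.trans (Lₚ.++-assoc v (alt a b p) _) (≡.cong (v ++_) (≡.sym (alt-∷ʳ a b p))))
      (Red-∷ʳ (Red-alt ne r pa pb p (ℕₚ.≤-trans (ℕₚ.n≤1+n p) l)) (prefixed-alt-root-Positive ne v p l pa pb))

  alt-B′ : ∀ a b k → k ≡ m a b → alt a b k ≈B alt b a k
  alt-B′ a b k ≡.refl = alt-B a b

  length-∷ʳ : ∀ (x : Word n) s → length (x ∷ʳ s) ≡ suc (length x)
  length-∷ʳ x s = ≡.trans (Lₚ.length-++ x) (ℕₚ.+-comm (length x) 1)

  -- Sign dichotomy and exchange condition are joined in one alternative. Since the ring is only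
  -- partially ordered, the sign of a coefficient cannot be tested, and negativity is witnessed by a
  -- braid-equivalent reduced word ending in s.
  Descent : Word n → Fin n → Set
  Descent x s = Positive (act x (α s)) ⊎ (∃ λ y → Red (y ∷ʳ s) × x ≈B (y ∷ʳ s))

  -- Peel off the longest alternating suffix in s and the last letter of x.
  descent : ∀ k x → length x ≤ k → Red x → ∀ s → Descent x s
  descent zero [] l r s = inj₁ (α-Positive s)
  descent (suc k) x l r s with initLast x
  ... | [] = inj₁ (α-Positive s)
  ... | x′ ∷ʳ′ t with t ≟ s
  ... | yes ≡.refl = inj₂ (x′ , r , B.refl)
  ... | no t≢s = peel k x′ x′≤k t s 0 t≢s (Red-prefix x′ r) (Red-last x′ r) x′≤k (B.reflexive (≡.sym (Lₚ.++-identityʳ x′))) ≡.refl ≡.refl (ℕₚ.≤-trans (s≤s z≤n) (off t s t≢s))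
    where
    x′≤k : length x′ ≤ k
    x′≤k = ℕ.s≤s⁻¹ (≡.subst (_≤ suc k) (length-∷ʳ x′ t) l)
    -- Invariant: up to braid moves the whole word is v followed by p + 1 alternating letters
    -- starting with a, and s would be the next one. If v α b is positive too, the dihedral formula
    -- or a full braid move decides; otherwise v ends in b and the alternating suffix grows.
    peel : ∀ j v → length v ≤ j → ∀ a b p → a ≢ b → Red v → Positive (act v (α a)) → length v ≤ k → x′ ≈B (v ++ alt a b p) →
      next a b p ≡ t → next b a p ≡ s → suc p ≤ m a b → Descent (x′ ∷ʳ t) s
    peel j v v≤j a b p a≢b rv pa v≤k e next≡t next≡s p<m = cases (descent k v v≤k rv b) (suc p ℕₚ.≟ m a b)
      where
      x≈ : (x′ ∷ʳ t) ≈B (v ++ alt a b (suc p))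
      x≈ = B.trans (++-congʳB [ t ] e) (B.reflexive (≡.trans (Lₚ.++-assoc v (alt a b p) [ t ]) (≡.cong (v ++_) (≡.trans (≡.cong (alt a b p ∷ʳ_) (≡.sym next≡t)) (≡.sym (alt-∷ʳ a b p))))))
      cases : Descent v b → Dec (suc p ≡ m a b) → Descent (x′ ∷ʳ t) s
      cases (inj₁ pb) (no p≢m) = inj₁ (Positive-resp (≋-sym (act-B x≈ (α s)))
        (≡.subst (λ q → Positive (act (v ++ alt a b (suc p)) (α q))) next≡s (prefixed-alt-root-Positive a≢b v (suc p) (ℕₚ.≤∧≢⇒< p<m p≢m) pa pb)))
      cases (inj₁ pb) (yes p≡m) = inj₂ (v ++ alt b a p , ≡.subst Red flipped (Red-alt (a≢b ∘ ≡.sym) rv pb pa (suc p) (≡.subst (suc p ≤_) (symm a b) p<m))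
        , B.trans x≈ (B.trans (++-congˡB v (alt-B′ a b (suc p) p≡m)) (B.reflexive flipped)))
        where
        flipped : v ++ alt b a (suc p) ≡ (v ++ alt b a p) ∷ʳ s
        flipped = ≡.trans (≡.cong (v ++_) (≡.trans (alt-∷ʳ b a p) (≡.cong (alt b a p ∷ʳ_) next≡s))) (≡.sym (Lₚ.++-assoc v (alt b a p) [ s ]))
      cases (inj₂ (v′ , rv′ , v≈)) (no p≢m) = shorter j v≤j
        where
        v≡ : length v ≡ suc (length v′)
        v≡ = ≡.trans (length-B v≈) (length-∷ʳ v′ b)
        shorter : ∀ j → length v ≤ j → Descent (x′ ∷ʳ t) s
        shorter zero v≤0 = ⊥-elim (ℕₚ.n≮0 (≡.subst (_≤ 0) v≡ v≤0))
        shorter (suc j) v≤ = peel j v′ (ℕ.s≤s⁻¹ (≡.subst (_≤ suc j) v≡ v≤)) b a (suc p) (a≢b ∘ ≡.sym) (Red-prefix v′ rv′) (Red-last v′ rv′)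
          (ℕₚ.≤-trans (ℕₚ.n≤1+n _) (≡.subst (_≤ k) v≡ v≤k))
          (B.trans e (B.trans (++-congʳB (alt a b p) v≈) (B.reflexive (Lₚ.++-assoc v′ [ b ] (alt a b p)))))
          next≡t next≡s (≡.subst (2 ℕ.+ p ≤_) (symm a b) (ℕₚ.≤∧≢⇒< p<m p≢m))
      -- As the m-th Chebyshev value is zero, x′ α t is a nonnegative multiple of v α b, which is
      -- negative because v ends in b; this contradicts reducedness.
      cases (inj₂ (v′ , rv′ , v≈)) (yes p≡m) = ⊥-elim (¬Positive∧Negative x′ t (Red-last x′ r) (Negative-resp (≋-sym x′-root)
          (Negative-⊙ (κ-nonneg a≢b p (ℕₚ.≤-trans (ℕₚ.n≤1+n p) p<m)) (Negative-resp (≋-sym (act-B v≈ (α b))) (Red-last-Negative v′ rv′)))))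
        where
        x′-root : act x′ (α t) ≋ chebyshev (κ a b) p ⊙ act v (α b)
        x′-root y = begin
          act x′ (α t) y
            ≈⟨ act-B e (α t) y ⟩
          act (v ++ alt a b p) (α t) y
            ≡⟨ ≡.cong (λ q → act (v ++ alt a b p) (α q) y) next≡t ⟨
          act (v ++ alt a b p) (α (next a b p)) y
            ≈⟨ prefixed-alt-root a≢b v p y ⟩
          chebyshev (κ a b) (suc p) * act v (α a) y + chebyshev (κ a b) p * act v (α b) y
            ≈⟨ +-congʳ (trans (*-congʳ (trans (reflexive (≡.cong (chebyshev (κ a b)) p≡m)) (κ-vanish a≢b))) (zeroˡ _)) ⟩
          0# + chebyshev (κ a b) p * act v (α b) y
            ≈⟨ +-identityˡ _ ⟩
          chebyshev (κ a b) p * act v (α b) y ∎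

  descend : ∀ {x} → Red x → ∀ s → Descent x s
  descend {x} = descent (length x) x ℕₚ.≤-refl

  -- The field `tight` turns lengths back into signs: if no letters were cancelled, every root in
  -- the inversion sequence of x was positive. This gives `Red-by-length`.
  record NormalForm (x : Word n) : Set where
    constructor normalForm
    field
      word : Word n
      red : Red word
      equal : word ≈W x
      shorter : length word ≤ length x
      tight : length word ≡ length x → Red x

  normalise : ∀ x → NormalForm x
  normalise x = go (reverseView x)
    where
    go : ∀ {x} → Reverse x → NormalForm x
    go [] = normalForm [] Red-[] W.refl z≤n (λ _ → Red-[])
    go (x ∶ rx ∶ʳ s) with go rx
    ... | normalForm y ry y≈x y≤x tight with descend ry s
    ... | inj₁ p = normalForm (y ∷ʳ s) (Red-∷ʳ ry p) (++-congʳW [ s ] y≈x) (≡.subst₂ _≤_ (≡.sym (length-∷ʳ y s)) (≡.sym (length-∷ʳ x s)) (s≤s y≤x))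
        (λ e → Red-∷ʳ (tight (ℕₚ.suc-injective (≡.trans (≡.sym (length-∷ʳ y s)) (≡.trans e (length-∷ʳ x s))))) (Positive-resp (act-W y≈x (α s)) p))
    ... | inj₂ (z , rz , y≈zs) = normalForm z (Red-prefix z rz) z≈ (ℕₚ.≤-trans (ℕₚ.n≤1+n _) (ℕₚ.≤-trans (ℕₚ.n≤1+n _) z<x))
        (λ e → ⊥-elim (ℕₚ.1+n≰n (ℕₚ.≤-trans (ℕₚ.n≤1+n _) (≡.subst (λ j → 2 ℕ.+ j ≤ length (x ∷ʳ s)) e z<x))))
      where
      z<x : 2 ℕ.+ length z ≤ length (x ∷ʳ s)
      z<x = ≡.subst (2 ℕ.+ length z ≤_) (≡.sym (length-∷ʳ x s)) (s≤s (≡.subst (_≤ length x) (≡.trans (length-B y≈zs) (length-∷ʳ z s)) y≤x))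
      z≈ : z ≈W (x ∷ʳ s)
      z≈ = W.sym (W.trans (++-congʳW [ s ] (W.sym y≈x)) (W.trans (++-congʳW [ s ] (B⇒W y≈zs))
        (W.trans (W.reflexive (Lₚ.++-assoc z [ s ] [ s ])) (W.trans (++-congˡW z (involution s)) (W.reflexive (Lₚ.++-identityʳ z))))))

  Red-sign : ∀ {x} → Red x → ∀ s → Positive (act x (α s)) ⊎ Negative (act x (α s))
  Red-sign r s with descend r s
  ... | inj₁ p = inj₁ p
  ... | inj₂ (y , ry , x≈) = inj₂ (Negative-resp (≋-sym (act-B x≈ (α s))) (Red-last-Negative y ry))

  sign : ∀ x s → Positive (act x (α s)) ⊎ Negative (act x (α s))
  sign x s with normalise x
  ... | normalForm y ry y≈x _ _ with Red-sign ry s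
  ... | inj₁ p = inj₁ (Positive-resp (act-W y≈x (α s)) p)
  ... | inj₂ p = inj₂ (Negative-resp (act-W y≈x (α s)) p)

  no-negative-root : ∀ x → (∀ s → ¬ Negative (act x (α s))) → x ≈W []
  no-negative-root x h with normalise x
  ... | normalForm y ry y≈x _ _ with initLast y
  ... | [] = W.sym y≈x
  ... | z ∷ʳ′ s = ⊥-elim (h s (Negative-resp (act-W y≈x (α s)) (Red-last-Negative z ry)))

  α-not-Negative : ∀ s → ¬ Negative (α s)
  α-not-Negative s = ¬Positive∧Negative [] s (α-Positive s)

  infix 4 _≈W?_
  -- A nonempty reduced word sends the simple root of its last letter to a negative root, so x y⁻¹
  -- is trivial exactly when its normal form is empty.
  _≈W?_ : ∀ x y → Dec (x ≈W y)
  x ≈W? y with normalise (x ++ reverse y)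
  ... | normalForm z rz z≈ _ _ with initLast z
  ... | [] = yes (cancelʳ-W (reverse y) (W.trans (W.sym z≈) (W.sym (reverse-inverseʳ y))))
  ... | z′ ∷ʳ′ s = no λ x≈y → α-not-Negative s (Negative-resp
      (act-W (W.trans z≈ (W.trans (++-congʳW (reverse y) x≈y) (reverse-inverseʳ y))) (α s)) (Red-last-Negative z′ rz))

  -- The last letter of y is a descent of x, so `descend` rewrites x by braid moves to end in it;
  -- cancel that letter and induct.
  matsumoto : ∀ {x y} → Red x → Red y → x ≈W y → x ≈B y
  matsumoto {x} {y} rx ry e = go (reverseView y) rx ry e
    where
    go : ∀ {x y} → Reverse y → Red x → Red y → x ≈W y → x ≈B y
    go {x} [] rx ry e with initLast x
    ... | [] = B.refl
    ... | x′ ∷ʳ′ s = ⊥-elim (α-not-Negative s (Negative-resp (act-W e (α s)) (Red-last-Negative x′ rx)))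
    go {x} (y ∶ v ∶ʳ s) rx ry e with descend rx s
    ... | inj₁ p = ⊥-elim (¬Positive∧Negative x s p (Negative-resp (≋-sym (act-W e (α s))) (Red-last-Negative y ry)))
    ... | inj₂ (z , rz , x≈) = B.trans x≈ (++-congʳB [ s ] (go v (Red-prefix z rz) (Red-prefix y ry) (cancelʳ-W [ s ] (W.trans (W.sym (B⇒W x≈)) e))))

  Red-by-length : ∀ {x y} → Red x → y ≈W x → length y ≡ length x → Red y
  Red-by-length {x} {y} rx e l with normalise y
  ... | normalForm z rz z≈y _ tight = tight (≡.trans (length-B (matsumoto rz rx (W.trans z≈y e))) (≡.sym l))

  Red-≈W⇒≈B : ∀ {x y} → Red x → y ≈W x → length y ≡ length x → y ≈B x
  Red-≈W⇒≈B rx e l = matsumoto (Red-by-length rx e l) rx e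

-- The exchange condition and the Euler form.

allPairs-map∈ : ∀ {A : Set} {R S : A → A → Set} {l} → (∀ {x y} → x ∈ l → y ∈ l → R x y → S x y) → AllPairs R l → AllPairs S l
allPairs-map∈ h [] = []
allPairs-map∈ h (x ∷ xs) = All.tabulate (λ y∈ → h (here ≡.refl) (there y∈) (All.lookup x y∈)) ∷ allPairs-map∈ (λ p q → h (there p) (there q)) xs

module EulerForm {n} {M : CoxeterMatrix n} (weights : Weights M) where
  open CoxeterMatrix M
  open Coxeter M hiding ([_]; Pos)
  open Words M
  open Weights weights
  open Geometry weights
  open Roots weights
  open IntegerCoefficientSolver commutativeRing
  open import Relation.Binary.Reasoning.Setoid setoid
  open import Algebra.Properties.Group +-group using (⁻¹-involutive; ε⁻¹≈ε)
  open import Algebra.Properties.Ring ring using (-‿distribʳ-*)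

  private
    x*0 : ∀ {x y} → y ≈ 0# → x * y ≈ 0#
    x*0 e = trans (*-congˡ e) (zeroʳ _)

    0*x : ∀ {x y} → x ≈ 0# → x * y ≈ 0#
    0*x e = trans (*-congʳ e) (zeroˡ _)

  ¬Nonneg-neg-1 : ∀ {x} → x ≈ 1# → ¬ Nonneg (- x)
  ¬Nonneg-neg-1 e p = 1≉0 (nonneg-antisym nonneg-1 (nonneg-resp (-‿cong e) p))

  -- The reflection q changes only the coordinate at q, so each other coordinate is both nonnegative
  -- and nonpositive.
  flipped-support : ∀ {q v} → Positive v → Negative (q • v) → ∀ {t} → q ≢ t → v t ≈ 0#
  flipped-support {q} {v} p m {t} ne = nonneg-antisym (p t) (nonneg-resp (-‿cong (•-other ne v)) (m t))

  supported⇒multiple : ∀ {q v} → (∀ {t} → q ≢ t → v t ≈ 0#) → v ≋ v q ⊙ α q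
  supported⇒multiple {q} {v} h t with q ≟ t
  ... | yes ≡.refl = sym (*-identityʳ _)
  ... | no ne = trans (h ne) (sym (zeroʳ _))

  -- The root d α i is a multiple of α q. The coefficient is recorded only as invertible, not as 1;
  -- its inverse is the coefficient at i of d⁻¹ α q.
  record Exchange (d : Word n) (i q : Fin n) : Set where
    field
      commutes : (q ∷ d) ≈W (d ∷ʳ i)
      support : ∀ {t} → q ≢ t → act d (α i) t ≈ 0#
      inverse : Carrier
      isInverse : act d (α i) q * inverse ≈ 1#

    cancel : ∀ {x} → act d (α i) q * x ≈ 0# → x ≈ 0#
    cancel {x} e = begin
      x                                     ≈⟨ *-identityˡ x ⟨
      1# * x                                ≈⟨ *-congʳ isInverse ⟨
      act d (α i) q * inverse * x           ≈⟨ solve 3 (λ g h x → g :* h :* x := h :* (g :* x)) refl _ inverse x ⟩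
      inverse * (act d (α i) q * x)         ≈⟨ x*0 e ⟩
      0# ∎

  -- The element f = d⁻¹ q d i fixes α i, and f α t has coefficient 1 at t for every other t, since
  -- the corrections are multiples of α i. So f makes no simple root negative and is trivial.
  exchange : ∀ d i q → Positive (act d (α i)) → Negative (q • act d (α i)) → Exchange d i q
  exchange d i q pos neg = record
    { commutes = commutes ; support = support ; inverse = η i
    ; isInverse = trans (g⊙η i) (reflexive (α-same i)) }
    where
    γ η : V
    γ = act d (α i)
    η = act (reverse d) (α q)
    g : Carrier
    g = γ q
    support : ∀ {t} → q ≢ t → γ t ≈ 0#
    support = flipped-support pos neg
    γ≋ : γ ≋ g ⊙ α q
    γ≋ = supported⇒multiple support
    g⊙η : g ⊙ η ≋ α i
    g⊙η = ≋-trans (≋-sym (act-⊙ (reverse d) g (α q))) (≋-trans (act-cong (reverse d) (≋-sym γ≋)) (act-inverse d (α i)))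
    η-pos : Positive η
    η-pos with sign (reverse d) q
    ... | inj₁ p = p
    ... | inj₂ p = ⊥-elim (α-not-Negative i (Negative-resp g⊙η (Negative-⊙ (pos q) p)))
    iη-neg : Negative (i • η)
    iη-neg with sign (i ∷ reverse d) q
    ... | inj₂ p = p
    ... | inj₁ p = ⊥-elim (α-not-Negative i (Positive-resp (≋-trans (≋-sym (•-⊙ i g η)) (≋-trans (•-cong i g⊙η) (•-α-same i))) (Positive-⊙ (pos q) p)))
    η-support : ∀ {t} → i ≢ t → η t ≈ 0#
    η-support = flipped-support η-pos iη-neg
    qγ : q • γ ≋ ⊖ γ
    qγ = ≋-trans (•-cong q γ≋) (≋-trans (•-⊙ q g (α q)) (≋-trans (λ t → *-congˡ (•-α-same q t)) (λ t → trans (sym (-‿distribʳ-* _ _)) (-‿cong (sym (γ≋ t))))))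
    f : Word n
    f = reverse d ++ q ∷ d ++ [ i ]
    f-act : ∀ v → act f v ≋ act (reverse d) (q • act d (i • v))
    f-act v = ≋-reflexive (≡.trans (act-++ (reverse d) (q ∷ d ++ [ i ]) v) (≡.cong (λ w → act (reverse d) (q • w)) (act-++ d [ i ] v)))
    f-i : act f (α i) ≋ α i
    f-i = ≋-trans (f-act (α i)) (≋-trans (act-cong (reverse d) inner) (act-inverse d (α i)))
      where
      inner : q • act d (i • α i) ≋ γ
      inner = ≋-trans (•-cong q (≋-trans (act-cong d (•-α-same i)) (act-⊖ d (α i)))) (≋-trans (act-⊖ [ q ] γ) (≋-trans (λ t → -‿cong (qγ t)) (λ t → ⁻¹-involutive (γ t))))
    f-other : ∀ {t} → i ≢ t → act f (α t) t ≈ 1#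
    f-other {t} ne = begin
      act f (α t) t
        ≈⟨ f-act (α t) t ⟩
      act (reverse d) (q • act d (i • α t)) t
        ≈⟨ act-cong (reverse d) (•-cong q (≋-trans (act-cong d (•-α i t)) (≋-trans (act-⊕ d (α t) _) (λ x → +-congˡ (act-⊙ d c (α i) x))))) t ⟩
      act (reverse d) (q • (act d (α t) ⊕ c ⊙ γ)) t
        ≈⟨ act-cong (reverse d) (≋-trans (•-⊕ q (act d (α t)) (c ⊙ γ)) (λ x → +-congˡ (trans (•-⊙ q c γ x) (*-congˡ (qγ x))))) t ⟩
      act (reverse d) (act d (α t) ⊕ p ⊙ α q ⊕ c ⊙ ⊖ γ) t
        ≈⟨ ≋-trans (act-⊕ (reverse d) (act d (α t) ⊕ p ⊙ α q) (c ⊙ ⊖ γ)) (λ x → +-cong (trans (act-⊕ (reverse d) (act d (α t)) (p ⊙ α q) x) (+-cong (act-inverse d (α t) x) (act-⊙ (reverse d) p (α q) x))) (trans (act-⊙ (reverse d) c (⊖ γ) x) (*-congˡ (trans (act-⊖ (reverse d) γ x) (-‿cong (act-inverse d (α i) x)))))) t ⟩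
      α t t + p * η t + c * - α i t
        ≈⟨ +-cong (+-cong (reflexive (α-same t)) (x*0 (η-support ne))) (x*0 (trans (-‿cong (reflexive (α-other ne))) ε⁻¹≈ε)) ⟩
      1# + 0# + 0#
        ≈⟨ trans (+-identityʳ _) (+-identityʳ _) ⟩
      1# ∎
      where
      c = C i t
      p = pair gens q (act d (α t))
    f≈[] : f ≈W []
    f≈[] = no-negative-root f not-neg
      where
      not-neg : ∀ t → ¬ Negative (act f (α t))
      not-neg t neg with i ≟ t
      ... | yes ≡.refl = α-not-Negative i (Negative-resp f-i neg)
      ... | no ne = ¬Nonneg-neg-1 (f-other ne) (neg t)
    commutes : (q ∷ d) ≈W (d ∷ʳ i)
    commutes = W.sym (W.trans (++-congʳW [ i ] (W.sym (cancelˡ-W (reverse d) (W.trans f≈[] (W.sym (reverse-inverseˡ d))))))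
      (W.trans (W.reflexive (Lₚ.++-assoc (q ∷ d) [ i ] [ i ])) (W.trans (++-congˡW (q ∷ d) (involution i)) (W.reflexive (Lₚ.++-identityʳ (q ∷ d))))))

  κ-nonneg₂ : ∀ {s t} → s ≢ t → Nonneg (κ s t)
  κ-nonneg₂ {s} {t} ne = nonneg-resp (solve 1 (λ k → k :* :1 :- :0 := k) refl (κ s t)) (κ-nonneg ne 2 (off s t ne))

  -- Otherwise m s t ≥ 3, and the third Chebyshev value κ² - 1 = -1 would have to be nonnegative.
  κ≈0⇒commute : ∀ {s t} → s ≢ t → κ s t ≈ 0# → m s t ≡ 2
  κ≈0⇒commute {s} {t} ne e with m s t ℕₚ.≟ 2
  ... | yes p = p
  ... | no m≢2 = ⊥-elim (1≉0 (nonneg-antisym nonneg-1 (nonneg-resp value (κ-nonneg ne 3 (ℕₚ.≤∧≢⇒< (off s t ne) (m≢2 ∘ ≡.sym))))))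
    where
    value : κ s t * (κ s t * 1# - 0#) - 1# ≈ - 1#
    value = trans (+-congʳ (trans (*-congʳ e) (zeroˡ _))) (+-identityˡ _)

  commute⇒κ≈0 : ∀ {s t} → s ≢ t → m s t ≡ 2 → κ s t ≈ 0#
  commute⇒κ≈0 {s} {t} ne e = trans (solve 1 (λ k → k := k :* :1 :- :0) refl (κ s t)) (≡.subst (λ k → chebyshev (κ s t) k ≈ 0#) e (κ-vanish ne))

  Supported : List (Fin n) → V → Set
  Supported c v = ∀ {t} → t ∉ c → v t ≈ 0#

  -- The Euler form of c; E c v w + E c w v is the invariant bilinear form.
  E : List (Fin n) → V → V → Carrier
  E [] v w = 0#
  E (r ∷ c) v w = v r * w r - v r * pair c r w + E c v w

  E-cong : ∀ c {v v′ w w′} → (∀ {t} → t ∈ c → v t ≈ v′ t) → (∀ {t} → t ∈ c → w t ≈ w′ t) → E c v w ≈ E c v′ w′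
  E-cong [] e f = refl
  E-cong (r ∷ c) e f = +-cong (+-cong (*-cong (e (here ≡.refl)) (f (here ≡.refl))) (-‿cong (*-cong (e (here ≡.refl)) (pair-cong c r (f ∘ there))))) (E-cong c (e ∘ there) (f ∘ there))

  E-rotate : ∀ c r v w → E (c ++ [ r ]) v w ≈ E c v w + (v r * w r - pair c r v * w r)
  E-rotate [] r v w = solve 2 (λ x y → x :* y :- x :* :0 :+ :0 := :0 :+ (x :* y :- :0 :* y)) refl (v r) (w r)
  E-rotate (q ∷ c) r v w = begin
    v q * w q - v q * pair (c ++ [ r ]) q w + E (c ++ [ r ]) v w
      ≈⟨ +-cong (+-congˡ (-‿cong (*-congˡ pair-last))) (E-rotate c r v w) ⟩
    v q * w q - v q * (C r q * w r + pair c q w) + (E c v w + (v r * w r - pair c r v * w r))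
      ≈⟨ solve 8 (λ vq wq k wr p e vr p′ → vq :* wq :- vq :* (k :* wr :+ p) :+ (e :+ (vr :* wr :- p′ :* wr)) := vq :* wq :- vq :* p :+ e :+ (vr :* wr :- (k :* vq :+ p′) :* wr)) refl
          (v q) (w q) (C r q) (w r) (pair c q w) (E c v w) (v r) (pair c r v) ⟩
    v q * w q - v q * pair c q w + E c v w + (v r * w r - (C r q * v q + pair c r v) * w r) ∎
    where
    pair-last : pair (c ++ [ r ]) q w ≈ C r q * w r + pair c q w
    pair-last = trans (Σ-middle c _) (+-cong (*-congʳ (C-sym q r)) (reflexive (≡.cong (λ l → pair l q w) (Lₚ.++-identityʳ c))))

  ∉-head : ∀ {r : Fin n} {c} → Unique (r ∷ c) → r ∉ c
  ∉-head (r∉ ∷ _) r∈ = All.lookup r∉ r∈ ≡.refl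

  ∈⇒≢ : ∀ {r : Fin n} {c t} → Unique (r ∷ c) → t ∈ c → r ≢ t
  ∈⇒≢ u t∈ ≡.refl = ∉-head u t∈

  -- Substituting the coordinate `pair c r v - v r` of r • v turns the first-letter terms into the
  -- last-letter terms of `E-rotate`. Together with `E-drop` and `E-swap`, this lets the form follow
  -- every move of a sorting process.
  E-transport : ∀ r c v w → Unique (r ∷ c) → Supported (r ∷ c) v → Supported (r ∷ c) w → E (r ∷ c) (r • v) (r • w) ≈ E (c ++ [ r ]) v w
  E-transport r c v w u sv sw = begin
    (r • v) r * (r • w) r - (r • v) r * pair c r (r • w) + E c (r • v) (r • w)
      ≈⟨ +-cong (+-cong (*-cong (at-r v sv) (at-r w sw)) (-‿cong (*-cong (at-r v sv) (pair-cong c r (off-r w))))) (E-cong c (off-r v) (off-r w)) ⟩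
    (pair c r v - v r) * (pair c r w - w r) - (pair c r v - v r) * pair c r w + E c v w
      ≈⟨ solve 5 (λ p a q b e → (p :- a) :* (q :- b) :- (p :- a) :* q :+ e := e :+ (a :* b :- p :* b)) refl (pair c r v) (v r) (pair c r w) (w r) (E c v w) ⟩
    E c v w + (v r * w r - pair c r v * w r)
      ≈⟨ E-rotate c r v w ⟨
    E (c ++ [ r ]) v w ∎
    where
    off-r : ∀ v {t} → t ∈ c → (r • v) t ≈ v t
    off-r v t∈ = •-other (∈⇒≢ u t∈) v
    at-r : ∀ v → Supported (r ∷ c) v → (r • v) r ≈ pair c r v - v r
    at-r v sv = begin
      (r • v) r                             ≈⟨ •-self r v ⟩
      v r + pair gens r v                   ≈⟨ +-congˡ (pair-support r v u sv) ⟩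
      v r + (C r r * v r + pair c r v)      ≡⟨ ≡.cong (λ k → v r + (k * v r + pair c r v)) (C-same r) ⟩
      v r + (- (1# + 1#) * v r + pair c r v) ≈⟨ solve 2 (λ a p → a :+ (:- (:1 :+ :1) :* a :+ p) := p :- a) refl (v r) (pair c r v) ⟩
      pair c r v - v r ∎

  E-drop : ∀ a t b v w → v t ≈ 0# → w t ≈ 0# → E (a ++ t ∷ b) v w ≈ E (a ++ b) v w
  E-drop [] t b v w ev ew = trans (+-congʳ (trans (+-cong (0*x ev) (trans (-‿cong (0*x ev)) ε⁻¹≈ε)) (+-identityʳ 0#))) (+-identityˡ _)
  E-drop (q ∷ a) t b v w ev ew = +-cong (+-congˡ (-‿cong (*-congˡ (trans (Σ-middle a _) (trans (+-congʳ (x*0 ew)) (+-identityˡ _)))))) (E-drop a t b v w ev ew)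

  E-swap : ∀ a s t b v w → C s t ≈ 0# → E (a ++ s ∷ t ∷ b) v w ≈ E (a ++ t ∷ s ∷ b) v w
  E-swap [] s t b v w e = begin
    v s * w s - v s * (C s t * w t + pair b s w) + (v t * w t - v t * pair b t w + E b v w)
      ≈⟨ +-congʳ (+-congˡ (-‿cong (*-congˡ (trans (+-congʳ (0*x e)) (+-identityˡ _))))) ⟩
    v s * w s - v s * pair b s w + (v t * w t - v t * pair b t w + E b v w)
      ≈⟨ solve 3 (λ x y z → x :+ (y :+ z) := y :+ (x :+ z)) refl _ _ _ ⟩
    v t * w t - v t * pair b t w + (v s * w s - v s * pair b s w + E b v w)
      ≈⟨ +-congʳ (+-congˡ (-‿cong (*-congˡ (trans (+-congʳ (0*x (trans (C-sym t s) e))) (+-identityˡ _))))) ⟨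
    v t * w t - v t * (C t s * w s + pair b t w) + (v s * w s - v s * pair b s w + E b v w) ∎
  E-swap (q ∷ a) s t b v w e = +-cong (+-congˡ (-‿cong (*-congˡ pair-swap))) (E-swap a s t b v w e)
    where
    pair-swap : pair (a ++ s ∷ t ∷ b) q w ≈ pair (a ++ t ∷ s ∷ b) q w
    pair-swap = trans (Σ-middle a _) (trans (+-congˡ (Σ-middle a _)) (trans (solve 3 (λ x y z → x :+ (y :+ z) := y :+ (x :+ z)) refl _ _ _)
      (sym (trans (Σ-middle a _) (+-congˡ (Σ-middle a _))))))

  pair-zero : ∀ c r {v} → (∀ {t} → t ∈ c → v t ≈ 0#) → pair c r v ≈ 0#
  pair-zero [] r z = refl
  pair-zero (q ∷ c) r z = trans (+-cong (x*0 (z (here ≡.refl))) (pair-zero c r (z ∘ there))) (+-identityˡ 0#)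

  E-zeroʳ : ∀ c {v w} → (∀ {t} → t ∈ c → w t ≈ 0#) → E c v w ≈ 0#
  E-zeroʳ [] z = refl
  E-zeroʳ (q ∷ c) z = trans (+-cong (+-cong (x*0 (z (here ≡.refl))) (-‿cong (x*0 (pair-zero c q (z ∘ there))))) (E-zeroʳ c (z ∘ there)))
    (solve 0 (:0 :+ :- :0 :+ :0 := :0) refl)

  E-zeroˡ : ∀ c {v w} → (∀ {t} → t ∈ c → v t ≈ 0#) → E c v w ≈ 0#
  E-zeroˡ [] z = refl
  E-zeroˡ (q ∷ c) z = trans (+-cong (+-cong (0*x (z (here ≡.refl))) (-‿cong (0*x (z (here ≡.refl))))) (E-zeroˡ c (z ∘ there)))
    (solve 0 (:0 :+ :- :0 :+ :0 := :0) refl)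

  -- Against a multiple of α r, with r at an end of the list, one slot reads off the coordinate at r
  -- of the other vector. This and its three variants convert statements about the form into
  -- statements about one coordinate.
  E-firstʳ : ∀ {r c} v w → Unique (r ∷ c) → (∀ {t} → r ≢ t → w t ≈ 0#) → E (r ∷ c) v w ≈ v r * w r
  E-firstʳ {r} {c} v w u z = trans (+-cong (+-congˡ (-‿cong (x*0 (pair-zero c r z′)))) (E-zeroʳ c z′))
    (solve 1 (λ x → x :+ :- :0 :+ :0 := x) refl _)
    where
    z′ : ∀ {t} → t ∈ c → w t ≈ 0#
    z′ t∈ = z (∈⇒≢ u t∈)

  E-firstˡ : ∀ {r c} v w → Unique (r ∷ c) → (∀ {t} → r ≢ t → v t ≈ 0#) → E (r ∷ c) v w ≈ v r * w r - v r * pair c r w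
  E-firstˡ {r} {c} v w u z = trans (+-congˡ (E-zeroˡ c (λ t∈ → z (∈⇒≢ u t∈)))) (+-identityʳ _)

  E-lastˡ : ∀ {r c} v w → Unique (r ∷ c) → (∀ {t} → r ≢ t → v t ≈ 0#) → E (c ++ [ r ]) v w ≈ v r * w r
  E-lastˡ {r} {c} v w u z = trans (E-rotate c r v w) (trans (+-cong (E-zeroˡ c z′) (+-congˡ (-‿cong (0*x (pair-zero c r z′)))))
    (solve 1 (λ x → :0 :+ (x :+ :- :0) := x) refl _))
    where
    z′ : ∀ {t} → t ∈ c → v t ≈ 0#
    z′ t∈ = z (∈⇒≢ u t∈)

  E-lastʳ : ∀ {r c} v w → Unique (r ∷ c) → (∀ {t} → r ≢ t → w t ≈ 0#) → E (c ++ [ r ]) v w ≈ v r * w r - pair c r v * w r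
  E-lastʳ {r} {c} v w u z = trans (E-rotate c r v w) (trans (+-congʳ (E-zeroʳ c (λ t∈ → z (∈⇒≢ u t∈)))) (+-identityˡ _))

  -- The form is triangular on simple roots: one of the two values vanishes and the other is -C i j,
  -- so the form remembers the order of any two noncommuting letters of c.
  E-simple : ∀ c → Unique c → AllPairs (λ i j → E c (α j) (α i) ≈ 0# × E c (α i) (α j) ≈ - C i j) c
  E-simple [] u = []
  E-simple (x ∷ c) u@(_ ∷ u′) = All.tabulate first ∷ allPairs-map∈ rest (E-simple c u′)
    where
    first : ∀ {j} → j ∈ c → E (x ∷ c) (α j) (α x) ≈ 0# × E (x ∷ c) (α x) (α j) ≈ - C x j
    first {j} j∈ = trans (E-firstʳ (α j) (α x) u (λ ne → reflexive (α-other ne))) (0*x (reflexive (α-other j≢x)))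
      , trans (E-firstˡ (α x) (α j) u (λ ne → reflexive (α-other ne)))
          (trans (+-cong (x*0 (reflexive (α-other j≢x))) (-‿cong (*-cong (reflexive (α-same x)) (trans (sym (pair-support x (α j) u′ off-j)) (pair-α x j)))))
            (solve 1 (λ k → :0 :+ :- (:1 :* k) := :- k) refl _))
      where
      j≢x : j ≢ x
      j≢x = ∈⇒≢ u j∈ ∘ ≡.sym
      off-j : Supported c (α j)
      off-j {t} t∉ = reflexive (α-other {j} {t} λ { ≡.refl → t∉ j∈ })
    rest : ∀ {i j} → i ∈ c → j ∈ c → E c (α j) (α i) ≈ 0# × E c (α i) (α j) ≈ - C i j → E (x ∷ c) (α j) (α i) ≈ 0# × E (x ∷ c) (α i) (α j) ≈ - C i j
    rest {i} {j} i∈ j∈ (e , f) = trans (E-drop [] x c (α j) (α i) (z j∈) (z i∈)) e , trans (E-drop [] x c (α i) (α j) (z i∈) (z j∈)) f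
      where
      z : ∀ {k} → k ∈ c → α k x ≈ 0#
      z k∈ = reflexive (α-other (∈⇒≢ u k∈ ∘ ≡.sym))

-- Sorted words as a queue process.

unique-rotate : ∀ {A : Set} {r : A} {c} → Unique (r ∷ c) → Unique (c ++ [ r ])
unique-rotate (r∉ ∷ u) = Uniqueₚ.++⁺ u ([] ∷ []) λ { (r∈ , here ≡.refl) → All.lookup r∉ r∈ ≡.refl }

∈-unrotate : ∀ {A : Set} {r t : A} c → t ∈ c ++ [ r ] → t ∈ r ∷ c
∈-unrotate c p with ∈-++⁻ c p
... | inj₁ q = there q
... | inj₂ (here e) = here e

∈-swap : ∀ {A : Set} (a : List A) {s t x b} → x ∈ a ++ s ∷ t ∷ b → x ∈ a ++ t ∷ s ∷ b
∈-swap [] (here e) = there (here e)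
∈-swap [] (there (here e)) = here e
∈-swap [] (there (there p)) = there (there p)
∈-swap (_ ∷ a) (here e) = here e
∈-swap (_ ∷ a) (there p) = there (∈-swap a p)

unique-swap : ∀ {A : Set} (a : List A) {s t b} → Unique (a ++ s ∷ t ∷ b) → Unique (a ++ t ∷ s ∷ b)
unique-swap [] ((s≢t ∷ s∉) ∷ (t∉ ∷ u)) = ((s≢t ∘ ≡.sym) ∷ t∉) ∷ (s∉ ∷ u)
unique-swap (x ∷ a) (x∉ ∷ u) = All.tabulate (λ y∈ → All.lookup x∉ (∈-swap a y∈)) ∷ unique-swap a u

unique-swap-≢ : ∀ {A : Set} (a : List A) {s t b} → Unique (a ++ s ∷ t ∷ b) → s ≢ t
unique-swap-≢ [] ((s≢t ∷ _) ∷ _) = s≢t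
unique-swap-≢ (x ∷ a) (_ ∷ u) = unique-swap-≢ a u

module SortedWords {n} (M : CoxeterMatrix n) where
  open CoxeterMatrix M
  open Coxeter M hiding ([_])
  open Words M

  -- The Cambrian recurrence on a queue: a letter that is read goes to the back, and one that is
  -- skipped is gone for all later copies of c.
  data Sorted : List (Fin n) → Word n → Set where
    nil  : ∀ {c} → Sorted c []
    take : ∀ {s c w} → Sorted (c ++ [ s ]) w → Sorted (s ∷ c) (s ∷ w)
    skip : ∀ {s c w} → Sorted c w → Sorted (s ∷ c) w

  -- Here unused letters may be discarded early and commuting neighbours of c
  -- exchanged; up to commutation of letters this gives the same words as Sorted.
  data WeaklySorted : List (Fin n) → Word n → Set where
    nil  : ∀ {c} → WeaklySorted c []
    take : ∀ {s c w} → WeaklySorted (c ++ [ s ]) w → WeaklySorted (s ∷ c) (s ∷ w)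
    drop : ∀ a {s b w} → WeaklySorted (a ++ b) w → WeaklySorted (a ++ s ∷ b) w
    swap : ∀ a {s t b w} → m s t ≡ 2 → WeaklySorted (a ++ s ∷ t ∷ b) w → WeaklySorted (a ++ t ∷ s ∷ b) w

  sorted⇒weaklySorted : ∀ {c w} → Sorted c w → WeaklySorted c w
  sorted⇒weaklySorted nil = nil
  sorted⇒weaklySorted (take d) = take (sorted⇒weaklySorted d)
  sorted⇒weaklySorted (skip d) = drop [] (sorted⇒weaklySorted d)

  Sorted-drop : ∀ {c w} → Sorted c w → ∀ a {k b} → c ≡ a ++ b → Sorted (a ++ k ∷ b) w
  Sorted-drop nil a e = nil
  Sorted-drop (take d) [] ≡.refl = skip (take d)
  Sorted-drop (take {s = s} d) (s ∷ a) {k} {b} ≡.refl = take (≡.subst (λ l → Sorted l _) (≡.sym (Lₚ.++-assoc a (k ∷ b) [ s ])) (Sorted-drop d a (Lₚ.++-assoc a b [ s ])))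
  Sorted-drop (skip d) [] ≡.refl = skip (skip d)
  Sorted-drop (skip d) (s ∷ a) ≡.refl = skip (Sorted-drop d a ≡.refl)

  Sorted-swap : ∀ {c w} → Sorted c w → ∀ a {s t b} → m s t ≡ 2 → c ≡ a ++ s ∷ t ∷ b → ∃ λ w′ → Sorted (a ++ t ∷ s ∷ b) w′ × w ≈B w′
  Sorted-swap nil a e eq = [] , nil , B.refl
  Sorted-swap (take {s = r} d) (r ∷ a) {s} {t} {b} e ≡.refl with Sorted-swap d a e (Lₚ.++-assoc a (s ∷ t ∷ b) [ r ])
  ... | w′ , d′ , w≈ = r ∷ w′ , take (≡.subst (λ l → Sorted l w′) (≡.sym (Lₚ.++-assoc a (t ∷ s ∷ b) [ r ])) d′) , ++-congˡB [ r ] w≈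
  Sorted-swap (skip d) (r ∷ a) e ≡.refl with Sorted-swap d a e ≡.refl
  ... | w′ , d′ , w≈ = w′ , skip d′ , w≈
  Sorted-swap (take nil) [] e ≡.refl = _ , skip (take nil) , B.refl
  Sorted-swap (take (skip d)) [] e ≡.refl = _ , skip (take d) , B.refl
  Sorted-swap (skip nil) [] e ≡.refl = _ , nil , B.refl
  Sorted-swap (skip (take d)) [] e ≡.refl = _ , take (skip d) , B.refl
  Sorted-swap (skip (skip d)) [] e ≡.refl = _ , skip (skip d) , B.refl
  -- The one case in which both exchanged letters are read, so that the word itself changes by a
  -- commutation.
  Sorted-swap (take (take d)) [] {s} {t} {b} e ≡.refl with Sorted-swap d b e (Lₚ.++-assoc b [ s ] [ t ])
  ... | w′ , d′ , w≈ = _ , take (take (≡.subst (λ l → Sorted l w′) (≡.sym (Lₚ.++-assoc b [ t ] [ s ])) d′)) , B.trans (swap-B e _) (++-congˡB (t ∷ s ∷ []) w≈)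

  weaklySorted⇒sorted : ∀ {c w} → WeaklySorted c w → ∃ λ w′ → Sorted c w′ × w ≈B w′
  weaklySorted⇒sorted nil = [] , nil , B.refl
  weaklySorted⇒sorted (take {s = s} d) with weaklySorted⇒sorted d
  ... | w′ , d′ , w≈ = s ∷ w′ , take d′ , ++-congˡB [ s ] w≈
  weaklySorted⇒sorted (drop a d) with weaklySorted⇒sorted d
  ... | w′ , d′ , w≈ = w′ , Sorted-drop d′ a ≡.refl , w≈
  weaklySorted⇒sorted (swap a e d) with weaklySorted⇒sorted d
  ... | w′ , d′ , w≈ with Sorted-swap d′ a e ≡.refl
  ... | w″ , d″ , w′≈ = w″ , d″ , B.trans w≈ w′≈

  letters : ∀ {c w} → WeaklySorted c w → All (_∈ c) w
  letters nil = []
  letters (take {c = c} d) = here ≡.refl ∷ All.map (∈-unrotate c) (letters d)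
  letters (drop a d) = All.map (∈-middle⁺ a) (letters d)
  letters (swap a e d) = All.map (∈-swap a) (letters d)

  module _ {P : Fin n → Set} (P? : Decidable P) where

    filter-sorted : ∀ {c w} → WeaklySorted c w → All P w → WeaklySorted (filter P? c) w
    filter-sorted nil ps = nil
    filter-sorted (take {s} {c} {w} d) (p ∷ ps) = ≡.subst (λ l → WeaklySorted l _) (≡.sym (Lₚ.filter-accept P? p))
      (take (≡.subst (λ l → WeaklySorted l w) (≡.trans (Lₚ.filter-++ P? c [ s ]) (≡.cong (filter P? c ++_) (Lₚ.filter-accept P? p))) (filter-sorted d ps)))
    filter-sorted (drop a {s} {b} {w} d) ps rewrite Lₚ.filter-++ P? a (s ∷ b) with filter-sorted d ps
    ... | ih rewrite Lₚ.filter-++ P? a b with P? s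
    ... | yes _ = drop (filter P? a) ih
    ... | no _ = ih
    filter-sorted (swap a {s} {t} {b} {w} e d) ps = ≡.subst (λ l → WeaklySorted l w) (≡.sym (Lₚ.filter-++ P? a (t ∷ s ∷ b)))
      (cases (P? s) (P? t) (≡.subst (λ l → WeaklySorted l w) (Lₚ.filter-++ P? a (s ∷ t ∷ b)) (filter-sorted d ps)))
      where
      both : ∀ {s t} → P s → P t → filter P? (s ∷ t ∷ b) ≡ s ∷ t ∷ filter P? b
      both ps pt = ≡.trans (Lₚ.filter-accept P? ps) (≡.cong (_ ∷_) (Lₚ.filter-accept P? pt))
      first : ∀ {s t} → P s → ¬ P t → filter P? (s ∷ t ∷ b) ≡ filter P? (t ∷ s ∷ b)
      first ps ¬pt = ≡.trans (Lₚ.filter-accept P? ps) (≡.trans (≡.cong (_ ∷_) (Lₚ.filter-reject P? ¬pt)) (≡.sym (≡.trans (Lₚ.filter-reject P? ¬pt) (Lₚ.filter-accept P? ps))))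
      neither : ∀ {s t} → ¬ P s → ¬ P t → filter P? (s ∷ t ∷ b) ≡ filter P? b
      neither ¬ps ¬pt = ≡.trans (Lₚ.filter-reject P? ¬ps) (Lₚ.filter-reject P? ¬pt)
      cases : Dec (P s) → Dec (P t) → WeaklySorted (filter P? a ++ filter P? (s ∷ t ∷ b)) w → WeaklySorted (filter P? a ++ filter P? (t ∷ s ∷ b)) w
      cases (yes ps) (yes pt) h = ≡.subst (λ l → WeaklySorted (filter P? a ++ l) w) (≡.sym (both pt ps))
        (swap (filter P? a) e (≡.subst (λ l → WeaklySorted (filter P? a ++ l) w) (both ps pt) h))
      cases (yes ps) (no ¬pt) h = ≡.subst (λ l → WeaklySorted (filter P? a ++ l) w) (first ps ¬pt) h
      cases (no ¬ps) (yes pt) h = ≡.subst (λ l → WeaklySorted (filter P? a ++ l) w) (≡.sym (first pt ¬ps)) h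
      cases (no ¬ps) (no ¬pt) h = ≡.subst (λ l → WeaklySorted (filter P? a ++ l) w) (≡.trans (neither ¬ps ¬pt) (≡.sym (neither ¬pt ¬ps))) h

    unfilter-sorted : ∀ a c d {w} → WeaklySorted (a ++ filter P? c ++ d) w → WeaklySorted (a ++ c ++ d) w
    unfilter-sorted a [] d s = s
    unfilter-sorted a (x ∷ c) d s with P? x
    ... | yes _ = ≡.subst (λ l → WeaklySorted l _) (Lₚ.++-assoc a [ x ] (c ++ d)) (unfilter-sorted (a ++ [ x ]) c d (≡.subst (λ l → WeaklySorted l _) (≡.sym (Lₚ.++-assoc a [ x ] (filter P? c ++ d))) s))
    ... | no _ = drop a (unfilter-sorted a c d s)

  move-right : ∀ p {i} a d {w} → All (λ k → m i k ≡ 2) a → WeaklySorted (p ++ i ∷ a ++ d) w → WeaklySorted (p ++ a ++ i ∷ d) w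
  move-right p [] d [] s = s
  move-right p {i} (x ∷ a) d (e ∷ es) s = ≡.subst (λ l → WeaklySorted l _) (Lₚ.++-assoc p [ x ] (a ++ i ∷ d))
    (move-right (p ++ [ x ]) a d es (≡.subst (λ l → WeaklySorted l _) (≡.sym (Lₚ.++-assoc p [ x ] (i ∷ a ++ d))) (swap p e s)))

-- Transporting the form along a sorted word.

module Reaching {n} {M : CoxeterMatrix n} (weights : Weights M) where
  open CoxeterMatrix M
  open Coxeter M hiding ([_]; Pos)
  open Words M
  open Weights weights
  open Geometry weights
  open Roots weights
  open EulerForm weights
  open SortedWords M
  open IntegerCoefficientSolver commutativeRing
  open import Relation.Binary.Reasoning.Setoid setoid
  open import Algebra.Properties.Group +-group using (ε⁻¹≈ε)

  Supported-⊆ : ∀ {c d v} → (∀ {t} → t ∈ c → t ∈ d) → Supported c v → Supported d v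
  Supported-⊆ ⊆ z t∉ = z (t∉ ∘ ⊆)

  Supported-resp : ∀ {c v w} → v ≋ w → Supported c v → Supported c w
  Supported-resp e z {t} t∉ = trans (sym (e t)) (z t∉)

  Supported-• : ∀ {c r v} → r ∈ c → Supported c v → Supported c (r • v)
  Supported-• {r = r} {v} r∈ z t∉ = trans (•-other {r} (λ { ≡.refl → t∉ r∈ }) v) (z t∉)

  Supported-act : ∀ {c x v} → All (_∈ c) x → Supported c v → Supported c (act x v)
  Supported-act [] z = z
  Supported-act {x = s ∷ x} (p ∷ ps) z = Supported-• {v = act x _} p (Supported-act ps z)

  Supported-α : ∀ {c s} → s ∈ c → Supported c (α s)
  Supported-α {s = s} s∈ {t} t∉ = reflexive (α-other {s} {t} λ { ≡.refl → t∉ s∈ })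

  C-commute : ∀ {s t} → s ≢ t → m s t ≡ 2 → C s t ≈ 0#
  C-commute ne e = trans (reflexive (C-other ne)) (commute⇒κ≈0 ne e)

  -- The state of a sorting process that has read x and is about to read s.
  record Reached (c : List (Fin n)) (x : Word n) (s : Fin n) (u : Word n) : Set where
    field
      rest : List (Fin n)
      unique : Unique (s ∷ rest)
      continue : WeaklySorted (rest ++ [ s ]) u
      replay : ∀ {u′} → WeaklySorted (s ∷ rest) u′ → WeaklySorted c (x ++ u′)
      supported : ∀ {v} → Supported (s ∷ rest) v → Supported c (act x v)
      transport : ∀ v w → Supported (s ∷ rest) v → Supported (s ∷ rest) w → E c (act x v) (act x w) ≈ E (s ∷ rest) v w

  reach : ∀ {c y} → Unique c → WeaklySorted c y → ∀ x {s u} → y ≡ x ++ s ∷ u → Reached c x s u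
  reach u nil [] ()
  reach u nil (_ ∷ _) ()
  reach u (take {s = r} {c} d) [] ≡.refl = record
    { rest = c ; unique = u ; continue = d ; replay = λ h → h ; supported = λ h → h ; transport = λ v w _ _ → refl }
  reach {y = r ∷ y} u (take {s = r} {c} d) (r ∷ x) ≡.refl = record
    { rest = rest ; unique = unique ; continue = continue
    ; replay = λ h → take (replay h)
    ; supported = λ h → Supported-• {v = act x _} (here ≡.refl) (Supported-⊆ {v = act x _} (∈-unrotate c) (supported h))
    ; transport = λ v w sv sw → trans (E-transport r c (act x v) (act x w) u (Supported-⊆ {v = act x v} (∈-unrotate c) (supported sv)) (Supported-⊆ {v = act x w} (∈-unrotate c) (supported sw))) (transport v w sv sw) }
    where open Reached (reach (unique-rotate u) d x ≡.refl)
  reach u (drop a {t} {b} d) x e = record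
    { rest = rest ; unique = unique ; continue = continue
    ; replay = λ h → drop a (replay h)
    ; supported = λ h → Supported-⊆ {v = act x _} (∈-middle⁺ a) (supported h)
    ; transport = λ v w sv sw → trans (E-drop a t b (act x v) (act x w) (supported sv (proj₂ (unique-middle a u))) (supported sw (proj₂ (unique-middle a u)))) (transport v w sv sw) }
    where open Reached (reach (proj₁ (unique-middle a u)) d x e)
  reach u (swap a {s} {t} {b} e d) x eq = record
    { rest = rest ; unique = unique ; continue = continue
    ; replay = λ h → swap a e (replay h)
    ; supported = λ h → Supported-⊆ {v = act x _} (∈-swap a) (supported h)
    ; transport = λ v w sv sw → trans (sym (E-swap a s t b (act x v) (act x w) (C-commute (unique-swap-≢ a (unique-swap a u)) e))) (transport v w sv sw) }
    where open Reached (reach (unique-swap a u) d x eq)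

  commute-≢ : ∀ {s q} → m s q ≡ 2 → s ≢ q
  commute-≢ {s} e ≡.refl with ≡.trans (≡.sym (diag s)) e
  ... | ()

  commute-past : ∀ {s} y → All (λ q → m s q ≡ 2) y → (s ∷ y) ≈B (y ∷ʳ s)
  commute-past [] [] = B.refl
  commute-past {s} (q ∷ y) (e ∷ es) = B.trans (swap-B e y) (++-congˡB [ q ] (commute-past y es))

  commute-fixes : ∀ {s} y → All (λ q → m s q ≡ 2) y → act y (α s) ≋ α s
  commute-fixes [] [] = ≋-refl
  commute-fixes {s} (q ∷ y) (e ∷ es) = ≋-trans (•-cong q (commute-fixes y es)) (≋-trans (•-α q s)
    (λ t → trans (+-congˡ (trans (*-congʳ (C-commute (commute-≢ e ∘ ≡.sym) (≡.trans (symm q s) e))) (zeroˡ _))) (+-identityʳ _)))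

  act-coordinate : ∀ {s} y v → All (λ q → s ≢ q) y → act y v s ≈ v s
  act-coordinate [] v [] = refl
  act-coordinate (q ∷ y) v (ne ∷ nes) = trans (•-other (ne ∘ ≡.sym) (act y v)) (act-coordinate y v nes)

  -- Here s carries the reflection r, the last letter of the queue. A later letter not commuting
  -- with s would give its root a positive coefficient at r, which the form excludes. So s can be
  -- moved to the end of v, and the word without s stays sorted.
  module FinalLetter {c r v x s y} (u : Unique (r ∷ c)) (d : WeaklySorted (c ++ [ r ]) v) (red : Red v) (split : v ≡ x ++ s ∷ y)
    (neg : Negative (r • act x (α s))) where

    pos : Positive (act x (α s))
    pos = red x s y split

    open Exchange (exchange x s r pos neg) public
    open Reached (reach (unique-rotate u) d x split)

    g : Carrier
    g = act x (α s) r

    -- The Euler form of c r with a multiple of α r on the left reads off the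
    -- coefficient at r, and transporting it past x s reads off that at s.
    coefficient : ∀ w → Supported (s ∷ rest) w → g * act x (s • w) r ≈ - w s
    coefficient w sw = begin
      g * act x (s • w) r
        ≈⟨ solve 2 (λ a b → a :* b := :- (:- a :* b)) refl g (act x (s • w) r) ⟩
      - (- g * act x (s • w) r)
        ≈⟨ -‿cong (*-congʳ (xs-α r)) ⟨
      - (act x (s • α s) r * act x (s • w) r)
        ≈⟨ -‿cong (E-lastˡ (act x (s • α s)) (act x (s • w)) u (λ {t} ne → trans (xs-α t) (trans (-‿cong (support ne)) ε⁻¹≈ε))) ⟨
      - E (c ++ [ r ]) (act x (s • α s)) (act x (s • w))
        ≈⟨ -‿cong (transport (s • α s) (s • w) (Supported-• {v = α s} (here ≡.refl) sα) (Supported-• {v = w} (here ≡.refl) sw)) ⟩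
      - E (s ∷ rest) (s • α s) (s • w)
        ≈⟨ -‿cong (E-transport s rest (α s) w unique sα sw) ⟩
      - E (rest ++ [ s ]) (α s) w
        ≈⟨ -‿cong (E-lastˡ (α s) w unique (λ ne → reflexive (α-other ne))) ⟩
      - (α s s * w s)
        ≈⟨ -‿cong (trans (*-congʳ (reflexive (α-same s))) (*-identityˡ _)) ⟩
      - w s ∎
      where
      sα : Supported (s ∷ rest) (α s)
      sα = Supported-α (here ≡.refl)
      xs-α : act x (s • α s) ≋ ⊖ act x (α s)
      xs-α = ≋-trans (act-cong x (•-α-same s)) (act-⊖ x (α s))

    rest-letters : All (_∈ s ∷ rest) y
    rest-letters = All.map (∈-unrotate rest) (letters continue)

    commuting-step : ∀ y₁ q y₂ → y ≡ y₁ ++ q ∷ y₂ → All (λ q → m s q ≡ 2) y₁ → m s q ≡ 2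
    commuting-step y₁ q y₂ e cy₁ with s ≟ q
    ... | yes ≡.refl = ⊥-elim (¬Positive∧Negative (x ++ s ∷ y₁) s
          (red (x ++ s ∷ y₁) s y₂ (≡.trans split (≡.trans (≡.cong (λ z → x ++ s ∷ z) e) (≡.sym (Lₚ.++-assoc x (s ∷ y₁) _)))))
          (Negative-resp (≋-sym root) (Negative-⊖ {v = act x (α s)} pos)))
      where
      root : act (x ++ s ∷ y₁) (α s) ≋ ⊖ act x (α s)
      root = ≋-trans (≋-reflexive (act-++ x (s ∷ y₁) (α s))) (≋-trans (act-cong x (≋-trans (•-cong s (commute-fixes y₁ cy₁)) (•-α-same s))) (act-⊖ x (α s)))
    ... | no s≢q = κ≈0⇒commute s≢q κ≈0
      where
      β δ : V
      β = act (x ++ s ∷ y₁) (α q)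
      δ = act (x ++ y₁) (α q)
      β-pos : Positive β
      β-pos = red (x ++ s ∷ y₁) q y₂ (≡.trans split (≡.trans (≡.cong (λ z → x ++ s ∷ z) e) (≡.sym (Lₚ.++-assoc x (s ∷ y₁) _))))
      q∈ : q ∈ s ∷ rest
      q∈ = All.lookup rest-letters (≡.subst (q ∈_) (≡.sym e) (∈-++⁺ʳ y₁ (here ≡.refl)))
      y₁∈ : All (_∈ s ∷ rest) y₁
      y₁∈ = Allₚ.++⁻ˡ y₁ (≡.subst (All (_∈ s ∷ rest)) e rest-letters)
      -- Apply `coefficient` to w = y₁ α q: its coordinate at s is zero because neither q nor a
      -- letter of y₁ is s.
      β-r : β r ≈ 0#
      β-r = cancel (begin
        g * act (x ++ s ∷ y₁) (α q) r         ≡⟨ ≡.cong (λ w → g * w r) (act-++ x (s ∷ y₁) (α q)) ⟩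
        g * act x (s • act y₁ (α q)) r        ≈⟨ coefficient (act y₁ (α q)) (Supported-act y₁∈ (Supported-α q∈)) ⟩
        - act y₁ (α q) s                      ≈⟨ -‿cong (trans (act-coordinate y₁ (α q) (All.map commute-≢ cy₁)) (reflexive (α-other (s≢q ∘ ≡.sym)))) ⟩
        - 0#                                  ≈⟨ ε⁻¹≈ε ⟩
        0# ∎)
      expand : β ≋ δ ⊕ κ s q ⊙ act x (α s)
      expand t = begin
        act (x ++ s ∷ y₁) (α q) t
          ≈⟨ act-B (++-congˡB x (commute-past y₁ cy₁)) (α q) t ⟩
        act (x ++ y₁ ∷ʳ s) (α q) t
          ≡⟨ ≡.cong (λ z → act z (α q) t) (Lₚ.++-assoc x y₁ [ s ]) ⟨
        act ((x ++ y₁) ∷ʳ s) (α q) t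
          ≈⟨ ≋-trans (act-∷ʳ (x ++ y₁) s (α q)) (≋-trans (act-cong (x ++ y₁) (•-α s q)) (act-⊕ (x ++ y₁) (α q) _)) t ⟩
        δ t + act (x ++ y₁) (C s q ⊙ α s) t
          ≈⟨ +-congˡ (trans (act-⊙ (x ++ y₁) (C s q) (α s) t) (*-cong (reflexive (C-other s≢q)) (≋-trans (≋-reflexive (act-++ x y₁ (α s))) (act-cong x (commute-fixes y₁ cy₁)) t))) ⟩
        δ t + κ s q * act x (α s) t ∎
      κ≈0 : κ s q ≈ 0#
      κ≈0 with sign (x ++ y₁) q
      -- Both δ r and κ s q * g are nonnegative and their sum β r is zero; the invertible g can be
      -- cancelled.
      ... | inj₁ δ-pos = cancel (trans (*-comm g (κ s q)) (nonneg-antisym κg (nonneg-resp κg≈ (δ-pos r))))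
        where
        κg : Nonneg (κ s q * g)
        κg = nonneg-* (κ-nonneg₂ s≢q) (pos r)
        κg≈ : δ r ≈ - (κ s q * g)
        κg≈ = begin
          δ r                              ≈⟨ solve 2 (λ a b → a := a :+ b :- b) refl (δ r) (κ s q * g) ⟩
          δ r + κ s q * g - κ s q * g      ≈⟨ +-congʳ (trans (sym (expand r)) β-r) ⟩
          0# - κ s q * g                   ≈⟨ +-identityˡ _ ⟩
          - (κ s q * g) ∎
      -- Off r the roots β and δ agree but have opposite signs, so β would be the zero vector.
      ... | inj₂ δ-neg = ⊥-elim (root-nonzero (x ++ s ∷ y₁) q β≋0)
        where
        β≋0 : β ≋ zero-V
        β≋0 t with r ≟ t
        ... | yes ≡.refl = β-r
        ... | no ne = nonneg-antisym (β-pos t) (nonneg-resp (-‿cong (sym (trans (expand t) (trans (+-congˡ (trans (*-congˡ (support ne)) (zeroʳ _))) (+-identityʳ _))))) (δ-neg t))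

    commuting : All (λ q → m s q ≡ 2) y
    commuting = go [] y ≡.refl []
      where
      go : ∀ y₁ y₂ → y ≡ y₁ ++ y₂ → All (λ q → m s q ≡ 2) y₁ → All (λ q → m s q ≡ 2) y₂
      go y₁ [] e cy₁ = []
      go y₁ (q ∷ y₂) e cy₁ = cq ∷ go (y₁ ∷ʳ q) y₂ (≡.trans e (≡.sym (Lₚ.∷ʳ-++ y₁ q y₂))) (Allₚ.++⁺ cy₁ (cq ∷ []))
        where cq = commuting-step y₁ q y₂ e cy₁

    removed : WeaklySorted (c ++ [ r ]) (x ++ y)
    removed = replay (drop [] (≡.subst (λ l → WeaklySorted l y) (Lₚ.++-identityʳ rest)
      (unfilter-sorted ≢s? [] rest [] (≡.subst (λ l → WeaklySorted l y) (≡.trans (Lₚ.filter-++ ≢s? rest [ s ]) (≡.cong (filter ≢s? rest ++_) (Lₚ.filter-reject ≢s? (λ ne → ne ≡.refl)))) (filter-sorted ≢s? continue (All.map commute-≢ commuting))))))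
      where
      ≢s? : Decidable (s ≢_)
      ≢s? t with s ≟ t
      ... | yes e = no (λ ne → ne e)
      ... | no ne = yes ne

    extracted : (x ++ s ∷ y) ≈B ((x ++ y) ∷ʳ s)
    extracted = B.trans (++-congˡB x (commute-past y commuting)) (B.reflexive (≡.sym (Lₚ.++-assoc x y [ s ])))

-- Restriction of sorted words to a parabolic subgroup.

allPairs-middle : ∀ {A : Set} {R : A → A → Set} a {i b} → AllPairs R (a ++ i ∷ b) → All (λ k → R k i) a × All (R i) b × AllPairs R (a ++ b)
allPairs-middle [] (p ∷ ps) = [] , p , ps
allPairs-middle (x ∷ a) (p ∷ ps) with allPairs-middle a ps
... | before , after , rest = All.lookup p (∈-++⁺ʳ a (here ≡.refl)) ∷ before , after , Allₚ.++⁺ (Allₚ.++⁻ˡ a p) (All.tail (Allₚ.++⁻ʳ a p)) ∷ rest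

filter-⊆ : ∀ {A : Set} {P : A → Set} (P? : Decidable P) a {b t} → t ∈ filter P? a ++ b → t ∈ a ++ b
filter-⊆ P? a t∈ with ∈-++⁻ (filter P? a) t∈
... | inj₁ p = ∈-++⁺ˡ (proj₁ (∈-filter⁻ P? {xs = a} p))
... | inj₂ p = ∈-++⁺ʳ a p

allPairs-filter : ∀ {A : Set} {R : A → A → Set} {P : A → Set} (P? : Decidable P) a {b} → AllPairs R (a ++ b) → AllPairs R (filter P? a ++ b)
allPairs-filter P? [] ps = ps
allPairs-filter P? (x ∷ a) (p ∷ ps) with P? x
... | yes _ = All.tabulate (λ y∈ → All.lookup p (filter-⊆ P? a y∈)) ∷ allPairs-filter P? a ps
... | no _ = allPairs-filter P? a ps

search : ∀ {A : Set} {P Q : A → Set} → (∀ i → P i ⊎ Q i) → ∀ l → (∀ {i} → i ∈ l → P i) ⊎ (∃ λ i → i ∈ l × Q i)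
search d [] = inj₁ λ ()
search d (x ∷ l) with d x | search d l
... | inj₂ q | _ = inj₂ (x , here ≡.refl , q)
... | inj₁ p | inj₂ (i , i∈ , q) = inj₂ (i , there i∈ , q)
... | inj₁ p | inj₁ ps = inj₁ λ { (here ≡.refl) → p ; (there i∈) → ps i∈ }

module Restriction {n} {M : CoxeterMatrix n} (weights : Weights M) where
  open CoxeterMatrix M
  open Coxeter M hiding ([_]; Pos)
  open Words M
  open Weights weights
  open Geometry weights
  open Roots weights
  open EulerForm weights
  open SortedWords M
  open Reaching weights
  open IntegerCoefficientSolver commutativeRing
  open import Data.List.Membership.DecPropositional (_≟_ {n}) using (_∈?_)
  open import Algebra.Properties.Group +-group using (⁻¹-involutive; ε⁻¹≈ε)

  -- The root b⁻¹ α i. For b minimal in W_J b and i in J these are the simple roots of b⁻¹ W_J b.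
  γ : Word n → Fin n → V
  γ b i = act (reverse b) (α i)

  γ-∷ʳ : ∀ b s i → γ (b ∷ʳ s) i ≡ s • γ b i
  γ-∷ʳ b s i = ≡.cong (λ x → act x (α i)) (Lₚ.reverse-++ b [ s ])

  conjugate : ∀ b {s t} → (b ++ s) ≈W (t ++ b) → (s ++ reverse b) ≈W (reverse b ++ t)
  conjugate b {s} {t} e = W.sym (W.trans
    (W.sym (W.trans (++-congˡW (reverse b) (++-congˡW t (reverse-inverseʳ b))) (W.reflexive (≡.cong (reverse b ++_) (Lₚ.++-identityʳ t)))))
    (W.trans (++-congˡW (reverse b) (W.trans (W.reflexive (≡.sym (Lₚ.++-assoc t b _))) (W.trans (++-congʳW (reverse b) (W.sym e)) (W.reflexive (Lₚ.++-assoc b s _)))))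
      (W.trans (W.reflexive (≡.sym (Lₚ.++-assoc (reverse b) b _))) (++-congʳW (s ++ reverse b) (reverse-inverseˡ b)))))

  conjugate′ : ∀ b {s t} → (s ++ reverse b) ≈W (reverse b ++ t) → (b ++ s) ≈W (t ++ b)
  conjugate′ b {s} {t} e = W.sym (≡.subst (λ d → (t ++ d) ≈W (d ++ s)) (Lₚ.reverse-involutive b) (conjugate (reverse b) (W.sym e)))

  hit-negative : ∀ b {s i} → (b ∷ʳ s) ≈W (i ∷ b) → Positive (γ b i) → Negative (s • γ b i)
  hit-negative b {s} {i} e p = Negative-resp (≋-sym (≋-trans (act-W (conjugate b {[ s ]} {[ i ]} e) (α i)) (act-∷ʳ-α (reverse b) i))) (Negative-⊖ {v = γ b i} p)

  negative-hit : ∀ b {s i} → Positive (γ b i) → Negative (s • γ b i) → (b ∷ʳ s) ≈W (i ∷ b)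
  negative-hit b {s} {i} p q = conjugate′ b {[ s ]} {[ i ]} (Exchange.commutes (exchange (reverse b) i s p q))

  -- Says that b is the shortest element of the coset W_J b.
  PositiveOn : List (Fin n) → Word n → Set
  PositiveOn J b = ∀ {i} → i ∈ J → Positive (γ b i)

  PositiveOn-[] : ∀ J → PositiveOn J []
  PositiveOn-[] J {i} _ = α-Positive i

  PositiveOn-≡ : ∀ {J b b′} → b ≡ b′ → PositiveOn J b → PositiveOn J b′
  PositiveOn-≡ ≡.refl p = p

  -- Reading a word from the minimal coset representative b of W_J b: a letter
  -- whose reflection lies in W_J is recorded in J, the others extend b.
  data Hits (J : List (Fin n)) : Word n → Word n → Word n → Word n → Set where
    nil  : ∀ {b} → Hits J b [] [] []
    hit  : ∀ {b s i u z e} → i ∈ J → (b ∷ʳ s) ≈W (i ∷ b) → Hits J b u z e → Hits J b (s ∷ u) (i ∷ z) e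
    miss : ∀ {b s u z e} → PositiveOn J (b ∷ʳ s) → Hits J (b ∷ʳ s) u z e → Hits J b (s ∷ u) z (s ∷ e)

  -- Deodhar's dichotomy for a minimal representative b: either s flips some b⁻¹ α i and then b s =
  -- i b, or b s is minimal again.
  hits : ∀ J b u → PositiveOn J b → ∃ λ z → ∃ λ e → Hits J b u z e
  hits J b [] p = [] , [] , nil
  hits J b (s ∷ u) p with search (λ i → sign (s ∷ reverse b) i) J
  ... | inj₂ (i , i∈ , neg) with hits J b u p
  ... | z , e , h = i ∷ z , e , hit i∈ (negative-hit b (p i∈) neg) h
  hits J b (s ∷ u) p | inj₁ pos = extend (hits J (b ∷ʳ s) u p′)
    where
    p′ : PositiveOn J (b ∷ʳ s)
    p′ {i} i∈ = ≡.subst Positive (≡.sym (γ-∷ʳ b s i)) (pos i∈)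
    extend : (∃ λ z → ∃ λ e → Hits J (b ∷ʳ s) u z e) → ∃ λ z → ∃ λ e → Hits J b (s ∷ u) z e
    extend (z , e , h) = z , s ∷ e , miss p′ h

  hits-W : ∀ {J b u z e} → Hits J b u z e → (b ++ u) ≈W (z ++ b ++ e)
  hits-W nil = W.refl
  hits-W (hit {b} {s} {i} {u} i∈ q h) = W.trans (W.reflexive (≡.sym (Lₚ.∷ʳ-++ b s u))) (W.trans (++-congʳW u q) (++-congˡW [ i ] (hits-W h)))
  hits-W (miss {b} {s} {u} {z} {e} p h) = W.trans (W.reflexive (≡.sym (Lₚ.∷ʳ-++ b s u))) (W.trans (hits-W h) (W.reflexive (≡.cong (z ++_) (Lₚ.∷ʳ-++ b s e))))

  hits-length : ∀ {J b u z e} → Hits J b u z e → length (z ++ e) ≡ length u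
  hits-length nil = ≡.refl
  hits-length (hit _ _ h) = ≡.cong suc (hits-length h)
  hits-length (miss {s = s} {z = z} {e} _ h) = ≡.trans (Lₚ.length-++ z) (≡.trans (ℕₚ.+-suc (length z) (length e)) (≡.cong suc (≡.trans (≡.sym (Lₚ.length-++ z)) (hits-length h))))

  hits-positive : ∀ {J b u z e} → PositiveOn J b → Hits J b u z e → PositiveOn J (b ++ e)
  hits-positive {b = b} p nil = PositiveOn-≡ (≡.sym (Lₚ.++-identityʳ b)) p
  hits-positive p (hit _ _ h) = hits-positive p h
  hits-positive p (miss {b} {s} {e = e} p′ h) = PositiveOn-≡ (Lₚ.∷ʳ-++ b s e) (hits-positive p′ h)

  hits-letters : ∀ {J b u z e} → Hits J b u z e → All (_∈ J) z
  hits-letters nil = []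
  hits-letters (hit i∈ _ h) = i∈ ∷ hits-letters h
  hits-letters (miss _ h) = hits-letters h

  hits-∷ʳ : ∀ {J b u z e s i} → Hits J b u z e → i ∈ J → ((b ++ e) ∷ʳ s) ≈W (i ∷ b ++ e) → Hits J b (u ∷ʳ s) (z ∷ʳ i) e
  hits-∷ʳ {b = b} {s = s} {i} nil i∈ q = hit i∈ (≡.subst (λ x → (x ∷ʳ s) ≈W (i ∷ x)) (Lₚ.++-identityʳ b) q) nil
  hits-∷ʳ (hit j∈ p h) i∈ q = hit j∈ p (hits-∷ʳ h i∈ q)
  hits-∷ʳ {s = s} {i} (miss {b} {t} {e = e} p h) i∈ q = miss p (hits-∷ʳ h i∈ (≡.subst (λ x → (x ∷ʳ s) ≈W (i ∷ x)) (≡.sym (Lₚ.∷ʳ-++ b t e)) q))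

  Positive-span : ∀ l x v → Positive v → Supported l v → (∀ {i} → i ∈ l → Positive (act x (α i))) → Positive (act x v)
  Positive-span [] x v p z h = Positive-resp (≋-sym (≋-trans (act-cong x (λ t → z λ ())) (act-zero x))) (λ t → nonneg-0)
  Positive-span (i ∷ l) x v p z h = Positive-resp (≋-sym (≋-trans (act-cong x decompose) (≋-trans (act-⊕ x (v i ⊙ α i) v′) (λ t → +-congʳ (act-⊙ x (v i) (α i) t)))))
    (Positive-⊕ (Positive-⊙ (p i) (h (here ≡.refl))) (Positive-span l x v′ p′ z′ (h ∘ there)))
    where
    v′ : V
    v′ t with i ≟ t
    ... | yes _ = 0#
    ... | no _ = v t
    decompose : v ≋ v i ⊙ α i ⊕ v′
    decompose t with i ≟ t
    ... | yes ≡.refl = solve 1 (λ a → a := a :* :1 :+ :0) refl (v i)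
    ... | no _ = solve 2 (λ a b → a := b :* :0 :+ a) refl (v t) (v i)
    p′ : Positive v′
    p′ t with i ≟ t
    ... | yes _ = nonneg-0
    ... | no _ = p t
    z′ : Supported l v′
    z′ {t} t∉ with i ≟ t
    ... | yes _ = refl
    ... | no ne = z λ { (here e) → ne (≡.sym e) ; (there q) → t∉ q }

  reflection-flips : ∀ a j → act (a ++ j ∷ reverse a) (act a (α j)) ≋ ⊖ act a (α j)
  reflection-flips a j = ≋-trans (≋-reflexive (act-++ a (j ∷ reverse a) _)) (≋-trans (act-cong a (≋-trans (•-cong j (act-inverse a (α j))) (•-α-same j))) (act-⊖ a (α j)))

  -- Let β be the positive root of the reflection. Were no b⁻¹ α i flipped by q, then both b⁻¹ β and
  -- q b⁻¹ β = -b⁻¹ β would be positive.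
  reflection-hit : ∀ J b q a j → PositiveOn J b → All (_∈ J) a → j ∈ J → (b ∷ʳ q) ≈W ((a ++ j ∷ reverse a) ++ b) → ∃ λ i → i ∈ J × (b ∷ʳ q) ≈W (i ∷ b)
  reflection-hit J b q a j pos a∈ j∈ e = cases (sign a j)
    where
    Supp-β : Supported J (act a (α j))
    Supp-β = Supported-act a∈ (Supported-α j∈)
    found : ∀ β → Positive β → Supported J β → act (a ++ j ∷ reverse a) β ≋ ⊖ β → ¬ act (reverse b) β ≋ zero-V → ∃ λ i → i ∈ J × (b ∷ʳ q) ≈W (i ∷ b)
    found β pβ sβ flips nz with search (λ i → sign (q ∷ reverse b) i) J
    ... | inj₂ (i , i∈ , neg) = i , i∈ , negative-hit b (pos i∈) neg
    ... | inj₁ qpos = ⊥-elim (nz λ t → nonneg-antisym (Positive-span J (reverse b) β pβ sβ pos t)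
        (Positive-resp flipped (Positive-span J (q ∷ reverse b) β pβ sβ qpos) t))
      where
      flipped : act (q ∷ reverse b) β ≋ ⊖ act (reverse b) β
      flipped = ≋-trans (act-W (conjugate b {[ q ]} e) β) (≋-trans (≋-reflexive (act-++ (reverse b) (a ++ j ∷ reverse a) β)) (≋-trans (act-cong (reverse b) flips) (act-⊖ (reverse b) β)))
    nonzero : ¬ act (reverse b) (act a (α j)) ≋ zero-V
    nonzero z = root-nonzero (reverse b ++ a) j (≋-trans (≋-reflexive (act-++ (reverse b) a (α j))) z)
    cases : Positive (act a (α j)) ⊎ Negative (act a (α j)) → ∃ λ i → i ∈ J × (b ∷ʳ q) ≈W (i ∷ b)
    cases (inj₁ p) = found (act a (α j)) p Supp-β (reflection-flips a j) nonzero
    cases (inj₂ p) = found (⊖ act a (α j)) p (λ t∉ → trans (-‿cong (Supp-β t∉)) ε⁻¹≈ε)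
      (≋-trans (act-⊖ (a ++ j ∷ reverse a) _) (λ t → -‿cong (reflection-flips a j t)))
      (λ z → nonzero (λ t → trans (sym (⁻¹-involutive _)) (trans (-‿cong (trans (sym (act-⊖ (reverse b) _ t)) (z t))) ε⁻¹≈ε)))

  -- Write d = z e with z in W_K and e minimal. The root e α k is still supported on K; minimality
  -- of e forces it to be positive, and since k e⁻¹ makes it negative, some q in K has e k = q e.
  -- Conjugate by z.
  supported-reflection : ∀ K d k → Supported K (act d (α k)) → ∃ λ z → ∃ λ q → All (_∈ K) z × q ∈ K × (d ∷ʳ k) ≈W ((z ++ q ∷ reverse z) ++ d)
  supported-reflection K d k supp with hits K [] d (PositiveOn-[] K)
  ... | z , e , h = cases (sign e k)
    where
    d≈ : d ≈W (z ++ e)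
    d≈ = hits-W h
    pos : PositiveOn K e
    pos = hits-positive (PositiveOn-[] K) h
    β : V
    β = act e (α k)
    β≋ : β ≋ act (reverse z) (act d (α k))
    β≋ = ≋-trans (≋-sym (act-inverse z β)) (act-cong (reverse z) (≋-trans (≋-reflexive (≡.sym (act-++ z e (α k)))) (≋-sym (act-W d≈ (α k)))))
    supp-β : Supported K β
    supp-β = Supported-resp (≋-sym β≋) (Supported-act (All.tabulate (λ t∈ → All.lookup (hits-letters h) (Anyₚ.reverse⁻ t∈))) supp)
    cases : Positive β ⊎ Negative β → _
    cases (inj₂ neg) = ⊥-elim (α-not-Negative k (Positive-resp (≋-trans (act-⊖ (reverse e) β) (λ t → -‿cong (act-inverse e (α k) t)))
      (Positive-span K (reverse e) (⊖ β) neg (λ t∉ → trans (-‿cong (supp-β t∉)) ε⁻¹≈ε) pos)))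
    cases (inj₁ p) with search (λ i → sign (k ∷ reverse e) i) K
    ... | inj₁ kpos = ⊥-elim (α-not-Negative k (Positive-resp (≋-trans (•-cong k (act-inverse e (α k))) (•-α-same k)) (Positive-span K (k ∷ reverse e) β p supp-β kpos)))
    ... | inj₂ (q , q∈ , neg) = z , q , hits-letters h , q∈ , (begin
        d ∷ʳ k                              ≈⟨ ++-congʳW [ k ] d≈ ⟩
        (z ++ e) ∷ʳ k                       ≡⟨ Lₚ.++-assoc z e [ k ] ⟩
        z ++ e ∷ʳ k                         ≈⟨ ++-congˡW z (negative-hit e (pos q∈) neg) ⟩
        z ++ q ∷ e                          ≈⟨ ++-congˡW z (++-congˡW [ q ] (++-congʳW e (reverse-inverseˡ z))) ⟨
        z ++ q ∷ (reverse z ++ z) ++ e      ≡⟨ ≡.cong (λ x → z ++ q ∷ x) (Lₚ.++-assoc (reverse z) z e) ⟩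
        z ++ q ∷ reverse z ++ z ++ e        ≡⟨ Lₚ.++-assoc z (q ∷ reverse z) (z ++ e) ⟨
        (z ++ q ∷ reverse z) ++ z ++ e      ≈⟨ ++-congˡW (z ++ q ∷ reverse z) d≈ ⟨
        (z ++ q ∷ reverse z) ++ d           ∎)
      where open ≈W-Reasoning

  -- The relation of `E-simple` for the transported roots, demanded only while both involve no
  -- letter outside the queue; beyond that the form says nothing about them.
  Ordered : List (Fin n) → Word n → Fin n → Fin n → Set
  Ordered c b i j = Supported c (γ b i) → Supported c (γ b j) → E c (γ b j) (γ b i) ≈ 0# × E c (γ b i) (γ b j) ≈ - C i j

  -- L lists, in an order compatible with c, the simple roots of b⁻¹ W_J b
  -- that can still be met; the others involve a letter not in c.
  record Frame (J L c : List (Fin n)) (b : Word n) : Set where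
    field
      unique-c : Unique c
      unique-L : Unique L
      L⊆J : ∀ {i} → i ∈ L → i ∈ J
      positive : PositiveOn J b
      ordered : AllPairs (Ordered c b) L
      dead : ∀ {i} → i ∈ J → i ∉ L → ¬ Supported c (γ b i)

  frame-drop : ∀ {J L b} a {t c} → Frame J L (a ++ t ∷ c) b → Frame J L (a ++ c) b
  frame-drop {b = b} a {t} {c} F = record
    { unique-c = proj₁ u ; unique-L = unique-L ; L⊆J = L⊆J ; positive = positive
    ; ordered = AllPairs.map (λ {i} {j} → step {i} {j}) ordered
    ; dead = λ {i} i∈ i∉ s → dead i∈ i∉ (up {i} s) }
    where
    open Frame F
    u = unique-middle a unique-c
    up : ∀ {i} → Supported (a ++ c) (γ b i) → Supported (a ++ t ∷ c) (γ b i)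
    up {i} = Supported-⊆ {v = γ b i} (∈-middle⁺ a)
    step : ∀ {i j} → Ordered (a ++ t ∷ c) b i j → Ordered (a ++ c) b i j
    step {i} {j} o si sj = let (p , q) = o (up {i} si) (up {j} sj) in
      trans (sym (E-drop a t c (γ b j) (γ b i) (sj (proj₂ u)) (si (proj₂ u)))) p , trans (sym (E-drop a t c (γ b i) (γ b j) (si (proj₂ u)) (sj (proj₂ u)))) q

  frame-swap : ∀ {J L b} a {s t c} → m s t ≡ 2 → Frame J L (a ++ t ∷ s ∷ c) b → Frame J L (a ++ s ∷ t ∷ c) b
  frame-swap {b = b} a {s} {t} {c} e F = record
    { unique-c = unique-swap a unique-c ; unique-L = unique-L ; L⊆J = L⊆J ; positive = positive
    ; ordered = AllPairs.map (λ {i} {j} → step {i} {j}) ordered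
    ; dead = λ {i} i∈ i∉ h → dead i∈ i∉ (up {i} h) }
    where
    open Frame F
    z : C s t ≈ 0#
    z = C-commute (unique-swap-≢ a (unique-swap a unique-c)) e
    up : ∀ {i} → Supported (a ++ s ∷ t ∷ c) (γ b i) → Supported (a ++ t ∷ s ∷ c) (γ b i)
    up {i} = Supported-⊆ {v = γ b i} (∈-swap a)
    step : ∀ {i j} → Ordered (a ++ t ∷ s ∷ c) b i j → Ordered (a ++ s ∷ t ∷ c) b i j
    step {i} {j} o si sj = let (p , q) = o (up {i} si) (up {j} sj) in
      trans (E-swap a s t c (γ b j) (γ b i) z) p , trans (E-swap a s t c (γ b i) (γ b j) z) q

  frame-miss : ∀ {J L r c b} → Frame J L (r ∷ c) b → PositiveOn J (b ∷ʳ r) → Frame J L (c ++ [ r ]) (b ∷ʳ r)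
  frame-miss {J} {L} {r} {c} {b} F p = record
    { unique-c = unique-rotate unique-c ; unique-L = unique-L ; L⊆J = L⊆J ; positive = p
    ; ordered = AllPairs.map (λ {i} {j} → step {i} {j}) ordered
    ; dead = λ {i} i∈ i∉ s → dead i∈ i∉ (down i s) }
    where
    open Frame F
    back : ∀ i → r • γ (b ∷ʳ r) i ≋ γ b i
    back i = ≋-trans (≋-reflexive (≡.cong (r •_) (γ-∷ʳ b r i))) (•-involutive r (γ b i))
    lower : ∀ i → Supported (c ++ [ r ]) (γ (b ∷ʳ r) i) → Supported (r ∷ c) (γ (b ∷ʳ r) i)
    lower i = Supported-⊆ {v = γ (b ∷ʳ r) i} (∈-unrotate c)
    down : ∀ i → Supported (c ++ [ r ]) (γ (b ∷ʳ r) i) → Supported (r ∷ c) (γ b i)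
    down i s = Supported-resp (back i) (Supported-• {v = γ (b ∷ʳ r) i} (here ≡.refl) (lower i s))
    forms : ∀ i j → Supported (c ++ [ r ]) (γ (b ∷ʳ r) i) → Supported (c ++ [ r ]) (γ (b ∷ʳ r) j) → E (c ++ [ r ]) (γ (b ∷ʳ r) j) (γ (b ∷ʳ r) i) ≈ E (r ∷ c) (γ b j) (γ b i)
    forms i j si sj = trans (sym (E-transport r c (γ (b ∷ʳ r) j) (γ (b ∷ʳ r) i) unique-c (lower j sj) (lower i si))) (E-cong (r ∷ c) (λ {t} _ → back j t) (λ {t} _ → back i t))
    step : ∀ {i j} → Ordered (r ∷ c) b i j → Ordered (c ++ [ r ]) (b ∷ʳ r) i j
    step {i} {j} o si sj = let (p , q) = o (down i si) (down j sj) in trans (forms i j si sj) p , trans (forms j i sj si) q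

  commutes? : ∀ i → Decidable (λ k → m i k ≡ 2)
  commutes? i k = m i k ℕₚ.≟ 2

  record HitFrame (J L : List (Fin n)) (r : Fin n) (c : List (Fin n)) (b : Word n) (i : Fin n) : Set where
    field
      before after : List (Fin n)
      split : L ≡ before ++ i ∷ after
    others : List (Fin n)
    others = filter (commutes? i) before ++ after
    field
      frame : Frame J (others ++ [ i ]) (c ++ [ r ]) b
      vanishes : ∀ {k} → k ∈ others → Supported (c ++ [ r ]) (γ b k) → γ b k r ≈ 0#

    others⊆L : ∀ {k} → k ∈ others → k ∈ L
    others⊆L k∈ = ≡.subst (_ ∈_) (≡.sym split) (∈-middle⁺ before (filter-⊆ (commutes? i) before k∈))

  -- As γ b i is a multiple g of α r, the form of γ b k with it is γ b k r * g. For k behind i this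
  -- is zero. For k before i it is nonnegative and also -κ k i, so k commutes with i or is dead and
  -- may be filtered out. The surviving roots thus vanish at r, and moving r to the back leaves
  -- their forms alone and puts i last.
  frame-hit : ∀ {J L r c b i} → Frame J L (r ∷ c) b → i ∈ J → (b ∷ʳ r) ≈W (i ∷ b) → HitFrame J L r c b i
  frame-hit {J} {L} {r} {c} {b} {i} F i∈J e with i ∈? L
  ... | no i∉L = ⊥-elim (Frame.dead F i∈J i∉L λ t∉ → Exchange.support (exchange (reverse b) i r (Frame.positive F i∈J) (hit-negative b e (Frame.positive F i∈J))) λ { ≡.refl → t∉ (here ≡.refl) })
  ... | yes i∈L with ∈-∃++ i∈L
  ... | before , after , ≡.refl = record
      { before = before ; after = after ; split = ≡.refl
      ; frame = record
        { unique-c = unique-rotate unique-c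
        ; unique-L = Uniqueₚ.++⁺ (allPairs-filter (commutes? i) before (proj₁ i-unique)) ([] ∷ []) (λ { (i∈ , here ≡.refl) → proj₂ i-unique (filter-⊆ (commutes? i) before i∈) })
        ; L⊆J = λ k∈ → L⊆J′ (∈-++⁻ others k∈)
        ; positive = positive
        ; ordered = AllPairsₚ.++⁺ (allPairs-map∈ (λ {k} {l} → rest {k} {l}) (allPairs-filter (commutes? i) before (proj₂ (proj₂ around)))) ([] ∷ []) (All.tabulate λ {k} k∈ → last {k} k∈ ∷ [])
        ; dead = dead′ }
      ; vanishes = vanishes }
    where
    open Frame F
    kept others : List (Fin n)
    kept = filter (commutes? i) before
    others = kept ++ after
    i-unique : Unique (before ++ after) × i ∉ before ++ after
    i-unique = unique-middle before unique-L
    around = allPairs-middle before ordered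
    open Exchange (exchange (reverse b) i r (positive i∈J) (hit-negative b e (positive i∈J)))
    g : Carrier
    g = γ b i r
    up : ∀ k → Supported (c ++ [ r ]) (γ b k) → Supported (r ∷ c) (γ b k)
    up k = Supported-⊆ {v = γ b k} (∈-unrotate c)
    supp-i : Supported (r ∷ c) (γ b i)
    supp-i t∉ = support λ { ≡.refl → t∉ (here ≡.refl) }
    first : ∀ k → E (r ∷ c) (γ b k) (γ b i) ≈ γ b k r * g
    first k = E-firstʳ (γ b k) (γ b i) unique-c support
    data Position (k : Fin n) : Set where
      earlier : m i k ≡ 2 → Ordered (r ∷ c) b k i → Position k
      later : Ordered (r ∷ c) b i k → Position k
    position : ∀ {k} → k ∈ others → Position k
    position {k} k∈ with ∈-++⁻ kept k∈
    ... | inj₁ p = earlier (proj₂ (∈-filter⁻ (commutes? i) {xs = before} p)) (All.lookup (proj₁ around) (proj₁ (∈-filter⁻ (commutes? i) {xs = before} p)))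
    ... | inj₂ p = later (All.lookup (proj₁ (proj₂ around)) p)
    neg-C : ∀ {k} → m i k ≡ 2 → - C k i ≈ 0#
    neg-C {k} e = trans (-‿cong (trans (C-sym k i) (C-commute (commute-≢ e) e))) ε⁻¹≈ε
    vanishes : ∀ {k} → k ∈ others → Supported (c ++ [ r ]) (γ b k) → γ b k r ≈ 0#
    vanishes {k} k∈ s with position k∈
    ... | earlier e o = cancel (trans (*-comm g _) (trans (sym (first k)) (trans (proj₂ (o (up k s) supp-i)) (neg-C e))))
    ... | later o = cancel (trans (*-comm g _) (trans (sym (first k)) (proj₁ (o supp-i (up k s)))))
    L⊆J′ : ∀ {k} → k ∈ others ⊎ k ∈ [ i ] → k ∈ J
    L⊆J′ (inj₁ k∈) = L⊆J (∈-middle⁺ before (filter-⊆ (commutes? i) before k∈))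
    L⊆J′ (inj₂ (here ≡.refl)) = i∈J
    forget : ∀ {k l} → γ b k r ≈ 0# → γ b l r ≈ 0# → E (c ++ [ r ]) (γ b k) (γ b l) ≈ E (r ∷ c) (γ b k) (γ b l)
    forget {k} {l} ek el = trans (E-drop c r [] (γ b k) (γ b l) ek el) (trans (reflexive (≡.cong (λ d → E d (γ b k) (γ b l)) (Lₚ.++-identityʳ c))) (sym (E-drop [] r c (γ b k) (γ b l) ek el)))
    rest : ∀ {k l} → k ∈ others → l ∈ others → Ordered (r ∷ c) b k l → Ordered (c ++ [ r ]) b k l
    rest {k} {l} k∈ l∈ o sk sl = let (p , q) = o (up k sk) (up l sl) in
      trans (forget {l} {k} (vanishes l∈ sl) (vanishes k∈ sk)) p , trans (forget {k} {l} (vanishes k∈ sk) (vanishes l∈ sl)) q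
    last : ∀ {k} → k ∈ others → Ordered (c ++ [ r ]) b k i
    last {k} k∈ sk si = trans (E-lastˡ (γ b i) (γ b k) unique-c support) (trans (*-congˡ (vanishes k∈ sk)) (zeroʳ _))
      , trans (E-lastʳ (γ b k) (γ b i) unique-c support) (trans (solve 3 (λ x g p → x :* g :- p :* g := g :* x :- g :* p) refl (γ b k r) g (pair c r (γ b k))) (trans (sym (E-firstˡ (γ b i) (γ b k) unique-c support)) (value (position k∈))))
      where
      value : Position k → E (r ∷ c) (γ b i) (γ b k) ≈ - C k i
      value (earlier e o) = trans (proj₁ (o (up k sk) supp-i)) (sym (neg-C e))
      value (later o) = trans (proj₂ (o supp-i (up k sk))) (-‿cong (C-sym i k))
    dead′ : ∀ {k} → k ∈ J → k ∉ others ++ [ i ] → ¬ Supported (c ++ [ r ]) (γ b k)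
    dead′ {k} k∈J k∉ s with k ∈? (before ++ i ∷ after)
    ... | no k∉L = dead k∈J k∉L (up k s)
    ... | yes k∈L with ∈-middle before k∈L
    ... | inj₁ ≡.refl = k∉ (∈-++⁺ʳ others (here ≡.refl))
    ... | inj₂ k∈′ with ∈-++⁻ before k∈′
    ... | inj₂ k∈after = k∉ (∈-++⁺ˡ (∈-++⁺ʳ kept k∈after))
    ... | inj₁ k∈before = k∉ (∈-++⁺ˡ (∈-++⁺ˡ (∈-filter⁺ (commutes? i) k∈before (κ≈0⇒commute i≢k (trans (κ-sym i k) κ≈0)))))
      where
      i≢k : i ≢ k
      i≢k ≡.refl = k∉ (∈-++⁺ʳ others (here ≡.refl))
      κ≈0 : κ k i ≈ 0#
      κ≈0 = nonneg-antisym (κ-nonneg₂ (i≢k ∘ ≡.sym)) (nonneg-resp (trans (sym (first k)) (trans (proj₂ (All.lookup (proj₁ around) k∈before (up k s) supp-i)) (-‿cong (reflexive (C-other (i≢k ∘ ≡.sym)))))) (nonneg-* (positive k∈J r) (positive i∈J r)))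

  restriction-sorted : ∀ {J L c b u z e} → WeaklySorted c u → Frame J L c b → Hits J b u z e → WeaklySorted L z
  restriction-sorted nil F nil = nil
  restriction-sorted (take d) F (miss p h) = restriction-sorted d (frame-miss F p) h
  restriction-sorted (drop a d) F h = restriction-sorted d (frame-drop a F) h
  restriction-sorted (swap a e d) F h = restriction-sorted d (frame-swap a e F) h
  -- Read i as if it were first in the queue, let it pass the kept earlier letters, all commuting
  -- with it, and then reinsert the letters filtered out.
  restriction-sorted (take d) F (hit {i = i} i∈ q h) = ≡.subst (λ l → WeaklySorted l _) (≡.sym split)
    (unfilter-sorted (commutes? i) [] before (i ∷ after) (move-right [] (filter (commutes? i) before) after (Allₚ.all-filter (commutes? i) before) (take (restriction-sorted d frame h))))
    where open HitFrame (frame-hit F i∈ q)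

-- Lifting equalities from W to the Artin monoid.

module Lifting {n} {M : CoxeterMatrix n} (weights : Weights M) where
  open CoxeterMatrix M
  open Coxeter M hiding ([_]; Pos)
  open Words M
  open Weights weights using (_≈_; 0#; trans; sym; -‿cong; +-group)
  open Geometry weights
  open Roots weights
  open EulerForm weights
  open SortedWords M
  open Reaching weights
  open Restriction weights
  open import Algebra.Properties.Group +-group using (⁻¹-involutive; ε⁻¹≈ε)

  left-extend : ∀ {v} → Red v → ∀ r → Red (r ∷ v) ⊎ (∃ λ x → ∃ λ s → ∃ λ y → v ≡ x ++ s ∷ y × Negative (r • act x (α s)))
  left-extend {v} rv r = go (reverseView v) rv
    where
    go : ∀ {v} → Reverse v → Red v → Red (r ∷ v) ⊎ (∃ λ x → ∃ λ s → ∃ λ y → v ≡ x ++ s ∷ y × Negative (r • act x (α s)))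
    go [] rv = inj₁ (Red-∷ʳ Red-[] (α-Positive r))
    go (v ∶ w ∶ʳ s) rv with go w (Red-prefix v rv)
    ... | inj₂ (x , t , y , e , neg) = inj₂ (x , t , y ∷ʳ s , ≡.trans (≡.cong (_∷ʳ s) e) (Lₚ.++-assoc x (t ∷ y) [ s ]) , neg)
    ... | inj₁ red with sign (r ∷ v) s
    ... | inj₁ p = inj₁ (Red-∷ʳ red p)
    ... | inj₂ p = inj₂ (v , s , [] , ≡.refl , p)

  -- Equality in W between the hit of i at the end of a reduced sorted word
  -- and its commuted form lifts to the braid monoid.
  Lift : List (Fin n) → Word n → Fin n → Set
  Lift c b i = ∀ x s → WeaklySorted c (x ∷ʳ s) → Red (x ∷ʳ s) → (b ++ x ∷ʳ s) ≈W (i ∷ b ++ x) → (b ++ x ∷ʳ s) ≈B (i ∷ b ++ x)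

  lift-[] : ∀ c i → Lift c [] i
  lift-[] c i x s d red e = B.sym (Red-≈W⇒≈B red (W.sym e) (≡.sym (length-∷ʳ x s)))

  lift-drop : ∀ a {t c b i} → Lift (a ++ t ∷ c) b i → Lift (a ++ c) b i
  lift-drop a l x s d = l x s (drop a d)

  lift-swap : ∀ a {s t c b i} → m s t ≡ 2 → Lift (a ++ t ∷ s ∷ c) b i → Lift (a ++ s ∷ t ∷ c) b i
  lift-swap a e l x s d = l x s (swap a e d)

  lift-hit : ∀ {r c b i} → Lift (r ∷ c) b i → (b ∷ʳ r) ≈W (i ∷ b) → (b ∷ʳ r) ≈B (i ∷ b)
  lift-hit {r} {c} {b} {i} l e = ≡.subst (λ x → (b ∷ʳ r) ≈B (i ∷ x)) (Lₚ.++-identityʳ b)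
    (l [] r (take nil) (Red-∷ʳ Red-[] (α-Positive r)) (≡.subst (λ x → (b ∷ʳ r) ≈W (i ∷ x)) (≡.sym (Lₚ.++-identityʳ b)) e))

  -- If r x s is reduced, the old hypothesis applies to r x. Otherwise some letter p of x s carries
  -- the reflection r, and `FinalLetter` moves it to the end of the word.
  lift-miss : ∀ {r c b i} → Unique (r ∷ c) → Lift (r ∷ c) b i → ¬ (b ∷ʳ r) ≈W (i ∷ b) → Lift (c ++ [ r ]) (b ∷ʳ r) i
  lift-miss {r} {c} {b} {i} u l ¬hit x s d red e with left-extend red r
  ... | inj₁ red′ = ≡.subst₂ _≈B_ (≡.sym (Lₚ.∷ʳ-++ b r (x ∷ʳ s))) (≡.cong (i ∷_) (≡.sym (Lₚ.∷ʳ-++ b r x)))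
      (l (r ∷ x) s (take d) red′ (≡.subst₂ _≈W_ (Lₚ.∷ʳ-++ b r (x ∷ʳ s)) (≡.cong (i ∷_) (Lₚ.∷ʳ-++ b r x)) e))
  ... | inj₂ (x′ , p , y , split , neg) with split-∷ʳ x x′ split
  -- Here p is s itself, so r x = x s in W, and the assumed equality becomes b = i b r: a hit after
  -- all.
  ... | inj₁ (≡.refl , ≡.refl , ≡.refl) = ⊥-elim (¬hit (W.sym hit′))
    where
    open FinalLetter u d red split neg using (commutes)
    open ≈W-Reasoning
    b≈ : b ≈W (i ∷ b ∷ʳ r)
    b≈ = cancelʳ-W x (begin
      b ++ x                    ≈⟨ ++-congˡW b (++-congʳW x (involution r)) ⟨
      b ++ r ∷ r ∷ x            ≡⟨ Lₚ.∷ʳ-++ b r (r ∷ x) ⟨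
      (b ∷ʳ r) ++ r ∷ x         ≈⟨ ++-congˡW (b ∷ʳ r) commutes ⟩
      (b ∷ʳ r) ++ x ∷ʳ s        ≈⟨ e ⟩
      i ∷ (b ∷ʳ r) ++ x         ∎)
    hit′ : (i ∷ b) ≈W (b ∷ʳ r)
    hit′ = begin
      i ∷ b                     ≡⟨ ≡.cong (i ∷_) (Lₚ.++-identityʳ b) ⟨
      i ∷ b ++ []               ≈⟨ ++-congˡW (i ∷ b) (involution r) ⟨
      i ∷ b ++ r ∷ r ∷ []       ≡⟨ ≡.cong (i ∷_) (Lₚ.∷ʳ-++ b r [ r ]) ⟨
      (i ∷ b ∷ʳ r) ∷ʳ r         ≈⟨ ++-congʳW [ r ] b≈ ⟨
      b ∷ʳ r                    ∎
  -- Move p to the end on both sides, lift the equality for r X s, and append p again.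
  ... | inj₂ (y′ , ≡.refl) = begin
      b⁺ ++ (x′ ++ p ∷ y′) ∷ʳ s          ≈⟨ ++-congˡB b⁺ whole ⟩
      b⁺ ++ ((X ∷ʳ s) ∷ʳ p)              ≡⟨ Lₚ.++-assoc b⁺ (X ∷ʳ s) [ p ] ⟨
      (b⁺ ++ X ∷ʳ s) ∷ʳ p                ≈⟨ ++-congʳB [ p ] lifted ⟩
      (i ∷ b⁺ ++ X) ∷ʳ p                 ≡⟨ Lₚ.++-assoc (i ∷ b⁺) X [ p ] ⟩
      i ∷ b⁺ ++ X ∷ʳ p                   ≈⟨ ++-congˡB (i ∷ b⁺) part ⟨
      i ∷ b⁺ ++ x′ ++ p ∷ y′             ∎
    where
    open ≈B-Reasoning
    open FinalLetter u d red split neg using (commutes; commuting; removed; extracted)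
    b⁺ X : Word n
    b⁺ = b ∷ʳ r
    X = x′ ++ y′
    y≡ : y ≡ y′ ∷ʳ s
    y≡ = Lₚ.∷-injectiveʳ (Lₚ.++-cancelˡ x′ (p ∷ y) (p ∷ y′ ∷ʳ s) (≡.trans (≡.sym split) (Lₚ.++-assoc x′ (p ∷ y′) [ s ])))
    X≡ : x′ ++ y ≡ X ∷ʳ s
    X≡ = ≡.trans (≡.cong (x′ ++_) y≡) (≡.sym (Lₚ.++-assoc x′ y′ [ s ]))
    whole : ((x′ ++ p ∷ y′) ∷ʳ s) ≈B ((X ∷ʳ s) ∷ʳ p)
    whole = ≡.subst₂ (λ a z → a ≈B (z ∷ʳ p)) (≡.sym split) X≡ extracted
    part : (x′ ++ p ∷ y′) ≈B (X ∷ʳ p)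
    part = B.trans (++-congˡB x′ (commute-past y′ (Allₚ.++⁻ˡ y′ (≡.subst (All _) y≡ commuting)))) (B.reflexive (≡.sym (Lₚ.++-assoc x′ y′ [ p ])))
    -- Because r x′ = x′ p in W, this word spells the same element as the given reduced word and has
    -- the same length.
    red′ : Red (r ∷ X ∷ʳ s)
    red′ = Red-by-length red (W.trans (W.reflexive (≡.cong (r ∷_) (≡.sym X≡))) (W.trans (++-congʳW y commutes) (W.reflexive (≡.trans (Lₚ.∷ʳ-++ x′ p y) (≡.sym split)))))
      (≡.sym (≡.trans (length-B whole) (length-∷ʳ (X ∷ʳ s) p)))
    premise : (b⁺ ++ X ∷ʳ s) ≈W (i ∷ b⁺ ++ X)
    premise = cancelʳ-W [ p ] (W.trans (W.reflexive (Lₚ.++-assoc b⁺ (X ∷ʳ s) [ p ])) (W.trans (++-congˡW b⁺ (W.sym (B⇒W whole)))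
      (W.trans e (W.trans (++-congˡW (i ∷ b⁺) (B⇒W part)) (W.reflexive (≡.sym (Lₚ.++-assoc (i ∷ b⁺) X [ p ])))))))
    lifted : (b⁺ ++ X ∷ʳ s) ≈B (i ∷ b⁺ ++ X)
    lifted = ≡.subst₂ _≈B_ (≡.sym (Lₚ.∷ʳ-++ b r (X ∷ʳ s))) (≡.cong (i ∷_) (≡.sym (Lₚ.∷ʳ-++ b r X)))
      (l (r ∷ X) s (take (≡.subst (WeaklySorted (c ++ [ r ])) X≡ removed)) red′ (≡.subst₂ _≈W_ (Lₚ.∷ʳ-++ b r (X ∷ʳ s)) (≡.cong (i ∷_) (Lₚ.∷ʳ-++ b r X)) premise))

  -- Cancelling b in W leaves r x = x s. These words have equal length and x s is reduced, so
  -- Matsumoto applies there, and only r has to cross b.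
  lift-hit-same : ∀ {r c b i} → Lift (r ∷ c) b i → (b ∷ʳ r) ≈W (i ∷ b) → Lift (c ++ [ r ]) b i
  lift-hit-same {r} {c} {b} {i} l q x s d red e = begin
    b ++ x ∷ʳ s        ≈⟨ ++-congˡB b (Red-≈W⇒≈B red r∷x≈ (≡.sym (length-∷ʳ x s))) ⟨
    b ++ r ∷ x         ≡⟨ Lₚ.∷ʳ-++ b r x ⟨
    (b ∷ʳ r) ++ x      ≈⟨ ++-congʳB x (lift-hit l q) ⟩
    i ∷ b ++ x         ∎
    where
    open ≈B-Reasoning
    r∷x≈ : (r ∷ x) ≈W (x ∷ʳ s)
    r∷x≈ = cancelˡ-W b (W.trans (W.reflexive (≡.sym (Lₚ.∷ʳ-++ b r x))) (W.trans (++-congʳW x q) (W.sym e)))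

  -- The hypothesis makes γ b k a multiple of act x (α s).
  supported-by-word : ∀ {c b x s k} → WeaklySorted c (x ∷ʳ s) → (b ++ x ∷ʳ s) ≈W (k ∷ b ++ x) → Supported c (γ b k)
  supported-by-word {c} {b} {x} {s} {k} d e = Supported-resp back (Supported-act (Allₚ.++⁻ˡ x (letters d)) ρ-supported)
    where
    B′ : Word n
    B′ = b ++ x
    ρ : V
    ρ = γ B′ k
    s∈ : s ∈ c
    s∈ = All.head (Allₚ.++⁻ʳ x (letters d))
    sρ : s • ρ ≋ ⊖ ρ
    sρ = ≋-trans (act-W (conjugate B′ {[ s ]} {[ k ]} (W.trans (W.reflexive (Lₚ.++-assoc b x [ s ])) e)) (α k)) (act-∷ʳ-α (reverse B′) k)
    ρ-supported : Supported c ρ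
    ρ-supported {t} t∉ with sign (reverse B′) k
    ... | inj₁ p = flipped-support {q = s} p (Negative-resp (≋-sym sρ) (Negative-⊖ {v = ρ} p)) (λ { ≡.refl → t∉ s∈ })
    ... | inj₂ p = trans (sym (⁻¹-involutive _)) (trans (-‿cong (flipped-support {q = s} {v = ⊖ ρ} p
          (Negative-resp (≋-sym (≋-trans (act-⊖ [ s ] ρ) (λ t → -‿cong (sρ t)))) (Negative-⊖ {v = ⊖ ρ} p)) (λ { ≡.refl → t∉ s∈ }))) ε⁻¹≈ε)
    back : act x ρ ≋ γ b k
    back = ≋-trans (≋-reflexive (≡.cong (λ z → act x (act z (α k))) (Lₚ.reverse-++ b x)))
      (≋-trans (act-cong x (≋-reflexive (act-++ (reverse x) (reverse b) (α k)))) (act-inverse′ x (γ b k)))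

  simple-frame : ∀ {c d} → Unique c → Unique d → AllPairs (Ordered c []) d → Frame d d c []
  simple-frame uc ud o = record
    { unique-c = uc ; unique-L = ud ; L⊆J = λ i∈ → i∈ ; positive = PositiveOn-[] _ ; ordered = o ; dead = λ i∈ i∉ → ⊥-elim (i∉ i∈) }

  simple-ordered : ∀ c → Unique c → AllPairs (Ordered c []) c
  simple-ordered c u = AllPairs.map (λ p _ _ → p) (E-simple c u)

  frame-without-first : ∀ {r c} → Unique (r ∷ c) → Frame c c (r ∷ c) []
  frame-without-first u@(_ ∷ u′) = simple-frame u u′ (AllPairs.tail (simple-ordered _ u))

  frame-without-last : ∀ {r c} → Unique (r ∷ c) → Frame c c (c ++ [ r ]) []
  frame-without-last {r} {c} u@(_ ∷ u′) = simple-frame (unique-rotate u) u′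
    (≡.subst (AllPairs _) (Lₚ.++-identityʳ c) (proj₂ (proj₂ (allPairs-middle c (simple-ordered (c ++ [ r ]) (unique-rotate u))))))

  -- With no coordinate at r, the root γ b k belongs to W_c. Split x = y f with y in W_c and f
  -- minimal; the reflection of the last letter s lies in W_c, so s becomes a letter s′ after y. The
  -- hypothesis applies to y s′, and f is appended on the right.
  lift-hit-other : ∀ {r c b k} → Unique (r ∷ c) → Lift (r ∷ c) b k → (Supported (c ++ [ r ]) (γ b k) → γ b k r ≈ 0#) → Lift (c ++ [ r ]) b k
  lift-hit-other {r} {c} {b} {k} u l vanishes x s d red e
    with supported-reflection c (reverse b) k supported | hits c [] x (PositiveOn-[] c)
    where
    supp : Supported (c ++ [ r ]) (γ b k)
    supp = supported-by-word {b = b} d e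
    supported : Supported c (γ b k)
    supported {t} t∉ with r ≟ t
    ... | yes ≡.refl = vanishes supp
    ... | no ne = supp λ t∈ → excluded (∈-++⁻ c t∈)
      where
      excluded : t ∈ c ⊎ t ∈ [ r ] → ⊥
      excluded (inj₁ t∈) = t∉ t∈
      excluded (inj₂ (here ≡.refl)) = ne ≡.refl
  ... | z , q , z∈ , q∈ , kb≈ | y , f , h with reflection-hit c f s (reverse y ++ z) q (hits-positive (PositiveOn-[] c) h) a∈ q∈ conjugated
    where
    open ≈W-Reasoning
    T : Word n
    T = z ++ q ∷ reverse z
    a∈ : All (_∈ c) (reverse y ++ z)
    a∈ = Allₚ.++⁺ (All.tabulate (λ t∈ → All.lookup (hits-letters h) (Anyₚ.reverse⁻ t∈))) z∈
    k∷b≈ : (b ++ T) ≈W (k ∷ b)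
    k∷b≈ = conjugate′ b {T} {[ k ]} (W.sym kb≈)
    xs≈ : (x ∷ʳ s) ≈W (T ++ x)
    xs≈ = cancelˡ-W b (begin
      b ++ x ∷ʳ s          ≈⟨ e ⟩
      (k ∷ b) ++ x         ≈⟨ ++-congʳW x k∷b≈ ⟨
      (b ++ T) ++ x        ≡⟨ Lₚ.++-assoc b T x ⟩
      b ++ T ++ x          ∎)
    conjugated : (f ∷ʳ s) ≈W (((reverse y ++ z) ++ q ∷ reverse (reverse y ++ z)) ++ f)
    conjugated = cancelˡ-W y (begin
      y ++ f ∷ʳ s                       ≡⟨ Lₚ.++-assoc y f [ s ] ⟨
      (y ++ f) ∷ʳ s                     ≈⟨ ++-congʳW [ s ] (hits-W h) ⟨
      x ∷ʳ s                            ≈⟨ xs≈ ⟩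
      T ++ x                            ≈⟨ ++-congˡW T (hits-W h) ⟩
      T ++ y ++ f                       ≈⟨ ++-congʳW (T ++ y ++ f) (reverse-inverseʳ y) ⟨
      (y ++ reverse y) ++ T ++ y ++ f   ≡⟨ Lₚ.++-assoc y (reverse y) (T ++ y ++ f) ⟩
      y ++ reverse y ++ T ++ y ++ f     ≡⟨ ≡.cong (y ++_) reassociate ⟩
      y ++ ((reverse y ++ z) ++ q ∷ reverse (reverse y ++ z)) ++ f ∎)
      where
      reassociate : reverse y ++ (z ++ q ∷ reverse z) ++ y ++ f ≡ ((reverse y ++ z) ++ q ∷ reverse (reverse y ++ z)) ++ f
      reassociate rewrite Lₚ.reverse-++ (reverse y) z | Lₚ.reverse-involutive y
        | Lₚ.++-assoc z (q ∷ reverse z) (y ++ f) | Lₚ.++-assoc (reverse y ++ z) (q ∷ reverse z ++ y) f | Lₚ.++-assoc (reverse z) y f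
        = ≡.sym (Lₚ.++-assoc (reverse y) z _)
  ... | s′ , s′∈ , hit′ = begin
      b ++ x ∷ʳ s                  ≈⟨ ++-congˡB b (Red-≈W⇒≈B red (W.sym (hits-W h⁺)) (hits-length h⁺)) ⟨
      b ++ y ∷ʳ s′ ++ f            ≡⟨ Lₚ.++-assoc b (y ∷ʳ s′) f ⟨
      (b ++ y ∷ʳ s′) ++ f          ≈⟨ ++-congʳB f (l y s′ sorted red-y premise) ⟩
      (k ∷ b ++ y) ++ f            ≡⟨ Lₚ.++-assoc (k ∷ b) y f ⟩
      k ∷ b ++ y ++ f              ≈⟨ ++-congˡB (k ∷ b) (Red-≈W⇒≈B (Red-prefix x red) (W.sym (hits-W h)) (hits-length h)) ⟩
      k ∷ b ++ x                   ∎
    where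
    open ≈B-Reasoning
    h⁺ : Hits c [] (x ∷ʳ s) (y ∷ʳ s′) f
    h⁺ = hits-∷ʳ h s′∈ hit′
    sorted : WeaklySorted (r ∷ c) (y ∷ʳ s′)
    -- The restricted word does not use r, so r may be put back at the front of the queue.
    sorted = drop [] (restriction-sorted d (frame-without-last u) h⁺)
    red-y : Red (y ∷ʳ s′)
    red-y = Red-prefix (y ∷ʳ s′) (Red-by-length red (W.sym (hits-W h⁺)) (hits-length h⁺))
    premise : (b ++ y ∷ʳ s′) ≈W (k ∷ b ++ y)
    premise = cancelʳ-W f (W.trans (W.reflexive (Lₚ.++-assoc b (y ∷ʳ s′) f)) (W.trans (++-congˡW b (W.sym (hits-W h⁺)))
      (W.trans e (W.trans (++-congˡW (k ∷ b) (hits-W h)) (W.reflexive (≡.sym (Lₚ.++-assoc (k ∷ b) y f)))))))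

  -- At a hit, `Lift` with empty x carries the letter across b. Its form for general x is what
  -- survives the growth of b and the rotation of the queue.
  restriction-prefix : ∀ {J L c b u z e} → WeaklySorted c u → Frame J L c b → (∀ {k} → k ∈ L → Lift c b k) → Hits J b u z e → (b ++ u) ≈B (z ++ b ++ e)
  restriction-prefix nil F l nil = B.refl
  restriction-prefix (drop a d) F l h = restriction-prefix d (frame-drop a F) (λ k∈ → lift-drop a (l k∈)) h
  restriction-prefix (swap a e d) F l h = restriction-prefix d (frame-swap a e F) (λ k∈ → lift-swap a e (l k∈)) h
  restriction-prefix {b = b} {z = z} (take {s = r} {w = u} d) F l (miss {e = e} p h) = begin
    b ++ r ∷ u               ≡⟨ Lₚ.∷ʳ-++ b r u ⟨
    (b ∷ʳ r) ++ u            ≈⟨ restriction-prefix d (frame-miss F p) (λ k∈ → lift-miss unique-c (l k∈) (¬hit (L⊆J k∈))) h ⟩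
    z ++ (b ∷ʳ r) ++ e       ≡⟨ ≡.cong (z ++_) (Lₚ.∷ʳ-++ b r e) ⟩
    z ++ b ++ r ∷ e          ∎
    where
    open ≈B-Reasoning
    open Frame F
    ¬hit : ∀ {k} → k ∈ _ → ¬ (b ∷ʳ r) ≈W (k ∷ b)
    ¬hit {k} k∈ q = ¬Positive∧Negative (r ∷ reverse b) k (≡.subst Positive (γ-∷ʳ b r k) (p k∈)) (hit-negative b q (positive k∈))
  restriction-prefix {J} {b = b} (take {s = r} {w = u} d) F l (hit {i = i} {z = z} {e} i∈ q h) = begin
    b ++ r ∷ u               ≡⟨ Lₚ.∷ʳ-++ b r u ⟨
    (b ∷ʳ r) ++ u            ≈⟨ ++-congʳB u (lift-hit (l i∈L) q) ⟩
    i ∷ b ++ u               ≈⟨ ++-congˡB [ i ] (restriction-prefix d frame l′ h) ⟩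
    i ∷ z ++ b ++ e          ∎
    where
    open ≈B-Reasoning
    open Frame F using (unique-c)
    open HitFrame (frame-hit F i∈ q)
    i∈L : i ∈ _
    i∈L = ≡.subst (i ∈_) (≡.sym split) (∈-++⁺ʳ before (here ≡.refl))
    l′ : ∀ {k} → k ∈ others ++ [ i ] → Lift _ b k
    l′ k∈ with ∈-++⁻ others k∈
    ... | inj₁ p = lift-hit-other unique-c (l (others⊆L p)) (vanishes p)
    ... | inj₂ (here ≡.refl) = lift-hit-same (l i∈L) q

-- Colored inversions as multiplicities of reflections.

module Counting {n} {M : CoxeterMatrix n} (weights : Weights M) where
  open CoxeterMatrix M
  open Coxeter M hiding ([_]; Pos)
  open Words M
  open Roots weights using (_≈W?_; next; alt-∷ʳ)

  bit : ∀ {P : Set} → Dec P → ℕ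
  bit (yes _) = 1
  bit (no _) = 0

  bit-yes : ∀ {P : Set} (d : Dec P) → P → bit d ≡ 1
  bit-yes (yes _) p = ≡.refl
  bit-yes (no ¬p) p = ⊥-elim (¬p p)

  bit-≤ : ∀ {P Q : Set} (d : Dec P) (e : Dec Q) → (P → Q) → bit d ≤ bit e
  bit-≤ (no _) e f = z≤n
  bit-≤ (yes p) e f = ℕₚ.≤-reflexive (≡.sym (bit-yes e (f p)))

  bit-≡ : ∀ {P Q : Set} (d : Dec P) (e : Dec Q) → (P → Q) → (Q → P) → bit d ≡ bit e
  bit-≡ d e f g = ℕₚ.≤-antisym (bit-≤ d e f) (bit-≤ e d g)

  sandwich : Fin n → Word n → Word n
  sandwich s τ = s ∷ τ ∷ʳ s

  sandwich-cong : ∀ s {τ τ′} → τ ≈W τ′ → sandwich s τ ≈W sandwich s τ′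
  sandwich-cong s e = ++-congˡW [ s ] (++-congʳW [ s ] e)

  sandwich-involutive : ∀ s τ → sandwich s (sandwich s τ) ≈W τ
  sandwich-involutive s τ = begin
    s ∷ s ∷ (τ ∷ʳ s) ∷ʳ s     ≈⟨ ++-congʳW ((τ ∷ʳ s) ∷ʳ s) (involution s) ⟩
    (τ ∷ʳ s) ∷ʳ s             ≡⟨ Lₚ.++-assoc τ [ s ] [ s ] ⟩
    τ ++ s ∷ s ∷ []           ≈⟨ ++-congˡW τ (involution s) ⟩
    τ ++ []                   ≡⟨ Lₚ.++-identityʳ τ ⟩
    τ                         ∎
    where open ≈W-Reasoning

  sandwich-swap : ∀ s {τ σ} → sandwich s τ ≈W σ → τ ≈W sandwich s σ
  sandwich-swap s {τ} e = W.trans (W.sym (sandwich-involutive s τ)) (sandwich-cong s e)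

  sandwich-self : ∀ s → sandwich s [ s ] ≈W [ s ]
  sandwich-self s = ++-congʳW [ s ] (involution s)

  -- The number of positions of w whose reflection s₁⋯sᵢ⋯s₁ is τ.
  count : Word n → Word n → ℕ
  count [] τ = 0
  count (s ∷ w) τ = bit (τ ≈W? [ s ]) ℕ.+ count w (sandwich s τ)

  count-cong : ∀ w {τ τ′} → τ ≈W τ′ → count w τ ≡ count w τ′
  count-cong [] e = ≡.refl
  count-cong (s ∷ w) e = ≡.cong₂ ℕ._+_ (bit-≡ (_ ≈W? _) (_ ≈W? _) (W.trans (W.sym e)) (W.trans e)) (count-cong w (sandwich-cong s e))

  conj : Word n → Word n → Word n
  conj x τ = reverse x ++ τ ++ x

  conj-∷ : ∀ s x τ → conj (s ∷ x) τ ≡ conj x (sandwich s τ)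
  conj-∷ s x τ = ≡.trans (≡.cong (_++ τ ++ s ∷ x) (Lₚ.unfold-reverse s x)) (≡.trans (Lₚ.++-assoc (reverse x) [ s ] (τ ++ s ∷ x))
    (≡.cong (λ y → reverse x ++ s ∷ y) (≡.sym (Lₚ.++-assoc τ [ s ] x))))

  count-++ : ∀ x y τ → count (x ++ y) τ ≡ count x τ ℕ.+ count y (conj x τ)
  count-++ [] y τ = ≡.cong (count y) (≡.sym (Lₚ.++-identityʳ τ))
  count-++ (s ∷ x) y τ = ≡.trans (≡.cong (bit (τ ≈W? [ s ]) ℕ.+_) (≡.trans (count-++ x y (sandwich s τ)) (≡.cong (λ σ → count x (sandwich s τ) ℕ.+ count y σ) (≡.sym (conj-∷ s x τ)))))
    (≡.sym (ℕₚ.+-assoc (bit (τ ≈W? [ s ])) _ _))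

  reverse-cong : ∀ {x y} → x ≈W y → reverse x ≈W reverse y
  reverse-cong {x} {y} e = cancelˡ-W x (W.trans (reverse-inverseʳ x) (W.sym (W.trans (++-congʳW (reverse y) e) (reverse-inverseʳ y))))

  conj-cong : ∀ {x y} τ → x ≈W y → conj x τ ≈W conj y τ
  conj-cong τ e = ++-congW (reverse-cong e) (++-congˡW τ e)

  sum< : ℕ → (ℕ → ℕ) → ℕ
  sum< zero f = 0
  sum< (suc k) f = f 0 ℕ.+ sum< k (f ∘ suc)

  sum<-last : ∀ k f → sum< (suc k) f ≡ sum< k f ℕ.+ f k
  sum<-last zero f = ℕₚ.+-identityʳ (f 0)
  sum<-last (suc k) f = ≡.trans (≡.cong (f 0 ℕ.+_) (sum<-last k (f ∘ suc))) (≡.sym (ℕₚ.+-assoc (f 0) _ _))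

  sum<-cong : ∀ k {f g} → (∀ i → f i ≡ g i) → sum< k f ≡ sum< k g
  sum<-cong zero e = ≡.refl
  sum<-cong (suc k) e = ≡.cong₂ ℕ._+_ (e 0) (sum<-cong k (e ∘ suc))

  sum<-reverse : ∀ k {f g} → (∀ i j → suc (i ℕ.+ j) ≡ k → f i ≡ g j) → sum< k f ≡ sum< k g
  sum<-reverse zero e = ≡.refl
  sum<-reverse (suc k) {f} {g} e = begin
    f 0 ℕ.+ sum< k (f ∘ suc)    ≡⟨ ≡.cong₂ ℕ._+_ (e 0 k ≡.refl) (sum<-reverse k (λ i j p → e (suc i) j (≡.cong suc p))) ⟩
    g k ℕ.+ sum< k g            ≡⟨ ℕₚ.+-comm (g k) _ ⟩
    sum< k g ℕ.+ g k            ≡⟨ sum<-last k g ⟨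
    sum< (suc k) g              ∎
    where open ≡.≡-Reasoning

  -- The reflection at position i, counted from 0, of an alternating word is alternating of this
  -- length.
  odd : ℕ → ℕ
  odd i = suc (i ℕ.+ i)

  next-double : ∀ i (a b : Fin n) → next a b (i ℕ.+ i) ≡ a
  next-double zero a b = ≡.refl
  next-double (suc i) a b rewrite ℕₚ.+-suc i i = next-double i a b

  alt-odd : ∀ a b i → alt a b (odd (suc i)) ≡ sandwich a (alt b a (odd i))
  alt-odd a b i = ≡.trans (alt-∷ʳ a b (suc i ℕ.+ suc i)) (≡.cong₂ _∷ʳ_ (≡.cong (λ k → a ∷ alt b a k) (ℕₚ.+-suc i i)) (next-double (suc i) a b))

  count-alt-sum : ∀ a b k τ → count (alt a b k) τ ≡ sum< k (λ i → bit (τ ≈W? alt a b (odd i)))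
  count-alt-sum a b zero τ = ≡.refl
  count-alt-sum a b (suc k) τ = ≡.cong (bit (τ ≈W? [ a ]) ℕ.+_) (≡.trans (count-alt-sum b a k (sandwich a τ))
    (sum<-cong k λ i → bit-≡ (_ ≈W? _) (_ ≈W? _)
      (λ e → ≡.subst (τ ≈W_) (≡.sym (alt-odd a b i)) (sandwich-swap a e))
      (λ e → W.sym (sandwich-swap a (W.sym (≡.subst (τ ≈W_) (alt-odd a b i) e))))))

  SameParity : ℕ → ℕ → Set
  SameParity p q = ∀ (a b : Fin n) → next a b p ≡ next a b q

  -- Appending the last letter of the right-hand word to both sides shifts one unit of length to the
  -- left; `SameParity` makes the two copies of that letter adjacent and equal on the right.
  alt-slide : ∀ s t q p → SameParity p q → alt s t p ≈W alt t s q → ∀ p′ q′ → p′ ℕ.+ q′ ≡ p ℕ.+ q → q′ ≤ q → alt s t p′ ≈W alt t s q′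
  alt-slide s t q p par e p′ q′ sum q′≤q with q ℕₚ.≟ q′
  ... | yes ≡.refl = ≡.subst (λ k → alt s t k ≈W alt t s q) (≡.sym (ℕₚ.+-cancelʳ-≡ q′ p′ p sum)) e
  alt-slide s t zero p par e p′ .zero sum z≤n | no ne = ⊥-elim (ne ≡.refl)
  alt-slide s t (suc q) p par e p′ q′ sum q′≤q | no ne =
    alt-slide s t q (suc p) (λ a b → par b a) step p′ q′ (≡.trans sum (ℕₚ.+-suc p q)) (ℕ.s≤s⁻¹ (ℕₚ.≤∧≢⇒< q′≤q (ne ∘ ≡.sym)))
    where
    open ≈W-Reasoning
    step : alt s t (suc p) ≈W alt t s q
    step = begin
      alt s t (suc p)                              ≡⟨ alt-∷ʳ s t p ⟩
      alt s t p ∷ʳ next s t p                      ≈⟨ ++-congʳW [ next s t p ] e ⟩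
      alt t s (suc q) ∷ʳ next s t p                ≡⟨ ≡.cong₂ _∷ʳ_ (alt-∷ʳ t s q) (par s t) ⟩
      (alt t s q ∷ʳ next t s q) ∷ʳ next t s q      ≡⟨ Lₚ.++-assoc (alt t s q) [ next t s q ] [ next t s q ] ⟩
      alt t s q ++ next t s q ∷ next t s q ∷ []    ≈⟨ ++-congˡW (alt t s q) (involution (next t s q)) ⟩
      alt t s q ++ []                              ≡⟨ Lₚ.++-identityʳ _ ⟩
      alt t s q                                    ∎

  alt-opposite : ∀ s t p q → p ℕ.+ q ≡ m s t ℕ.+ m s t → alt s t p ≈W alt t s q
  alt-opposite s t p q e with ℕₚ.≤-total q (m s t)
  ... | inj₁ q≤m = alt-slide s t (m s t) (m s t) (λ _ _ → ≡.refl) (B⇒W (alt-B s t)) p q e q≤m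
  ... | inj₂ m≤q = W.sym (alt-slide t s (m s t) (m s t) (λ _ _ → ≡.refl) (W.sym (B⇒W (alt-B s t))) q p (≡.trans (ℕₚ.+-comm q p) e)
      (ℕₚ.+-cancelʳ-≤ q p (m s t) (ℕₚ.≤-trans (ℕₚ.≤-reflexive e) (ℕₚ.+-monoʳ-≤ (m s t) m≤q))))

  -- The reflections of one side, read from left to right, are those of the other read from right to
  -- left: for i + j + 1 = m the lengths 2 i + 1 and 2 j + 1 add up to 2 m.
  count-braid : ∀ s t τ → count (alt s t (m s t)) τ ≡ count (alt t s (m s t)) τ
  count-braid s t τ = ≡.trans (count-alt-sum s t (m s t) τ) (≡.trans (sum<-reverse (m s t) opposite) (≡.sym (count-alt-sum t s (m s t) τ)))
    where
    total : ∀ i j → suc (i ℕ.+ j) ≡ m s t → odd i ℕ.+ odd j ≡ m s t ℕ.+ m s t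
    total i j e = ≡.trans (≡.trans (≡.cong suc (≡.trans (ℕₚ.+-suc (i ℕ.+ i) (j ℕ.+ j)) (≡.cong suc (interchange i i j j)))) (≡.cong suc (≡.sym (ℕₚ.+-suc (i ℕ.+ j) (i ℕ.+ j))))) (≡.cong₂ ℕ._+_ e e)
      where open import Algebra.Properties.CommutativeSemigroup ℕₚ.+-commutativeSemigroup using (interchange)
    opposite : ∀ i j → suc (i ℕ.+ j) ≡ m s t → bit (τ ≈W? alt s t (odd i)) ≡ bit (τ ≈W? alt t s (odd j))
    opposite i j e = bit-≡ (_ ≈W? _) (_ ≈W? _) (λ p → W.trans p same) (λ p → W.trans p (W.sym same))
      where
      same : alt s t (odd i) ≈W alt t s (odd j)
      same = alt-opposite s t (odd i) (odd j) (total i j e)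

  count-B : ∀ {w w′} → w ≈B w′ → ∀ τ → count w τ ≡ count w′ τ
  count-B = Eq.fold (record { refl = λ τ → ≡.refl ; sym = λ e τ → ≡.sym (e τ) ; trans = λ e f τ → ≡.trans (e τ) (f τ) }) step
    where
    step : ∀ {w w′} → BraidStep w w′ → ∀ τ → count w τ ≡ count w′ τ
    step (braid x y s t) τ = begin
      count (x ++ a ++ y) τ                                      ≡⟨ count-++ x (a ++ y) τ ⟩
      count x τ ℕ.+ count (a ++ y) σ                             ≡⟨ ≡.cong (count x τ ℕ.+_) (count-++ a y σ) ⟩
      count x τ ℕ.+ (count a σ ℕ.+ count y (conj a σ))           ≡⟨ ≡.cong (count x τ ℕ.+_) (≡.cong₂ ℕ._+_ (count-braid s t σ) (count-cong y (conj-cong σ (B⇒W (alt-B s t))))) ⟩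
      count x τ ℕ.+ (count a′ σ ℕ.+ count y (conj a′ σ))         ≡⟨ ≡.cong (count x τ ℕ.+_) (count-++ a′ y σ) ⟨
      count x τ ℕ.+ count (a′ ++ y) σ                            ≡⟨ count-++ x (a′ ++ y) τ ⟨
      count (x ++ a′ ++ y) τ                                     ∎
      where
      open ≡.≡-Reasoning
      a = alt s t (m s t)
      a′ = alt t s (m s t)
      σ = conj x τ

  count-≤R : ∀ {w u} → w ≤R u → ∀ τ → count w τ ≤ count u τ
  count-≤R {w} {u} (v , e) τ = ℕₚ.≤-trans (ℕₚ.m≤m+n (count w τ) (count v (conj w τ))) (ℕₚ.≤-reflexive (≡.trans (≡.sym (count-++ w v τ)) (count-B e τ)))

  -- Prefixing s adds the entry at s with color 0, raises the colors already present at s by one and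
  -- conjugates the other entries. So the colors at τ are 0, ..., count - 1; `count⇒inv` is the
  -- converse.
  inv⇒count : ∀ w {τ k} → InInv w (τ , k) → k < count w τ
  inv⇒count [] ([] , s , y , () , _)
  inv⇒count [] (_ ∷ _ , s , y , () , _)
  inv⇒count (s ∷ w) {τ} ([] , .s , .w , ≡.refl , (s≈τ , ≡.refl)) = ℕₚ.≤-trans (ℕₚ.≤-reflexive (≡.sym (bit-yes (τ ≈W? [ s ]) (W.sym s≈τ)))) (ℕₚ.m≤m+n _ _)
  inv⇒count (s ∷ w) {τ} (.s ∷ x , t , y , ≡.refl , ((τ′ , k) , ap , inj₁ (τ′≈s , τ≈τ′ , ≡.refl))) =
    ≡.subst (λ j → suc k < j ℕ.+ count w (sandwich s τ)) (≡.sym (bit-yes (τ ≈W? [ s ]) (W.trans τ≈τ′ τ′≈s)))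
      (s≤s (≡.subst (k <_) (count-cong w (W.trans τ′≈s (W.trans (W.sym (sandwich-self s)) (sandwich-cong s (W.sym (W.trans τ≈τ′ τ′≈s)))))) (inv⇒count w (x , t , y , ≡.refl , ap))))
  inv⇒count (s ∷ w) {τ} (.s ∷ x , t , y , ≡.refl , ((τ′ , k) , ap , inj₂ (_ , τ≈ , ≡.refl))) =
    ℕₚ.≤-trans (≡.subst (k <_) (count-cong w (W.sym (W.trans (sandwich-cong s τ≈) (sandwich-involutive s τ′)))) (inv⇒count w (x , t , y , ≡.refl , ap))) (ℕₚ.m≤n+m _ (bit (τ ≈W? [ s ])))

  count⇒inv : ∀ w {τ k} → k < count w τ → InInv w (τ , k)
  count⇒inv (s ∷ w) {τ} {k} lt with τ ≈W? [ s ]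
  count⇒inv (s ∷ w) {τ} {zero} lt | yes τ≈s = [] , s , w , ≡.refl , (W.sym τ≈s , ≡.refl)
  count⇒inv (s ∷ w) {τ} {suc k} (s≤s lt) | yes τ≈s with count⇒inv w lt
  ... | x , t , y , e , ap = s ∷ x , t , y , ≡.cong (s ∷_) e , ((sandwich s τ , k) , ap , inj₁ (fixed , W.trans τ≈s (W.sym fixed) , ≡.refl))
    where
    fixed : sandwich s τ ≈W [ s ]
    fixed = W.trans (sandwich-cong s τ≈s) (sandwich-self s)
  count⇒inv (s ∷ w) {τ} {k} lt | no τ≉s with count⇒inv w lt
  ... | x , t , y , e , ap = s ∷ x , t , y , ≡.cong (s ∷_) e
      , ((sandwich s τ , k) , ap , inj₂ ((λ p → τ≉s (W.trans (sandwich-swap s p) (sandwich-self s))) , W.sym (sandwich-involutive s τ) , ≡.refl))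

-- Common lower bounds of sorted words.

module Meets {n} (M : CoxeterMatrix n) where
  weights : Weights M
  weights = coxeterWeights M

  open CoxeterMatrix M
  open Coxeter M hiding ([_]; Pos)
  open Words M
  open Roots weights using (_≈W?_; ¬Positive∧Negative; Positive)
  open SortedWords M
  open Restriction weights
  open Lifting weights
  open Counting weights

  InParabolic : List (Fin n) → Word n → Set
  InParabolic J τ = ∃ λ a → ∃ λ j → All (_∈ J) a × j ∈ J × τ ≈W (a ++ j ∷ reverse a)

  sandwich-parabolic : ∀ {J i τ} → i ∈ J → InParabolic J τ → InParabolic J (sandwich i τ)
  sandwich-parabolic {i = i} i∈ (a , j , a∈ , j∈ , e) = i ∷ a , j , i∈ ∷ a∈ , j∈ , W.trans (sandwich-cong i e)
    (W.reflexive (≡.cong (i ∷_) (≡.trans (Lₚ.++-assoc a (j ∷ reverse a) [ i ]) (≡.cong (λ x → a ++ j ∷ x) (≡.sym (Lₚ.unfold-reverse i a))))))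

  parabolic-resp : ∀ {J τ σ} → τ ≈W σ → InParabolic J σ → InParabolic J τ
  parabolic-resp e (a , j , a∈ , j∈ , f) = a , j , a∈ , j∈ , W.trans e f

  count-parabolic : ∀ {J} w {τ} → All (_∈ J) w → 0 < count w τ → InParabolic J τ
  count-parabolic (s ∷ w) {τ} (s∈ ∷ w∈) lt with τ ≈W? [ s ]
  ... | yes e = [] , s , [] , s∈ , e
  ... | no _ = parabolic-resp (W.sym (sandwich-involutive s τ)) (sandwich-parabolic s∈ (count-parabolic w w∈ lt))

  conj-hit : ∀ b {s i} τ → (b ∷ʳ s) ≈W (i ∷ b) → sandwich s (conj b τ) ≈W conj b (sandwich i τ)
  conj-hit b {s} {i} τ q = begin
    s ∷ (reverse b ++ τ ++ b) ∷ʳ s            ≡⟨ ≡.cong (s ∷_) (≡.trans (Lₚ.++-assoc (reverse b) (τ ++ b) [ s ]) (≡.cong (reverse b ++_) (Lₚ.++-assoc τ b [ s ]))) ⟩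
    (s ∷ reverse b) ++ τ ++ b ∷ʳ s            ≈⟨ ++-congW (conjugate b {[ s ]} {[ i ]} q) (++-congˡW τ q) ⟩
    (reverse b ∷ʳ i) ++ τ ++ i ∷ b            ≡⟨ Lₚ.∷ʳ-++ (reverse b) i (τ ++ i ∷ b) ⟩
    reverse b ++ i ∷ τ ++ i ∷ b               ≡⟨ ≡.cong (λ x → reverse b ++ i ∷ x) (Lₚ.++-assoc τ [ i ] b) ⟨
    reverse b ++ (i ∷ τ ∷ʳ i) ++ b            ∎
    where open ≈W-Reasoning

  conj-miss : ∀ b s τ → sandwich s (conj b τ) ≡ conj (b ∷ʳ s) τ
  conj-miss b s τ = ≡.trans (≡.cong (s ∷_) (≡.trans (Lₚ.++-assoc (reverse b) (τ ++ b) [ s ]) (≡.cong (reverse b ++_) (Lₚ.++-assoc τ b [ s ]))))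
    (≡.cong (_++ τ ++ b ∷ʳ s) (≡.sym (Lₚ.reverse-++ b [ s ])))

  conj-simple : ∀ b {s} τ → conj b τ ≈W [ s ] → (b ∷ʳ s) ≈W (τ ++ b)
  conj-simple b τ e = W.sym (cancelˡ-W (reverse b) (W.trans e (W.sym (W.trans (W.reflexive (≡.sym (Lₚ.++-assoc (reverse b) b _))) (++-congʳW _ (reverse-inverseˡ b))))))

  -- A hit contributes matching reflections to both sides, up to conjugation by b. A miss
  -- contributes nothing, since with a reflection in W_J it would be a hit by `reflection-hit`.
  hits-count : ∀ {J b u z e} → Hits J b u z e → PositiveOn J b → ∀ {τ} → InParabolic J τ → count u (conj b τ) ≤ count z τ
  hits-count nil p h = z≤n
  hits-count (hit {b} {s} {i} {u} {z} i∈ q h) p {τ} τ∈ = ℕₚ.+-mono-≤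
    (bit-≤ (_ ≈W? _) (_ ≈W? _) λ e → cancelʳ-W b (W.trans (W.sym (conj-simple b τ e)) q))
    (≡.subst (_≤ count z (sandwich i τ)) (≡.sym (count-cong u (conj-hit b τ q))) (hits-count h p (sandwich-parabolic i∈ τ∈)))
  hits-count {J} (miss {b} {s} {u} {z} p′ h) p {τ} τ∈@(a , j , a∈ , j∈ , τ≈) with conj b τ ≈W? [ s ]
  ... | no _ = ≡.subst (λ σ → count u σ ≤ count z τ) (≡.sym (conj-miss b s τ)) (hits-count h p′ τ∈)
  ... | yes e with reflection-hit J b s a j p a∈ j∈ (W.trans (conj-simple b τ e) (++-congʳW b τ≈))
  ... | i , i∈ , q = ⊥-elim (¬Positive∧Negative (s ∷ reverse b) i (≡.subst Positive (γ-∷ʳ b s i) (p′ i∈)) (hit-negative b q (p i∈)))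

  restrict : ∀ {r c u} → Unique (r ∷ c) → Sorted (r ∷ c) u → ∃ λ z → Sorted c z × z ≤R u × (∀ τ → InParabolic c τ → count u τ ≤ count z τ)
  restrict {r} {c} {u} uc d with hits c [] u (PositiveOn-[] c)
  ... | z , e , h with weaklySorted⇒sorted (restriction-sorted (sorted⇒weaklySorted d) (frame-without-first uc) h)
  ... | z′ , d′ , z≈z′ = z′ , d′
      , (e , B.trans (++-congʳB e (B.sym z≈z′)) (B.sym (restriction-prefix (sorted⇒weaklySorted d) (frame-without-first uc) (λ {k} _ → lift-[] (r ∷ c) k) h)))
      , λ τ τ∈ → ≡.subst₂ _≤_ (count-cong u (W.reflexive (Lₚ.++-identityʳ τ))) (count-B z≈z′ τ) (hits-count h (PositiveOn-[] c) τ∈)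

  ≤R-trans : ∀ {x y z} → x ≤R y → y ≤R z → x ≤R z
  ≤R-trans {x} (v , e) (v′ , e′) = v ++ v′ , B.trans (B.reflexive (≡.sym (Lₚ.++-assoc x v v′))) (B.trans (++-congʳB v′ e) e′)

  ≤R-∷ : ∀ s {x y} → x ≤R y → (s ∷ x) ≤R (s ∷ y)
  ≤R-∷ s (v , e) = v , ++-congˡB [ s ] e

  LowerBound : Word n → Word n → Set
  LowerBound w u = ∃ λ z → z ≤R w × z ≤R u × (∀ τ → count w τ ⊓ count u τ ≤ count z τ)

  LowerBound-sym : ∀ {w u} → LowerBound w u → LowerBound u w
  LowerBound-sym {w} {u} (z , z≤w , z≤u , h) = z , z≤u , z≤w , λ τ → ≡.subst (_≤ count z τ) (ℕₚ.⊓-comm (count w τ) (count u τ)) (h τ)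

  -- As w uses only letters of c, reflections outside W_c have multiplicity 0 in w, so replacing u
  -- by u′ costs nothing in the minimum.
  parabolic-lowerBound : ∀ {c w u u′} → All (_∈ c) w → u′ ≤R u → (∀ τ → InParabolic c τ → count u τ ≤ count u′ τ) → LowerBound w u′ → LowerBound w u
  parabolic-lowerBound {c} {w} {u} {u′} w∈ u′≤u more (z , z≤w , z≤u′ , h) = z , z≤w , ≤R-trans z≤u′ u′≤u , bound
    where
    bound : ∀ τ → count w τ ⊓ count u τ ≤ count z τ
    bound τ with count w τ in eq
    ... | zero = z≤n
    ... | suc k = ℕₚ.≤-trans (ℕₚ.⊓-monoʳ-≤ (suc k) (more τ (count-parabolic w w∈ (≡.subst (0 <_) (≡.sym eq) (s≤s z≤n))))) (≡.subst (λ j → j ⊓ count u′ τ ≤ count z τ) eq (h τ))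

  sorted-letters : ∀ {c w} → Sorted c w → All (_∈ c) w
  sorted-letters d = letters (sorted⇒weaklySorted d)

  -- The length of c drops whenever its first letter is discarded; reading that letter in both words
  -- rotates c but shortens the words. If only one word reads it, that word is replaced by its
  -- restriction.
  lowerBound : ∀ k {c w u} → length c ≡ k → Unique c → Sorted c w → Sorted c u → LowerBound w u
  lowerBound k l uc nil du = [] , (_ , B.refl) , (_ , B.refl) , λ τ → z≤n
  lowerBound k l uc (take _) nil = [] , (_ , B.refl) , (_ , B.refl) , λ τ → ℕₚ.≤-reflexive (ℕₚ.⊓-zeroʳ _)
  lowerBound k l uc (skip _) nil = [] , (_ , B.refl) , (_ , B.refl) , λ τ → ℕₚ.≤-reflexive (ℕₚ.⊓-zeroʳ _)
  lowerBound k l uc (take {s} {c} {w} dw) (take {w = u} du) with lowerBound k (≡.trans (length-++-∷ʳ) l) (unique-rotate uc) dw du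
    where
    length-++-∷ʳ : length (c ++ [ s ]) ≡ suc (length c)
    length-++-∷ʳ = ≡.trans (Lₚ.length-++ c) (ℕₚ.+-comm (length c) 1)
  ... | z , z≤w , z≤u , h = s ∷ z , ≤R-∷ s z≤w , ≤R-∷ s z≤u , λ τ →
      ≡.subst (_≤ count (s ∷ z) τ) (ℕₚ.+-distribˡ-⊓ (bit (τ ≈W? [ s ])) (count w (sandwich s τ)) (count u (sandwich s τ))) (ℕₚ.+-monoʳ-≤ (bit (τ ≈W? [ s ])) (h (sandwich s τ)))
  lowerBound zero () uc (skip _) (skip _)
  lowerBound zero () uc (skip _) (take _)
  lowerBound zero () uc (take _) (skip _)
  lowerBound (suc k) l uc@(_ ∷ uc′) (skip dw) (skip du) = lowerBound k (ℕₚ.suc-injective l) uc′ dw du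
  lowerBound (suc k) l uc@(_ ∷ uc′) (skip dw) du@(take _) with restrict uc du
  ... | u′ , du′ , u′≤u , more = parabolic-lowerBound (sorted-letters dw) u′≤u more (lowerBound k (ℕₚ.suc-injective l) uc′ dw du′)
  lowerBound (suc k) l uc@(_ ∷ uc′) dw@(take _) (skip du) with restrict uc dw
  ... | w′ , dw′ , w′≤w , more = LowerBound-sym (parabolic-lowerBound (sorted-letters du) w′≤w more (lowerBound k (ℕₚ.suc-injective l) uc′ du dw′))

  no-reflections : ∀ v → (∀ τ → count v τ ≡ 0) → v ≡ []
  no-reflections [] h = ≡.refl
  no-reflections (s ∷ v) h with ≡.trans (≡.sym (bit-yes ([ s ] ≈W? [ s ]) W.refl)) (ℕₚ.m+n≡0⇒m≡0 _ (h [ s ]))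
  ... | ()

  conj-inverse : ∀ x τ → conj x (x ++ τ ++ reverse x) ≈W τ
  conj-inverse x τ = begin
    reverse x ++ (x ++ τ ++ reverse x) ++ x     ≡⟨ ≡.cong (reverse x ++_) (≡.trans (Lₚ.++-assoc x (τ ++ reverse x) x) (≡.cong (x ++_) (Lₚ.++-assoc τ (reverse x) x))) ⟩
    reverse x ++ x ++ τ ++ reverse x ++ x       ≡⟨ Lₚ.++-assoc (reverse x) x _ ⟨
    (reverse x ++ x) ++ τ ++ reverse x ++ x     ≈⟨ ++-congW (reverse-inverseˡ x) (++-congˡW τ (reverse-inverseˡ x)) ⟩
    τ ++ []                                     ≡⟨ Lₚ.++-identityʳ τ ⟩
    τ                                           ∎
    where open ≈W-Reasoning

  ≤R-antisym-count : ∀ {z w} → z ≤R w → (∀ τ → count w τ ≤ count z τ) → w ≈B z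
  ≤R-antisym-count {z} {w} (v , e) h with no-reflections v empty
    where
    empty : ∀ τ → count v τ ≡ 0
    empty τ = ≡.trans (count-cong v (W.sym (conj-inverse z τ))) (ℕₚ.n≤0⇒n≡0 (ℕₚ.+-cancelˡ-≤ (count z σ) _ 0
      (≡.subst₂ _≤_ (≡.trans (≡.sym (count-B e σ)) (count-++ z v σ)) (≡.sym (ℕₚ.+-identityʳ _)) (h σ))))
      -- Conjugating this σ by z gives τ, so `count-++` isolates the multiplicity of τ in v.
      where σ = z ++ τ ++ reverse z
  ... | ≡.refl = B.trans (B.sym e) (B.reflexive (Lₚ.++-identityʳ z))

-- From positions in the infinite word to the queue process.

module Positions {n} (M : CoxeterMatrix n) (c : Fin n → Fin n) where
  open Coxeter M hiding ([_])
  open SortedWords M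

  label : Pos → Fin n
  label (k , i) = c i

  code-suc : ∀ k i → code (suc k , i) ≡ n ℕ.+ code (k , i)
  code-suc k i = ℕₚ.+-assoc n (k ℕ.* n) (toℕ i)

  code-mono : ∀ {k k′} i → k ≤ k′ → code (k , i) ≤ code (k′ , i)
  code-mono i l = ℕₚ.+-monoˡ-≤ (toℕ i) (ℕₚ.*-monoˡ-≤ n l)

  code-cancel : ∀ {k k′} i → code (k , i) < code (k′ , i) → k < k′
  code-cancel {k} {k′} i l with k ℕₚ.<? k′
  ... | yes p = p
  ... | no ¬p = ⊥-elim (ℕₚ.<⇒≱ l (code-mono i (ℕₚ.≮⇒≥ ¬p)))

  increasing-tail : ∀ {p ps} → Increasing (p ∷ ps) → Increasing ps
  increasing-tail Coxeter.[ p ] = []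
  increasing-tail (l ∷ inc) = inc

  increasing-head : ∀ {p ps q} → Increasing (p ∷ ps) → q ∈ ps → code p < code q
  increasing-head (l ∷ inc) (here ≡.refl) = l
  increasing-head (l ∷ inc) (there q∈) = ℕₚ.<-trans l (increasing-head inc q∈)

  -- Q lists the next position of each letter that is still in use.
  record Queue (Q ps : List Pos) : Set where
    field
      increasing : AllPairs (λ p q → code p < code q) Q
      window : ∀ {p q} → p ∈ Q → q ∈ Q → code p < n ℕ.+ code q
      covers : ∀ {k i} → (k , i) ∈ ps → ∃ λ k₀ → k₀ ≤ k × (k₀ , i) ∈ Q
      closed : ∀ {k i k₀} → (suc k , i) ∈ ps → (k₀ , i) ∈ Q → k₀ ≤ k → (k , i) ∈ ps

  descend-to : ∀ {Q ps k₀ i} → Queue Q ps → (k₀ , i) ∈ Q → ∀ k → k₀ ≤ k → (k , i) ∈ ps → (k₀ , i) ∈ ps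
  descend-to {k₀ = k₀} q k₀∈ k l k∈ with k₀ ℕₚ.≟ k
  ... | yes ≡.refl = k∈
  descend-to q k₀∈ zero z≤n k∈ | no ne = ⊥-elim (ne ≡.refl)
  descend-to q k₀∈ (suc k) l k∈ | no ne = descend-to q k₀∈ k l′ (Queue.closed q k∈ k₀∈ l′)
    where l′ = ℕ.s≤s⁻¹ (ℕₚ.≤∧≢⇒< l ne)

  -- The position p is not before its own queue entry, hence not before the head p₀; every position
  -- after p in an increasing list is then too late to be p₀.
  absent : ∀ {p₀ Q p ps} → Queue (p₀ ∷ Q) (p ∷ ps) → Increasing (p ∷ ps) → p ≢ p₀ → p₀ ∉ p ∷ ps
  absent q inc ne (here e) = ne (≡.sym e)
  absent {p = k , i} q inc ne (there p₀∈) with Queue.covers q (here ≡.refl)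
  ... | _ , l , here ≡.refl = ℕₚ.<⇒≱ (increasing-head inc p₀∈) (code-mono i l)
  ... | _ , l , there k₀∈ = ℕₚ.<⇒≱ (increasing-head inc p₀∈) (ℕₚ.<⇒≤ (ℕₚ.<-≤-trans (All.lookup (AllPairs.head (Queue.increasing q)) k₀∈) (code-mono i l)))

  -- Sortability enters here: by `closed` a later copy of a letter forces the present one, so a
  -- letter passed over never returns and may leave the queue.
  skip-queue : ∀ {p₀ Q ps} → Queue (p₀ ∷ Q) ps → p₀ ∉ ps → Queue Q ps
  skip-queue {p₀} {Q} {ps} q p₀∉ = record
    { increasing = AllPairs.tail increasing
    ; window = λ p∈ p′∈ → window (there p∈) (there p′∈)
    ; covers = covers′
    ; closed = λ k∈ k₀∈ → closed k∈ (there k₀∈) }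
    where
    open Queue q
    covers′ : ∀ {k i} → (k , i) ∈ ps → ∃ λ k₀ → k₀ ≤ k × (k₀ , i) ∈ Q
    covers′ {k} k∈ with covers k∈
    ... | _ , l , here ≡.refl = ⊥-elim (p₀∉ (descend-to q (here ≡.refl) k l k∈))
    ... | k₀ , l , there k₀∈ = k₀ , l , k₀∈

  -- By `window` the queue spans less than one period, so the next copy of the head, n positions
  -- later, follows all other entries and goes to the back.
  take-queue : ∀ {k i Q ps} → Increasing ((k , i) ∷ ps) → Queue ((k , i) ∷ Q) ((k , i) ∷ ps) → Queue (Q ++ (suc k , i) ∷ []) ps
  take-queue {k} {i} {Q} {ps} inc q = record
    { increasing = AllPairsₚ.++⁺ (AllPairs.tail increasing) ([] ∷ []) (All.tabulate λ {p} p∈ → ≡.subst (code p <_) (≡.sym (code-suc k i)) (window (there p∈) (here ≡.refl)) ∷ [])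
    ; window = λ p∈ p′∈ → window′ (∈-++⁻ Q p∈) (∈-++⁻ Q p′∈)
    ; covers = covers′
    ; closed = λ k∈ k₀∈ → closed′ k∈ (∈-++⁻ Q k₀∈) }
    where
    open Queue q
    first : ∀ {p} → p ∈ Q → code (k , i) < code p
    first p∈ = All.lookup (AllPairs.head increasing) p∈
    window′ : ∀ {p p′} → p ∈ Q ⊎ p ∈ (suc k , i) ∷ [] → p′ ∈ Q ⊎ p′ ∈ (suc k , i) ∷ [] → code p < n ℕ.+ code p′
    window′ (inj₁ p∈) (inj₁ p′∈) = window (there p∈) (there p′∈)
    window′ (inj₁ p∈) (inj₂ (here ≡.refl)) = ℕₚ.<-≤-trans (window (there p∈) (here ≡.refl)) (ℕₚ.+-monoʳ-≤ n (code-mono i (ℕₚ.n≤1+n k)))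
    window′ {p′ = p′} (inj₂ (here ≡.refl)) (inj₁ p′∈) = ≡.subst (_< n ℕ.+ code p′) (≡.sym (code-suc k i)) (ℕₚ.+-monoʳ-< n (first p′∈))
    window′ (inj₂ (here ≡.refl)) (inj₂ (here ≡.refl)) = ≡.subst (_< n ℕ.+ code (suc k , i)) (≡.sym (code-suc k i)) (ℕₚ.+-monoʳ-< n (ℕₚ.<-≤-trans (window (here ≡.refl) (here ≡.refl)) (ℕₚ.≤-reflexive (≡.sym (code-suc k i)))))
    covers′ : ∀ {k′ i′} → (k′ , i′) ∈ ps → ∃ λ k₀ → k₀ ≤ k′ × (k₀ , i′) ∈ Q ++ (suc k , i) ∷ []
    covers′ k′∈ with covers (there k′∈)
    ... | _ , l , here ≡.refl = suc k , code-cancel i (increasing-head inc k′∈) , ∈-++⁺ʳ Q (here ≡.refl)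
    ... | k₀ , l , there k₀∈ = k₀ , l , ∈-++⁺ˡ k₀∈
    closed′ : ∀ {k′ i′ k₀} → (suc k′ , i′) ∈ ps → (k₀ , i′) ∈ Q ⊎ (k₀ , i′) ∈ (suc k , i) ∷ [] → k₀ ≤ k′ → (k′ , i′) ∈ ps
    closed′ k′∈ (inj₁ k₀∈) l with closed (there k′∈) (there k₀∈) l
    ... | here ≡.refl = ⊥-elim (ℕₚ.<⇒≱ (first k₀∈) (code-mono i l))
    ... | there r = r
    closed′ k′∈ (inj₂ (here ≡.refl)) l with closed (there k′∈) (here ≡.refl) (ℕₚ.≤-trans (ℕₚ.n≤1+n k) l)
    ... | here ≡.refl = ⊥-elim (ℕₚ.1+n≰n l)
    ... | there r = r

  queue⇒sorted : ∀ ps Q → Increasing ps → Queue Q ps → Sorted (map label Q) (spell c ps)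
  queue⇒sorted [] Q inc q = nil
  queue⇒sorted ((k , i) ∷ ps) Q inc q = go Q q
    where
    go : ∀ Q → Queue Q ((k , i) ∷ ps) → Sorted (map label Q) (spell c ((k , i) ∷ ps))
    go [] q with Queue.covers q (here ≡.refl)
    ... | _ , _ , ()
    go (p₀ ∷ Q) q with ≡-dec ℕₚ._≟_ _≟_ (k , i) p₀
    ... | no ne = skip (go Q (skip-queue q (absent q inc ne)))
    ... | yes ≡.refl = take (≡.subst (λ l → Sorted l (spell c ps)) (Lₚ.map-++ label Q ((suc k , i) ∷ []))
        (queue⇒sorted ps (Q ++ (suc k , i) ∷ []) (increasing-tail inc) (take-queue inc q)))

  sortable⇒sorted : ∀ {w} → Sortable c w → ∃ λ w′ → Sorted (tabulate c) w′ × w′ ≈B w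
  sortable⇒sorted (ps , (inc , ps≈w , _) , closed) = spell c ps
    , ≡.subst (λ l → Sorted l (spell c ps)) (Lₚ.map-tabulate (0 ,_) label) (queue⇒sorted ps (tabulate (0 ,_)) inc initial) , ps≈w
    where
    initial : Queue (tabulate (0 ,_)) ps
    initial = record
      { increasing = AllPairsₚ.tabulate⁺-< (λ i<j → i<j)
      ; window = window
      ; covers = λ {k} {i} _ → 0 , z≤n , ∈-tabulate⁺ i
      ; closed = λ {k} {i} k∈ _ _ → closed k i k∈ }
      where
      window : ∀ {p q} → p ∈ tabulate (0 ,_) → q ∈ tabulate (0 ,_) → code p < n ℕ.+ code q
      window p∈ q∈ with ∈-tabulate⁻ p∈
      ... | i , ≡.refl = ℕₚ.<-≤-trans (Finₚ.toℕ<n i) (ℕₚ.m≤m+n n _)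

mainTheorem7 : ∀ {n} (M : CoxeterMatrix n) → let open Coxeter M in
    (c : Fin n → Fin n) → Injective _≡_ _≡_ c →
    (w0 : Word n) → IsLongest w0 →
    (m : ℕ) (w u : Word n) → InSortm c w0 m w → InSortm c w0 m u →
    ((w ≤R u → (∀ r → InInv w r → InInv u r)) ×
    ((∀ r → InInv w r → InInv u r) → w ≤R u)) ×
    (∀ z → IsMeet z w u →
    ∀ r → (InInv z r → InInv w r × InInv u r) × (InInv w r × InInv u r → InInv z r))
mainTheorem7 M c c-injective w0 _ _ w u (sortable-w , _) (sortable-u , _)
  with Positions.sortable⇒sorted M c sortable-w | Positions.sortable⇒sorted M c sortable-u
... | w′ , sorted-w , w′≈w | u′ , sorted-u , u′≈u = (monotone , reflects) , meets
  where
  open Coxeter M hiding ([_])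
  open Words M using (module B)
  open Meets M
  open Counting weights
  bound : LowerBound w′ u′
  bound = lowerBound _ ≡.refl (Uniqueₚ.tabulate⁺ c-injective) sorted-w sorted-u
  z = proj₁ bound
  ≤R-w : z ≤R w
  ≤R-w = ≤R-trans (proj₁ (proj₂ bound)) ([] , B.trans (B.reflexive (Lₚ.++-identityʳ w′)) w′≈w)
  ≤R-u : z ≤R u
  ≤R-u = ≤R-trans (proj₁ (proj₂ (proj₂ bound))) ([] , B.trans (B.reflexive (Lₚ.++-identityʳ u′)) u′≈u)
  minimum : ∀ τ → count w τ ⊓ count u τ ≤ count z τ
  minimum τ = ≡.subst₂ (λ a b → a ⊓ b ≤ count z τ) (count-B w′≈w τ) (count-B u′≈u τ) (proj₂ (proj₂ (proj₂ bound)) τ)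
  monotone : ∀ {x y} → x ≤R y → ∀ r → InInv x r → InInv y r
  monotone {x} {y} x≤y (τ , k) p = count⇒inv y (ℕₚ.<-≤-trans (inv⇒count x p) (count-≤R x≤y τ))
  reflects : (∀ r → InInv w r → InInv u r) → w ≤R u
  reflects h = ≤R-trans ([] , B.trans (B.reflexive (Lₚ.++-identityʳ w)) (≤R-antisym-count ≤R-w below)) ≤R-u
    where
    below-u : ∀ τ → count w τ ≤ count u τ
    below-u τ with count w τ in eq
    ... | zero = z≤n
    ... | suc k = inv⇒count u (h (τ , k) (count⇒inv w (ℕₚ.≤-reflexive (≡.sym eq))))
    -- The inclusion makes `count w τ` the minimum, so z has at least the reflections of w and
    -- equals it.
    below : ∀ τ → count w τ ≤ count z τ
    below τ = ℕₚ.≤-trans (ℕₚ.≤-reflexive (≡.sym (ℕₚ.m≤n⇒m⊓n≡m (below-u τ)))) (minimum τ)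
  meets : ∀ z′ → IsMeet z′ w u → ∀ r → (InInv z′ r → InInv w r × InInv u r) × (InInv w r × InInv u r → InInv z′ r)
  meets z′ (z′≤w , z′≤u , greatest) (τ , k) = (λ p → monotone z′≤w (τ , k) p , monotone z′≤u (τ , k) p)
    -- A meet lies above the lower bound `z`, hence inherits the common inversions that `z` has.
    , λ { (p , q) → monotone (greatest z ≤R-w ≤R-u) (τ , k) (count⇒inv z (ℕₚ.<-≤-trans (ℕₚ.⊓-glb (inv⇒count w p) (inv⇒count u q)) (minimum τ))) }
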